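{- For the 8.8.4 lattice, the entropy constant $\eta=\lim_{m,n\to\infty} f(m,n)^{1/(4mn-2m-2n)}$ exists and satisfies $$1.467007628\le \eta\le 1.549560102 .$$
   Context: For integers $m,n\ge 2$ the 8.8.4 lattice graph $G_{m,n}$ (a finite part of the tiling of the plane with vertex type 8.8.4) is built from squares indexed by $(a,b)$, $1\le a\le m$, $1\le b\le n$, with vertices $U(a,b)$ (present iff $a\ge 2$), $D(a,b)$ (present iff $a\le m-1$), $L(a,b)$ (present iff $b\ge 2$), $R(a,b)$ (present iff $b\le n-1$). Edges: for each $(a,b)$, each of $U(a,b),D(a,b)$ is adjacent to each of $L(a,b),R(a,b)$ (when present); $D(a,b)$ is adjacent to $U(a+1,b)$ for $1\le a\le m-1$; $R(a,b)$ is adjacent to $L(a,b+1)$ for $1\le b\le n-1$. There are no other edges. $G_{m,n}$ has $4mn-2m-2n$ vertices. $f(m,n)$ is its number of independent sets (the empty set included), and the limit is the double limit with $m,n\to\infty$ independently. -}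

module Defs where

import Algebra.Definitions.RawSemiring as RawSemiringDefinitions
open import Data.Integer.Base using (+_)
open import Data.List.Base
  using (List; []; _∷_; _++_; map; filter; length; cartesianProduct; applyUpTo)
open import Data.List.Relation.Unary.All using ([]; _∷_)
open import Data.List.Relation.Unary.AllPairs using (AllPairs; []; _∷_; allPairs?)
open import Data.List.Relation.Unary.Unique.Propositional using (Unique)
open import Data.List.Relation.Unary.Unique.Propositional.Properties
  using (cartesianProduct⁺; filter⁺; applyUpTo⁺₁)
open import Data.Nat.Base as ℕ using (ℕ; zero; suc; NonZero; _∸_)
import Data.Nat.Properties as ℕ
open import Data.Nat.Tactic.RingSolver using (solve-∀)
open import Data.Product using (∃; _×_; _,_)
open import Data.Rational.Base
  using (ℚ; 0ℚ; 1ℚ; _+_; _-_; -_; _*_; 1/_; _/_; _<_; _≤_; _⊓_; _⊔_;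
         Positive; NonNegative; positive; nonNegative; normalize; +-*-rawSemiring)
open import Data.Rational.Properties
open import Data.Sum.Base using (_⊎_; inj₁; inj₂)
open import Level using (0ℓ)
open import Relation.Binary.Construct.Closure.Symmetric
  using (SymClosure; fwd; bwd; symmetric)
open import Relation.Binary.Core using (Rel)
open import Relation.Binary.Definitions using (Decidable; Symmetric)
open import Relation.Binary.PropositionalEquality
  using (_≡_; refl; sym; trans; cong; subst)
open import Relation.Nullary using (¬_; yes; no; contradiction)
open import Relation.Nullary.Decidable using (¬?; map′; _×-dec_; _⊎-dec_)
import Relation.Unary as Unary

open RawSemiringDefinitions +-*-rawSemiring using (_^_) public

-- The vertex set is the set of entries of `vertices`, which need not exhaust
-- `V`; only the restriction of `_∼_` to it matters.
record FiniteGraph : Set₁ where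
  infix 4 _∼_ _∼?_
  field
    V        : Set
    vertices : List V
    unique   : Unique vertices
    _∼_      : Rel V 0ℓ
    _∼?_     : Decidable _∼_
    ∼-sym    : Symmetric _∼_
    ∼-irrefl : ∀ {v} → ¬ (v ∼ v)

-- The sublists of a duplicate-free list represent each subset of its
-- entries exactly once.
sublists : {A : Set} → List A → List (List A)
sublists []       = [] ∷ []
sublists (x ∷ xs) = sublists xs ++ map (x ∷_) (sublists xs)

module _ (G : FiniteGraph) where
  open FiniteGraph G

  Independent : List V → Set
  Independent = AllPairs (λ u v → ¬ (u ∼ v))

  independent? : Unary.Decidable Independent
  independent? = allPairs? (λ u v → ¬? (u ∼? v))

  numIndependentSets : ℕ
  numIndependentSets = length (filter independent? (sublists vertices))

data Corner : Set where
  U D L R : Corner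

-- (a , b , c) is the corner c of the square (a , b).
Vertex : Set
Vertex = ℕ × ℕ × Corner

HasCorner : (m n : ℕ) → Vertex → Set
HasCorner m n (a , b , U) = 2 ℕ.≤ a
HasCorner m n (a , b , D) = a ℕ.≤ m ∸ 1
HasCorner m n (a , b , L) = 2 ℕ.≤ b
HasCorner m n (a , b , R) = b ℕ.≤ n ∸ 1

hasCorner? : ∀ m n → Unary.Decidable (HasCorner m n)
hasCorner? m n (a , b , U) = 2 ℕ.≤? a
hasCorner? m n (a , b , D) = a ℕ.≤? m ∸ 1
hasCorner? m n (a , b , L) = 2 ℕ.≤? b
hasCorner? m n (a , b , R) = b ℕ.≤? n ∸ 1

oneTo : ℕ → List ℕ
oneTo = applyUpTo suc

corners : List Corner
corners = U ∷ D ∷ L ∷ R ∷ []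

latticeVertices : (m n : ℕ) → List Vertex
latticeVertices m n =
  filter (hasCorner? m n)
    (cartesianProduct (oneTo m) (cartesianProduct (oneTo n) corners))

data Edge : Rel Vertex 0ℓ where
  UL : ∀ {a b} → Edge (a , b , U) (a , b , L)
  UR : ∀ {a b} → Edge (a , b , U) (a , b , R)
  DL : ∀ {a b} → Edge (a , b , D) (a , b , L)
  DR : ∀ {a b} → Edge (a , b , D) (a , b , R)
  DU : ∀ {a b} → Edge (a , b , D) (suc a , b , U)
  RL : ∀ {a b} → Edge (a , b , R) (a , suc b , L)

unique-oneTo : ∀ n → Unique (oneTo n)
unique-oneTo n = applyUpTo⁺₁ suc n λ i<j _ eq → ℕ.<⇒≢ i<j (ℕ.suc-injective eq)

unique-corners : Unique corners
unique-corners =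
  ((λ ()) ∷ (λ ()) ∷ (λ ()) ∷ []) ∷ ((λ ()) ∷ (λ ()) ∷ []) ∷
  ((λ ()) ∷ []) ∷ [] ∷ []

unique-vertices : ∀ m n → Unique (latticeVertices m n)
unique-vertices m n = filter⁺ (hasCorner? m n)
  (cartesianProduct⁺ (unique-oneTo m)
    (cartesianProduct⁺ (unique-oneTo n) unique-corners))

edge? : Decidable Edge
edge? (a , b , U) (a′ , b′ , U) = no λ ()
edge? (a , b , U) (a′ , b′ , D) = no λ ()
edge? (a , b , U) (a′ , b′ , L) = map′ (λ { (refl , refl) → UL }) (λ { UL → refl , refl }) (a ℕ.≟ a′ ×-dec b ℕ.≟ b′)
edge? (a , b , U) (a′ , b′ , R) = map′ (λ { (refl , refl) → UR }) (λ { UR → refl , refl }) (a ℕ.≟ a′ ×-dec b ℕ.≟ b′)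
edge? (a , b , D) (a′ , b′ , U) = map′ (λ { (refl , refl) → DU }) (λ { DU → refl , refl }) (suc a ℕ.≟ a′ ×-dec b ℕ.≟ b′)
edge? (a , b , D) (a′ , b′ , D) = no λ ()
edge? (a , b , D) (a′ , b′ , L) = map′ (λ { (refl , refl) → DL }) (λ { DL → refl , refl }) (a ℕ.≟ a′ ×-dec b ℕ.≟ b′)
edge? (a , b , D) (a′ , b′ , R) = map′ (λ { (refl , refl) → DR }) (λ { DR → refl , refl }) (a ℕ.≟ a′ ×-dec b ℕ.≟ b′)
edge? (a , b , L) (a′ , b′ , U) = no λ ()
edge? (a , b , L) (a′ , b′ , D) = no λ ()
edge? (a , b , L) (a′ , b′ , L) = no λ ()
edge? (a , b , L) (a′ , b′ , R) = no λ ()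
edge? (a , b , R) (a′ , b′ , U) = no λ ()
edge? (a , b , R) (a′ , b′ , D) = no λ ()
edge? (a , b , R) (a′ , b′ , L) = map′ (λ { (refl , refl) → RL }) (λ { RL → refl , refl }) (a ℕ.≟ a′ ×-dec suc b ℕ.≟ b′)
edge? (a , b , R) (a′ , b′ , R) = no λ ()

symClosure? : Decidable (SymClosure Edge)
symClosure? x y = map′ (λ { (inj₁ e) → fwd e ; (inj₂ e) → bwd e })
  (λ { (fwd e) → inj₁ e ; (bwd e) → inj₂ e }) (edge? x y ⊎-dec edge? y x)

latticeGraph : (m n : ℕ) → FiniteGraph
latticeGraph m n = record
  { V        = Vertex
  ; vertices = latticeVertices m n
  ; unique   = unique-vertices m n
  ; _∼_      = SymClosure Edge
  ; _∼?_     = symClosure?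
  ; ∼-sym    = symmetric Edge
  ; ∼-irrefl = λ { (fwd ()) ; (bwd ()) }
  }

f : (m n : ℕ) → ℕ
f m n = numIndependentSets (latticeGraph m n)

-- `Lower q` means q < x and `Upper q` means x < q.
record ℝ : Set₁ where
  field
    Lower Upper     : ℚ → Set
    lower-inhabited : ∃ Lower
    upper-inhabited : ∃ Upper
    lower-closed    : ∀ {q r} → q < r → Lower r → Lower q
    upper-closed    : ∀ {q r} → q < r → Upper q → Upper r
    lower-open      : ∀ {q} → Lower q → ∃ λ r → q < r × Lower r
    upper-open      : ∀ {r} → Upper r → ∃ λ q → q < r × Upper q
    disjoint        : ∀ {q} → Lower q → ¬ Upper q
    located         : ∀ {q r} → q < r → Lower q ⊎ Upper r

open ℝ public

infix 4 _≤ᴿ_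
_≤ᴿ_ : Rel ℝ 0ℓ
x ≤ᴿ y = ∀ q → Lower x q → Lower y q

-- The two components say x < y + ε and y < x + ε.
∣_-_∣<_ : ℝ → ℝ → ℚ → Set
∣ x - y ∣< ε =
  (∃ λ q → Upper x q × Lower y (q - ε)) × (∃ λ q → Upper y q × Lower x (q - ε))

below : ∀ q → ∃ λ p → p < q
below q = q - 1ℚ , subst (q - 1ℚ <_) (+-identityʳ q)
  (+-monoʳ-< q {(- 1ℚ)} {0ℚ} (negative⁻¹ (- 1ℚ)))

above : ∀ q → q < q + 1ℚ
above q = subst (_< q + 1ℚ) (+-identityʳ q) (+-monoʳ-< q (positive⁻¹ 1ℚ))

split : ∀ {q r} → q < r → ∀ p → q < p ⊎ p < r
split {q} q<r p with q <? p
... | yes q<p = inj₁ q<p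
... | no  q≮p = inj₂ (≤-<-trans (≮⇒≥ q≮p) q<r)

fromℚ : ℚ → ℝ
fromℚ p = record
  { Lower           = _< p
  ; Upper           = p <_
  ; lower-inhabited = below p
  ; upper-inhabited = p + 1ℚ , above p
  ; lower-closed    = <-trans
  ; upper-closed    = λ q<r p<q → <-trans p<q q<r
  ; lower-open      = <-dense
  ; upper-open      = λ p<r → let q , p<q , q<r = <-dense p<r in q , q<r , p<q
  ; disjoint        = <-asym
  ; located         = λ q<r → split q<r p
  }

pow-nonNeg : ∀ k {q} → 0ℚ ≤ q → 0ℚ ≤ q ^ k
pow-nonNeg zero    _       = nonNegative⁻¹ 1ℚ
pow-nonNeg (suc k) {q} 0≤q =
  subst (_≤ q * q ^ k) (*-zeroʳ q)
    (*-monoˡ-≤-nonNeg q {{nonNegative 0≤q}} (pow-nonNeg k 0≤q))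

*-mono-≤ : ∀ {p q r s} → 0ℚ ≤ q → 0ℚ ≤ r → p ≤ q → r ≤ s → p * r ≤ q * s
*-mono-≤ {p} {q} {r} {s} 0≤q 0≤r p≤q r≤s = ≤-trans
  (*-monoʳ-≤-nonNeg r {{nonNegative 0≤r}} p≤q)
  (*-monoˡ-≤-nonNeg q {{nonNegative 0≤q}} r≤s)

pow-mono-≤ : ∀ k {q r} → 0ℚ ≤ q → q ≤ r → q ^ k ≤ r ^ k
pow-mono-≤ zero    _   _   = ≤-refl
pow-mono-≤ (suc k) 0≤q q≤r =
  *-mono-≤ (≤-trans 0≤q q≤r) (pow-nonNeg k 0≤q) q≤r (pow-mono-≤ k 0≤q q≤r)

pow-pos : ∀ k {q} → 0ℚ < q → 0ℚ < q ^ k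
pow-pos zero    _       = positive⁻¹ 1ℚ
pow-pos (suc k) {q} 0<q =
  subst (_< q * q ^ k) (*-zeroʳ q)
    (*-monoʳ-<-pos q {{positive 0<q}} (pow-pos k 0<q))

pow-mono-< : ∀ k .{{_ : NonZero k}} {q r} → 0ℚ ≤ q → q < r → q ^ k < r ^ k
pow-mono-< (suc k) {q} {r} 0≤q q<r = ≤-<-trans
  (*-monoˡ-≤-nonNeg q {{nonNegative 0≤q}} (pow-mono-≤ k 0≤q (<⇒≤ q<r)))
  (*-monoˡ-<-pos (r ^ k) {{positive (pow-pos k (≤-<-trans 0≤q q<r))}} q<r)

module _ (s : ℚ) (0<s : 0ℚ < s) where
  private instance
    s-pos : Positive s
    s-pos = positive 0<s
    s-nz  = pos⇒nonZero s
    s⁻¹-pos : Positive (1/ s)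
    s⁻¹-pos = 1/pos⇒pos s

    s-nn : NonNegative s
    s-nn = pos⇒nonNeg s

  cancel : ∀ c → s * (1/ s * c) ≡ c
  cancel c = trans (sym (*-assoc s (1/ s) c))
    (trans (cong (_* c) (*-inverseʳ s)) (*-identityˡ c))

  *-open-up : ∀ {q c} → s * q < c → ∃ λ r → q < r × s * r < c
  *-open-up {q} {c} sq<c =
    let r , q<r , r<c/s = <-dense (*-cancelˡ-<-nonNeg s (subst (s * q <_) (sym (cancel c)) sq<c))
    in r , q<r , subst (s * r <_) (cancel c) (*-monoʳ-<-pos s r<c/s)

  *-open-down : ∀ {q c} → c < s * q → ∃ λ r → r < q × c < s * r
  *-open-down {q} {c} c<sq =
    let r , c/s<r , r<q = <-dense (*-cancelˡ-<-nonNeg s (subst (_< s * q) (sym (cancel c)) c<sq))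
    in r , r<q , subst (_< s * r) (cancel c) (*-monoʳ-<-pos s c/s<r)

⊓-pres-> : ∀ {p q r} → p < q → p < r → p < q ⊓ r
⊓-pres-> {p} {q} {r} p<q p<r with ⊓-sel q r
... | inj₁ eq = subst (p <_) (sym eq) p<q
... | inj₂ eq = subst (p <_) (sym eq) p<r

⊔-pres-< : ∀ {p q r} → q < p → r < p → q ⊔ r < p
⊔-pres-< {p} {q} {r} q<p r<p with ⊔-sel q r
... | inj₁ eq = subst (_< p) (sym eq) q<p
... | inj₂ eq = subst (_< p) (sym eq) r<p

pow-open-up : ∀ k {q c} → 0ℚ ≤ q → q ^ k < c → ∃ λ r → q < r × r ^ k < c
pow-open-up zero    {q} 0≤q 1<c = q + 1ℚ , above q , 1<c
pow-open-up (suc k) {q} {c} 0≤q q*qᵏ<c =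
  let s , qᵏ<s , q*s<c = step
      0<s              = ≤-<-trans (pow-nonNeg k 0≤q) qᵏ<s
      t , q<t , s*t<c  = *-open-up s 0<s (subst (_< c) (*-comm q s) q*s<c)
      u , q<u , uᵏ<s   = pow-open-up k 0≤q qᵏ<s
      r                = t ⊓ u
      q<r              = ⊓-pres-> q<t q<u
      0≤r              = ≤-trans 0≤q (<⇒≤ q<r)
      0≤t              = ≤-trans 0≤q (<⇒≤ q<t)
      rᵏ≤s             = ≤-trans (pow-mono-≤ k 0≤r (p⊓q≤q t u)) (<⇒≤ uᵏ<s)
      r*rᵏ≤t*s         = *-mono-≤ 0≤t (pow-nonNeg k 0≤r) (p⊓q≤p t u) rᵏ≤s
  in r , q<r , ≤-<-trans r*rᵏ≤t*s (subst (_< c) (*-comm s t) s*t<c)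
  where
  step : ∃ λ s → q ^ k < s × q * s < c
  step with 0ℚ <? q
  ... | yes 0<q = *-open-up q 0<q q*qᵏ<c
  ... | no  0≮q with ≤-antisym 0≤q (≮⇒≥ 0≮q)
  ...   | refl = 0ℚ ^ k + 1ℚ , above (0ℚ ^ k) ,
    subst (_< c) (trans (*-zeroˡ (0ℚ ^ k)) (sym (*-zeroˡ (0ℚ ^ k + 1ℚ)))) q*qᵏ<c

pow-open-down : ∀ k {q c} → 0ℚ < q → 0ℚ ≤ c → c < q ^ k →
                ∃ λ r → r < q × 0ℚ < r × c < r ^ k
pow-open-down zero    {q} 0<q 0≤c c<1 =
  let r , 0<r , r<q = <-dense 0<q in r , r<q , 0<r , c<1
pow-open-down (suc k) {q} {c} 0<q 0≤c c<q*qᵏ =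
  let s , s<qᵏ , c<q*s        = *-open-down q 0<q c<q*qᵏ
      0<s                     = *-cancelˡ-<-nonNeg q {{nonNegative (<⇒≤ 0<q)}}
                                  (subst (_< q * s) (sym (*-zeroʳ q)) (≤-<-trans 0≤c c<q*s))
      t , t<q , c<s*t         = *-open-down s 0<s (subst (c <_) (*-comm q s) c<q*s)
      u , u<q , 0<u , s<uᵏ    = pow-open-down k 0<q (<⇒≤ 0<s) s<qᵏ
      r                       = t ⊔ u
      0<r                     = <-≤-trans 0<u (p≤q⊔p t u)
      s≤rᵏ                    = ≤-trans (<⇒≤ s<uᵏ) (pow-mono-≤ k (<⇒≤ 0<u) (p≤q⊔p t u))
      t*s≤r*rᵏ                = *-mono-≤ (<⇒≤ 0<r) (<⇒≤ 0<s) (p≤p⊔q t u) s≤rᵏ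
  in r , ⊔-pres-< t<q u<q , 0<r ,
     <-≤-trans (subst (c <_) (*-comm s t) c<s*t) t*s≤r*rᵏ

self≤pow : ∀ k .{{_ : NonZero k}} {q} → 1ℚ ≤ q → q ≤ q ^ k
self≤pow (suc k) {q} 1≤q = subst (_≤ q * q ^ k) (*-identityʳ q)
  (*-monoˡ-≤-nonNeg q {{nonNegative (≤-trans (nonNegative⁻¹ 1ℚ) 1≤q)}}
    (subst (_≤ q ^ k) (1^ k) (pow-mono-≤ k (nonNegative⁻¹ 1ℚ) 1≤q)))
  where
  1^ : ∀ k → 1ℚ ^ k ≡ 1ℚ
  1^ zero    = refl
  1^ (suc k) = trans (*-identityˡ (1ℚ ^ k)) (1^ k)

-- The non-negative k-th root x of N: q < x iff q < 0 or q^k < N, and x < q iff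
-- q > 0 and N < q^k.
root : (k : ℕ) .{{_ : NonZero k}} → ℕ → ℝ
root k N = record
  { Lower           = λ q → q < 0ℚ ⊎ q ^ k < c
  ; Upper           = λ q → 0ℚ < q × c < q ^ k
  ; lower-inhabited = let q , q<0 = below 0ℚ in q , inj₁ q<0
  ; upper-inhabited = c + 1ℚ , <-≤-trans (positive⁻¹ 1ℚ) 1≤c+1 ,
                      <-≤-trans (above c) (self≤pow k 1≤c+1)
  ; lower-closed    = lower-closed′
  ; upper-closed    = λ { q<r (0<q , c<qᵏ) →
                      <-trans 0<q q<r , <-trans c<qᵏ (pow-mono-< k (<⇒≤ 0<q) q<r) }
  ; lower-open      = lower-open′
  ; upper-open      = λ { (0<r , c<rᵏ) →
                      let q , q<r , 0<q , c<qᵏ = pow-open-down k 0<r 0≤c c<rᵏ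
                      in q , q<r , 0<q , c<qᵏ }
  ; disjoint        = λ { (inj₁ q<0) (0<q , _) → <-asym q<0 0<q
                        ; (inj₂ qᵏ<c) (_ , c<qᵏ) → <-asym qᵏ<c c<qᵏ }
  ; located         = located′
  }
  where
  c : ℚ
  c = + N / 1

  0≤c : 0ℚ ≤ c
  0≤c = nonNegative⁻¹ c {{normalize-nonNeg N 1}}

  1≤c+1 : 1ℚ ≤ c + 1ℚ
  1≤c+1 = subst (_≤ c + 1ℚ) (+-identityˡ 1ℚ) (+-monoˡ-≤ 1ℚ 0≤c)

  lower-closed′ : ∀ {q r} → q < r → r < 0ℚ ⊎ r ^ k < c → q < 0ℚ ⊎ q ^ k < c
  lower-closed′ q<r (inj₁ r<0) = inj₁ (<-trans q<r r<0)
  lower-closed′ {q} q<r (inj₂ rᵏ<c) with q <? 0ℚ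
  ... | yes q<0 = inj₁ q<0
  ... | no  q≮0 = inj₂ (<-trans (pow-mono-< k (≮⇒≥ q≮0) q<r) rᵏ<c)

  lower-open′ : ∀ {q} → q < 0ℚ ⊎ q ^ k < c → ∃ λ r → q < r × (r < 0ℚ ⊎ r ^ k < c)
  lower-open′ {q} l with q <? 0ℚ | l
  ... | yes q<0 | _ = let r , q<r , r<0 = <-dense q<0 in r , q<r , inj₁ r<0
  ... | no  q≮0 | inj₁ q<0  = contradiction q<0 q≮0
  ... | no  q≮0 | inj₂ qᵏ<c =
    let r , q<r , rᵏ<c = pow-open-up k (≮⇒≥ q≮0) qᵏ<c in r , q<r , inj₂ rᵏ<c

  located′ : ∀ {q r} → q < r → (q < 0ℚ ⊎ q ^ k < c) ⊎ (0ℚ < r × c < r ^ k)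
  located′ {q} q<r with q <? 0ℚ
  ... | yes q<0 = inj₁ (inj₁ q<0)
  ... | no  q≮0 with split (pow-mono-< k (≮⇒≥ q≮0) q<r) c
  ...   | inj₁ qᵏ<c = inj₁ (inj₂ qᵏ<c)
  ...   | inj₂ c<rᵏ = inj₂ (≤-<-trans (≮⇒≥ q≮0) q<r , c<rᵏ)

numVertices : (m n : ℕ) → ℕ
numVertices m n = 4 ℕ.* m ℕ.* n ∸ 2 ℕ.* m ∸ 2 ℕ.* n

numVertices-nonZero : ∀ {m n} → 2 ℕ.≤ m → 2 ℕ.≤ n → NonZero (numVertices m n)
numVertices-nonZero {suc (suc i)} {suc (suc j)} (ℕ.s≤s (ℕ.s≤s _)) (ℕ.s≤s (ℕ.s≤s _)) = subst NonZero (sym eq) _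
  where
  m n r : ℕ
  m = suc (suc i)
  n = suc (suc j)
  r = 7 ℕ.+ (6 ℕ.* i ℕ.+ 6 ℕ.* j ℕ.+ 4 ℕ.* i ℕ.* j)

  expand : ∀ i j → 4 ℕ.* (2 ℕ.+ i) ℕ.* (2 ℕ.+ j) ≡
    2 ℕ.* (2 ℕ.+ i) ℕ.+ (2 ℕ.* (2 ℕ.+ j) ℕ.+ (8 ℕ.+ (6 ℕ.* i ℕ.+ 6 ℕ.* j ℕ.+ 4 ℕ.* i ℕ.* j)))
  expand = solve-∀

  eq : numVertices m n ≡ suc r
  eq = trans (cong (λ x → x ∸ 2 ℕ.* m ∸ 2 ℕ.* n) (expand i j))
    (trans (cong (_∸ 2 ℕ.* n) (ℕ.m+n∸m≡n (2 ℕ.* m) _)) (ℕ.m+n∸m≡n (2 ℕ.* n) (suc r)))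

-- f(m,n)^(1/(4mn-2m-2n))
normalizedCount : (m n : ℕ) → 2 ℕ.≤ m → 2 ℕ.≤ n → ℝ
normalizedCount m n 2≤m 2≤n =
  root (numVertices m n) {{numVertices-nonZero 2≤m 2≤n}} (f m n)

IsEntropyConstant : ℝ → Set
IsEntropyConstant η =
  ∀ ε → 0ℚ < ε → ∃ λ N → ∀ m n (2≤m : 2 ℕ.≤ m) (2≤n : 2 ℕ.≤ n) →
  N ℕ.≤ m → N ℕ.≤ n → ∣ normalizedCount m n 2≤m 2≤n - η ∣< ε

module Submission where

-- The vertices pair up into links: D(a,b) with U(a+1,b) and R(a,b) with
-- L(a,b+1).  Once the horizontal links are fixed, the vertical ones are
-- independent of each other, and f(m,n) becomes 1ᵀ T^(m-1) 1 for a symmetric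
-- matrix T indexed by the states of a row, with entries between 1 and 3^n.
-- Hence f is supermultiplicative, and submultiplicative up to boundary factors,
-- in m and, by transposition, in n.  So the roots of f(k,k) converge to their
-- supremum η, which is also the infimum of the roots of 9^k f(k,k).
--
-- Lower bound: f(20,20) ≥ f(4,20)^5, and f(4,20) is computed.
-- Upper bound: by Cauchy–Schwarz the norm of T^4 is at most the square root of
-- tr T^8, which counts the independent sets of a cylinder of circumference 8.
-- The growth of this number in n is bounded by Collatz–Wielandt, comparing two
-- iterates of the column-to-column operator (on functions of 8 bits).

-- The vertex count 4mn - 2m - 2n is not additive under gluing, but the area 4mn is. Roots on
-- squares are therefore taken with exponent 4K², and the discrepancy, of the order of the
-- perimeter, is removed only in the passage to the double limit. All other losses (9^K for cutting
-- a square, the 3^n states of a row, the starting value of the column iteration) are also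
-- exponential in the perimeter only, hence invisible to a root of the order of the area. The size
-- of T grows with n, whereas the operator obtained by expanding tr T^8 along columns acts on
-- functions of 8 bits for every n: this is why one finite comparison bounds the growth for all n.
-- By symmetry of T, tr T^8 is the squared Frobenius norm of T^4. The roots of tr T^(2p) of order 2p
-- decrease towards the norm of T as p grows, but the table to be evaluated has 2^(2p) entries. Real
-- numbers are cuts, so neither roots nor logarithms are computed: estimates are cleared to
-- inequalities between powers of natural numbers, and stay squared where Cauchy-Schwarz has squared
-- them.

-- Finite sums and the Cauchy-Schwarz inequality

module FiniteSums where

  open import Data.List.Base using (List; []; _∷_; _++_; map; concatMap)
  open import Data.Nat.Base
  open import Data.Nat.Properties
  open import Algebra.Properties.CommutativeSemigroup +-commutativeSemigroup using () renaming
    (interchange to +-interchange) public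
  open import Algebra.Properties.CommutativeSemigroup *-commutativeSemigroup using () renaming
    (interchange to *-interchange)
  open import Data.Nat.Tactic.RingSolver using (solve-∀)
  open import Data.Vec.Base as Vec using (Vec; []; _∷_)
  open import Relation.Binary.PropositionalEquality

  ∑ : {A : Set} → List A → (A → ℕ) → ℕ
  ∑ []       g = 0
  ∑ (x ∷ xs) g = g x + ∑ xs g

  ∑-cong : ∀ {A : Set} (xs : List A) {g h : A → ℕ} → (∀ x → g x ≡ h x) → ∑ xs g ≡ ∑ xs h
  ∑-cong []       eq = refl
  ∑-cong (x ∷ xs) eq = cong₂ _+_ (eq x) (∑-cong xs eq)

  ∑-mono : ∀ {A : Set} (xs : List A) {g h : A → ℕ} → (∀ x → g x ≤ h x) → ∑ xs g ≤ ∑ xs h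
  ∑-mono []       le = z≤n
  ∑-mono (x ∷ xs) le = +-mono-≤ (le x) (∑-mono xs le)

  ∑-zero : ∀ {A : Set} (xs : List A) → ∑ xs (λ _ → 0) ≡ 0
  ∑-zero []       = refl
  ∑-zero (x ∷ xs) = ∑-zero xs

  ∑-+ : ∀ {A : Set} (xs : List A) (g h : A → ℕ) → ∑ xs (λ x → g x + h x) ≡ ∑ xs g + ∑ xs h
  ∑-+ []       g h = refl
  ∑-+ (x ∷ xs) g h = trans (cong (g x + h x +_) (∑-+ xs g h))
    (+-interchange (g x) (h x) (∑ xs g) (∑ xs h))

  ∑-*ˡ : ∀ {A : Set} (xs : List A) c (g : A → ℕ) → ∑ xs (λ x → c * g x) ≡ c * ∑ xs g
  ∑-*ˡ []       c g = sym (*-zeroʳ c)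
  ∑-*ˡ (x ∷ xs) c g = trans (cong (c * g x +_) (∑-*ˡ xs c g)) (sym (*-distribˡ-+ c (g x) (∑ xs g)))

  ∑-*ʳ : ∀ {A : Set} (xs : List A) c (g : A → ℕ) → ∑ xs (λ x → g x * c) ≡ ∑ xs g * c
  ∑-*ʳ []       c g = refl
  ∑-*ʳ (x ∷ xs) c g = trans (cong (g x * c +_) (∑-*ʳ xs c g)) (sym (*-distribʳ-+ c (g x) (∑ xs g)))

  ∑-swap : ∀ {A B : Set} (xs : List A) (ys : List B) (g : A → B → ℕ) →
           ∑ xs (λ x → ∑ ys (g x)) ≡ ∑ ys (λ y → ∑ xs (λ x → g x y))
  ∑-swap []       ys g = sym (∑-zero ys)
  ∑-swap (x ∷ xs) ys g = trans (cong (∑ ys (g x) +_) (∑-swap xs ys g))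
    (sym (∑-+ ys (g x) (λ y → ∑ xs (λ x → g x y))))

  ∑-++ : ∀ {A : Set} (xs ys : List A) (g : A → ℕ) → ∑ (xs ++ ys) g ≡ ∑ xs g + ∑ ys g
  ∑-++ []       ys g = refl
  ∑-++ (x ∷ xs) ys g = trans (cong (g x +_) (∑-++ xs ys g)) (sym (+-assoc (g x) _ _))

  ∑-map : ∀ {A B : Set} (φ : A → B) (xs : List A) (g : B → ℕ) →
    ∑ (map φ xs) g ≡ ∑ xs (λ x → g (φ x))
  ∑-map φ []       g = refl
  ∑-map φ (x ∷ xs) g = cong (g (φ x) +_) (∑-map φ xs g)

  ∑-concatMap : ∀ {A B : Set} (φ : A → List B) (xs : List A) (g : B → ℕ) →
                ∑ (concatMap φ xs) g ≡ ∑ xs (λ x → ∑ (φ x) g)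
  ∑-concatMap φ []       g = refl
  ∑-concatMap φ (x ∷ xs) g = trans (∑-++ (φ x) (concatMap φ xs) g)
    (cong (∑ (φ x) g +_) (∑-concatMap φ xs g))

  ∑-product : ∀ {A B : Set} (xs : List A) (ys : List B) (g : A → ℕ) (h : B → ℕ) →
              ∑ xs (λ x → ∑ ys (λ y → g x * h y)) ≡ ∑ xs g * ∑ ys h
  ∑-product xs ys g h = trans (∑-cong xs (λ x → ∑-*ˡ ys (g x) h)) (∑-*ʳ xs (∑ ys h) g)

  2xy≤x²+y² : ∀ x y → 2 * (x * y) ≤ x * x + y * y
  2xy≤x²+y² zero    y       = z≤n
  2xy≤x²+y² (suc x) zero    = subst (_≤ suc x * suc x + 0) (sym (cong (2 *_) (*-zeroʳ (suc x)))) z≤n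
  2xy≤x²+y² (suc x) (suc y) = subst₂ _≤_ (sym (left x y)) (sym (right x y))
    (+-monoˡ-≤ (2 * x + 2 * y + 2) (2xy≤x²+y² x y))
    where
    left : ∀ x y → 2 * (suc x * suc y) ≡ 2 * (x * y) + (2 * x + 2 * y + 2)
    left = solve-∀
    right : ∀ x y → suc x * suc x + suc y * suc y ≡ x * x + y * y + (2 * x + 2 * y + 2)
    right = solve-∀

  cauchy-schwarz : ∀ {A : Set} (xs : List A) (g h : A → ℕ) →
    ∑ xs (λ x → g x * h x) * ∑ xs (λ x → g x * h x) ≤ ∑ xs (λ x → g x * g x) * ∑ xs
      (λ x → h x * h x)
  cauchy-schwarz xs g h = *-cancelˡ-≤ 2 (begin
    2 * (S * S)
      ≡⟨ cong (2 *_) (∑-product xs xs gh gh) ⟨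
    2 * ∑ xs (λ x → ∑ xs (λ y → gh x * gh y))
      ≡⟨ ∑-*ˡ xs 2 _ ⟨
    ∑ xs (λ x → 2 * ∑ xs (λ y → gh x * gh y))
      ≡⟨ ∑-cong xs (λ x → sym (∑-*ˡ xs 2 _)) ⟩
    ∑ xs (λ x → ∑ xs (λ y → 2 * (gh x * gh y)))
      ≤⟨ ∑-mono xs (λ x → ∑-mono xs (λ y → pointwise x y)) ⟩
    ∑ xs (λ x → ∑ xs (λ y → g² x * h² y + h² x * g² y))
      ≡⟨ ∑-cong xs (λ x → ∑-+ xs _ _) ⟩
    ∑ xs (λ x → ∑ xs (λ y → g² x * h² y) + ∑ xs (λ y → h² x * g² y))
      ≡⟨ ∑-+ xs _ _ ⟩
    ∑ xs (λ x → ∑ xs (λ y → g² x * h² y)) + ∑ xs (λ x → ∑ xs (λ y → h² x * g² y))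
      ≡⟨ cong₂ _+_ (∑-product xs xs g² h²) (∑-product xs xs h² g²) ⟩
    ∑ xs g² * ∑ xs h² + ∑ xs h² * ∑ xs g²
      ≡⟨ twice (∑ xs g²) (∑ xs h²) ⟩
    2 * (∑ xs g² * ∑ xs h²) ∎)
    where
    open ≤-Reasoning
    gh g² h² : _ → ℕ
    gh x = g x * h x
    g² x = g x * g x
    h² x = h x * h x
    S = ∑ xs gh

    twice : ∀ a b → a * b + b * a ≡ 2 * (a * b)
    twice = solve-∀

    regroup : ∀ a b c d → 2 * (a * d * (b * c)) ≡ 2 * (a * b * (c * d))
    regroup = solve-∀

    squares : ∀ a b c d → a * d * (a * d) + b * c * (b * c) ≡ a * a * (d * d) + b * b * (c * c)
    squares = solve-∀

    pointwise : ∀ x y → 2 * (gh x * gh y) ≤ g² x * h² y + h² x * g² y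
    pointwise x y = subst₂ _≤_ (regroup (g x) (h x) (g y) (h y)) (squares (g x) (h x) (g y) (h y))
      (2xy≤x²+y² (g x * h y) (h x * g y))

  vecs : {A : Set} → List A → ∀ p → List (Vec A p)
  vecs xs zero    = [] ∷ []
  vecs xs (suc p) = concatMap (λ x → map (x ∷_) (vecs xs p)) xs

  ∑-vecs-suc : ∀ {A : Set} (xs : List A) p (g : Vec A (suc p) → ℕ) →
               ∑ (vecs xs (suc p)) g ≡ ∑ xs (λ x → ∑ (vecs xs p) (λ v → g (x ∷ v)))
  ∑-vecs-suc xs p g = trans (∑-concatMap _ xs g) (∑-cong xs (λ x → ∑-map (x ∷_) (vecs xs p) g))

  ∑-vecs-++ : ∀ {A : Set} (xs : List A) m {n} (g : Vec A (m + n) → ℕ) →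
              ∑ (vecs xs (m + n)) g ≡ ∑ (vecs xs m) (λ u → ∑ (vecs xs n) (λ v → g (u Vec.++ v)))
  ∑-vecs-++ xs zero    g = sym (+-identityʳ _)
  ∑-vecs-++ xs (suc m) {n} g = begin
    ∑ (vecs xs (suc m + n)) g
      ≡⟨ ∑-vecs-suc xs (m + n) g ⟩
    ∑ xs (λ x → ∑ (vecs xs (m + n)) (λ w → g (x ∷ w)))
      ≡⟨ ∑-cong xs (λ x → ∑-vecs-++ xs m (λ w → g (x ∷ w))) ⟩
    ∑ xs (λ x → ∑ (vecs xs m) (λ u → ∑ (vecs xs n) (λ v → g (x ∷ u Vec.++ v))))
      ≡⟨ ∑-vecs-suc xs m _ ⟨
    ∑ (vecs xs (suc m)) (λ u → ∑ (vecs xs n) (λ v → g (u Vec.++ v))) ∎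
    where open ≡-Reasoning

  -- A p × (n + 1) array is a first column and a p × n array.
  ∑-columns : ∀ {A : Set} (xs : List A) p {n} (g : Vec (Vec A (suc n)) p → ℕ) →
              ∑ (vecs (vecs xs (suc n)) p) g ≡
              ∑ (vecs xs p) (λ s → ∑ (vecs (vecs xs n) p) (λ r → g (Vec.zipWith _∷_ s r)))
  ∑-columns xs zero    g = sym (+-identityʳ _)
  ∑-columns xs (suc p) {n} g = begin
    ∑ (vecs (vecs xs (suc n)) (suc p)) g
      ≡⟨ ∑-vecs-suc (vecs xs (suc n)) p g ⟩
    ∑ (vecs xs (suc n)) (λ v → ∑ (vecs (vecs xs (suc n)) p) (λ r → g (v ∷ r)))
      ≡⟨ ∑-vecs-suc xs n _ ⟩
    ∑ xs (λ x → ∑ (vecs xs n) (λ v → ∑ (vecs (vecs xs (suc n)) p) (λ r → g ((x ∷ v) ∷ r))))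
      ≡⟨ ∑-cong xs (λ x → ∑-cong (vecs xs n) (λ v → ∑-columns xs p _)) ⟩
    ∑ xs (λ x → ∑ (vecs xs n) (λ v → ∑ (vecs xs p) (λ s → ∑ (vecs (vecs xs n) p) (λ r →
      g ((x ∷ v) ∷ Vec.zipWith _∷_ s r)))))
      ≡⟨ ∑-cong xs (λ x → ∑-swap (vecs xs n) (vecs xs p) _) ⟩
    ∑ xs (λ x → ∑ (vecs xs p) (λ s → ∑ (vecs xs n) (λ v → ∑ (vecs (vecs xs n) p) (λ r →
      g ((x ∷ v) ∷ Vec.zipWith _∷_ s r)))))
      ≡⟨ ∑-cong xs (λ x → ∑-cong (vecs xs p) (λ s → ∑-vecs-suc (vecs xs n) p _)) ⟨
    ∑ xs (λ x → ∑ (vecs xs p) (λ s → ∑ (vecs (vecs xs n) (suc p)) (λ r →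
      g (Vec.zipWith _∷_ (x ∷ s) r))))
      ≡⟨ ∑-vecs-suc xs p _ ⟨
    ∑ (vecs xs (suc p)) (λ s → ∑ (vecs (vecs xs n) (suc p)) (λ r → g (Vec.zipWith _∷_ s r))) ∎
    where open ≡-Reasoning

  ∑-vecs-1 : ∀ {A : Set} (xs : List A) p → ∑ (vecs xs p) (λ _ → 1) ≡ ∑ xs (λ _ → 1) ^ p
  ∑-vecs-1 xs zero    = refl
  ∑-vecs-1 xs (suc p) = begin
    ∑ (vecs xs (suc p)) (λ _ → 1)             ≡⟨ ∑-vecs-suc xs p _ ⟩
    ∑ xs (λ x → ∑ (vecs xs p) (λ v → 1))      ≡⟨ ∑-product xs (vecs xs p) (λ _ → 1) (λ _ → 1) ⟩
    ∑ xs (λ _ → 1) * ∑ (vecs xs p) (λ _ → 1)  ≡⟨ cong (∑ xs (λ _ → 1) *_) (∑-vecs-1 xs p) ⟩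
    ∑ xs (λ _ → 1) * ∑ xs (λ _ → 1) ^ p       ∎
    where open ≡-Reasoning

  -- Paths, cycles and powers of kernels

  Kernel : Set → Set
  Kernel A = A → A → ℕ

  -- `c` weighs the last vertex: it is constantly 1 for an open path and the closing factor for a
  -- cycle, so that one induction serves both.
  chain : ∀ {A : Set} → Kernel A → (A → ℕ) → A → ∀ {p} → Vec A p → ℕ
  chain K c x []      = c x
  chain K c x (y ∷ v) = K x y * chain K c y v

  path : ∀ {A : Set} → Kernel A → ∀ {p} → Vec A p → ℕ
  path K []      = 1
  path K (x ∷ v) = chain K (λ _ → 1) x v

  cycle : ∀ {A : Set} → Kernel A → ∀ {p} → Vec A p → ℕ
  cycle K []      = 1
  cycle K (x ∷ v) = chain K (λ y → K y x) x v

  module _ {A : Set} (X : List A) where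

    apply : Kernel A → (A → ℕ) → A → ℕ
    apply L g x = ∑ X (λ y → L x y * g y)

    normSq : (A → ℕ) → ℕ
    normSq g = ∑ X (λ x → g x * g x)

    module _ (K : Kernel A) where

      applyⁿ : ℕ → (A → ℕ) → A → ℕ
      applyⁿ zero    g = g
      applyⁿ (suc n) g = apply K (applyⁿ n g)

      applyⁿ-+ : ∀ m n g → applyⁿ (m + n) g ≡ applyⁿ m (applyⁿ n g)
      applyⁿ-+ zero    n g = refl
      applyⁿ-+ (suc m) n g = cong (apply K) (applyⁿ-+ m n g)

      -- K^(n + 1)
      power⁺ : ℕ → Kernel A
      power⁺ zero    x z = K x z
      power⁺ (suc n) x z = ∑ X (λ y → K x y * power⁺ n y z)

      ∑-chain : ∀ p c x → ∑ (vecs X p) (chain K c x) ≡ applyⁿ p c x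
      ∑-chain zero    c x = +-identityʳ (c x)
      ∑-chain (suc p) c x = begin
        ∑ (vecs X (suc p)) (chain K c x)                        ≡⟨ ∑-vecs-suc X p _ ⟩
        ∑ X (λ y → ∑ (vecs X p) (λ v → K x y * chain K c y v))
          ≡⟨ ∑-cong X (λ y → ∑-*ˡ (vecs X p) (K x y) _) ⟩
        ∑ X (λ y → K x y * ∑ (vecs X p) (chain K c y))
          ≡⟨ ∑-cong X (λ y → cong (K x y *_) (∑-chain p c y)) ⟩
        applyⁿ (suc p) c x                                      ∎
        where open ≡-Reasoning

      ∑-path-suc : ∀ p → ∑ (vecs X (suc p)) (path K) ≡ ∑ X (applyⁿ p (λ _ → 1))
      ∑-path-suc p = trans (∑-vecs-suc X p _) (∑-cong X (∑-chain p _))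

      applyⁿ-column : ∀ n x z → applyⁿ n (λ y → K y z) x ≡ power⁺ n x z
      applyⁿ-column zero    x z = refl
      applyⁿ-column (suc n) x z = ∑-cong X (λ y → cong (K x y *_) (applyⁿ-column n y z))

      ∑-cycle-suc : ∀ p → ∑ (vecs X (suc p)) (cycle K) ≡ ∑ X (λ x → power⁺ p x x)
      ∑-cycle-suc p = trans (∑-vecs-suc X p _)
        (∑-cong X (λ x → trans (∑-chain p _ x) (applyⁿ-column p x x)))

      apply-power⁺ : ∀ n g x → apply (power⁺ n) g x ≡ applyⁿ (suc n) g x
      apply-power⁺ zero    g x = refl
      apply-power⁺ (suc n) g x = begin
        ∑ X (λ z → ∑ X (λ y → K x y * power⁺ n y z) * g z)
          ≡⟨ ∑-cong X (λ z → sym (∑-*ʳ X (g z) _)) ⟩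
        ∑ X (λ z → ∑ X (λ y → K x y * power⁺ n y z * g z))
          ≡⟨ ∑-swap X X _ ⟩
        ∑ X (λ y → ∑ X (λ z → K x y * power⁺ n y z * g z))
          ≡⟨ ∑-cong X (λ y → trans (∑-cong X (λ z → *-assoc (K x y) _ _)) (∑-*ˡ X (K x y) _)) ⟩
        ∑ X (λ y → K x y * apply (power⁺ n) g y)
          ≡⟨ ∑-cong X (λ y → cong (K x y *_) (apply-power⁺ n g y)) ⟩
        applyⁿ (suc (suc n)) g x ∎
        where open ≡-Reasoning

      power⁺-+ : ∀ m n x z → power⁺ (m + suc n) x z ≡ ∑ X (λ y → power⁺ m x y * power⁺ n y z)
      power⁺-+ m n x z = begin
        power⁺ (m + suc n) x z               ≡⟨ applyⁿ-column (m + suc n) x z ⟨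
        applyⁿ (m + suc n) (λ y → K y z) x   ≡⟨ cong (λ k → applyⁿ k (λ y → K y z) x) (+-suc m n) ⟩
        applyⁿ (suc m + n) (λ y → K y z) x   ≡⟨ cong-app (applyⁿ-+ (suc m) n (λ y → K y z)) x ⟩
        applyⁿ (suc m) (applyⁿ n (λ y → K y z)) x ≡⟨ apply-power⁺ m _ x ⟨
        apply (power⁺ m) (applyⁿ n (λ y → K y z)) x
          ≡⟨ ∑-cong X (λ y → cong (power⁺ m x y *_) (applyⁿ-column n y z)) ⟩
        ∑ X (λ y → power⁺ m x y * power⁺ n y z) ∎
        where open ≡-Reasoning

      -- tr K^(2n + 2)
      trace : ℕ → ℕ
      trace n = ∑ (vecs X (suc n + suc n)) (cycle K)

      module _ (K-sym : ∀ x y → K x y ≡ K y x) where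

        power⁺-sym : ∀ n x y → power⁺ n x y ≡ power⁺ n y x
        power⁺-sym zero    x y = K-sym x y
        power⁺-sym (suc n) x y = begin
          ∑ X (λ z → K x z * power⁺ n z y)
            ≡⟨ ∑-cong X (λ z →
              trans (*-comm (K x z) _) (cong₂ _*_ (power⁺-sym n z y) (K-sym x z))) ⟩
          ∑ X (λ z → power⁺ n y z * K z x)  ≡⟨ power⁺-+ n 0 y x ⟨
          power⁺ (n + 1) y x                ≡⟨ cong (λ k → power⁺ k y x) (+-comm n 1) ⟩
          power⁺ (suc n) y x                ∎
          where open ≡-Reasoning

        -- By symmetry the diagonal entry at x of the product of K^(n + 1) with itself is the
        -- squared norm of row x.
        frobenius : ∀ n → ∑ X (λ x → normSq (power⁺ n x)) ≡ trace n
        frobenius n = sym (begin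
          ∑ (vecs X (suc n + suc n)) (cycle K)                      ≡⟨ ∑-cycle-suc (n + suc n) ⟩
          ∑ X (λ x → power⁺ (n + suc n) x x)
            ≡⟨ ∑-cong X (λ x → power⁺-+ n n x x) ⟩
          ∑ X (λ x → ∑ X (λ y → power⁺ n x y * power⁺ n y x))
            ≡⟨ ∑-cong X (λ x → ∑-cong X (λ y → cong (power⁺ n x y *_) (power⁺-sym n y x))) ⟩
          ∑ X (λ x → normSq (power⁺ n x))                           ∎)
          where open ≡-Reasoning

        -- Cauchy-Schwarz in each row: the Frobenius norm dominates the operator norm.
        normSq-apply : ∀ n g → normSq (applyⁿ (suc n) g) ≤ trace n * normSq g
        normSq-apply n g = begin
          normSq (applyⁿ (suc n) g)
            ≡⟨ ∑-cong X (λ x → cong₂ _*_ (apply-power⁺ n g x) (apply-power⁺ n g x)) ⟨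
          ∑ X (λ x → apply (power⁺ n) g x * apply (power⁺ n) g x)
            ≤⟨ ∑-mono X (λ x → cauchy-schwarz X (power⁺ n x) g) ⟩
          ∑ X (λ x → normSq (power⁺ n x) * normSq g)
            ≡⟨ ∑-*ʳ X (normSq g) _ ⟩
          ∑ X (λ x → normSq (power⁺ n x)) * normSq g
            ≡⟨ cong (_* normSq g) (frobenius n) ⟩
          trace n * normSq g ∎
          where open ≤-Reasoning

        iterate-apply : (n k : ℕ) → (A → ℕ) → A → ℕ
        iterate-apply n zero    g = g
        iterate-apply n (suc k) g = applyⁿ (suc n) (iterate-apply n k g)

        applyⁿ-* : ∀ n k g → applyⁿ (k * suc n) g ≡ iterate-apply n k g
        applyⁿ-* n zero    g = refl
        applyⁿ-* n (suc k) g = trans (applyⁿ-+ (suc n) (k * suc n) g)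
          (cong (applyⁿ (suc n)) (applyⁿ-* n k g))

        -- The sum over paths is the inner product of 1 with K^(k(n + 1)) 1. Cauchy-Schwarz
        -- separates the two vectors, and `normSq-apply` is then used k times. The second factor N
        -- is the squared norm of the constant 1.
        ∑-path-sq : ∀ n k → let S = ∑ (vecs X (suc (k * suc n))) (path K); N = ∑ X (λ _ → 1) in
                    S * S ≤ N * N * trace n ^ k
        ∑-path-sq n k = begin
          S * S
            ≡⟨ cong (λ s → s * s) (trans (∑-path-suc (k * suc n)) (cong (∑ X) (applyⁿ-* n k _))) ⟩
          ∑ X v * ∑ X v
            ≡⟨ cong (λ s → s * s) (∑-cong X (λ x → sym (*-identityˡ (v x)))) ⟩
          ∑ X (λ x → 1 * v x) * ∑ X (λ x → 1 * v x)
                                     ≤⟨ cauchy-schwarz X (λ _ → 1) v ⟩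
          N * normSq v               ≤⟨ *-monoʳ-≤ N (bound k) ⟩
          N * (trace n ^ k * N)      ≡⟨ cong (N *_) (*-comm (trace n ^ k) N) ⟩
          N * (N * trace n ^ k)      ≡⟨ *-assoc N N _ ⟨
          N * N * trace n ^ k        ∎
          where
          open ≤-Reasoning
          S = ∑ (vecs X (suc (k * suc n))) (path K)
          N = ∑ X (λ _ → 1)
          v = iterate-apply n k (λ _ → 1)
          bound : ∀ k → normSq (iterate-apply n k (λ _ → 1)) ≤ trace n ^ k * N
          bound zero    = ≤-reflexive (sym (+-identityʳ N))
          bound (suc k) = ≤-trans (normSq-apply n _)
            (≤-trans (*-monoʳ-≤ (trace n) (bound k)) (≤-reflexive (sym (*-assoc (trace n) _ N))))

-- The transfer matrix between rows

module TransferMatrix where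

  open FiniteSums
  open import Data.Bool.Base using (Bool; true; false; _∧_; T)
  open import Data.Bool.Properties using (T-∧)
  open import Data.List.Base using (List; []; _∷_)
  open import Data.Nat.Base
  open import Data.Nat.Properties
  open import Algebra.Properties.CommutativeSemigroup *-commutativeSemigroup using () renaming
    (interchange to *-interchange)
  open import Data.Nat.Tactic.RingSolver using (solve-∀)
  open import Data.Product using (_×_; _,_; proj₁; proj₂)
  open import Data.Vec.Base as Vec using (Vec; []; _∷_; zip; zipWith; replicate)
  open import Function.Bundles using (module Equivalence)
  open import Relation.Binary.PropositionalEquality

  -- The states of the horizontal link between the squares (a , b) and (a , b + 1):
  -- `near` means that R(a , b) is chosen, `far` that L(a , b + 1) is.
  data Link : Set where
    none near far : Link

  links : List Link
  links = none ∷ near ∷ far ∷ []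

  -- A square is blocked if its vertex L or R is chosen.
  blocked : Bool → Link → Bool
  blocked l none = l
  blocked l near = true
  blocked l far  = l

  isFar : Link → Bool
  isFar none = false
  isFar near = false
  isFar far  = true

  -- The number of states of the vertical link between two squares that are
  -- blocked or not.
  t : Kernel Bool
  t false false = 3
  t false true  = 2
  t true  false = 2
  t true  true  = 1

  -- The bit says whether the vertex L of the first square is chosen.
  rowKernel : ∀ n → Kernel (Bool × Vec Link n)
  rowKernel zero    (l , _)     (l′ , _)      = t l l′
  rowKernel (suc n) (l , s ∷ x) (l′ , s′ ∷ x′) =
    t (blocked l s) (blocked l′ s′) * rowKernel n (isFar s , x) (isFar s′ , x′)

  rows : ∀ n → List (Vec Link n)
  rows n = vecs links n

  -- The first square of a row has no vertex L, hence the bit `false`.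
  rowKernel₀ : ∀ n → Kernel (Vec Link n)
  rowKernel₀ n x y = rowKernel n (false , x) (false , y)

  -- This is f m (n + 1): a row of n + 1 squares has n links.
  Z : ℕ → ℕ → ℕ
  Z m n = ∑ (vecs (rows n) m) (path (rowKernel₀ n))

  t-sym : ∀ a b → t a b ≡ t b a
  t-sym false false = refl
  t-sym false true  = refl
  t-sym true  false = refl
  t-sym true  true  = refl

  rowKernel-sym : ∀ n x y → rowKernel n x y ≡ rowKernel n y x
  rowKernel-sym zero    (l , [])    (l′ , [])      = t-sym l l′
  rowKernel-sym (suc n) (l , s ∷ x) (l′ , s′ ∷ x′) =
    cong₂ _*_ (t-sym (blocked l s) (blocked l′ s′)) (rowKernel-sym n (isFar s , x) (isFar s′ , x′))

  1≤t : ∀ a b → 1 ≤ t a b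
  1≤t false false = s≤s z≤n
  1≤t false true  = s≤s z≤n
  1≤t true  false = s≤s z≤n
  1≤t true  true  = s≤s z≤n

  t≤3 : ∀ a b → t a b ≤ 3
  t≤3 false false = s≤s (s≤s (s≤s z≤n))
  t≤3 false true  = s≤s (s≤s z≤n)
  t≤3 true  false = s≤s (s≤s z≤n)
  t≤3 true  true  = s≤s z≤n

  1≤rowKernel : ∀ n x y → 1 ≤ rowKernel n x y
  1≤rowKernel zero    (l , _)     (l′ , _)       = 1≤t l l′
  1≤rowKernel (suc n) (l , s ∷ x) (l′ , s′ ∷ x′) =
    *-mono-≤ (1≤t (blocked l s) (blocked l′ s′)) (1≤rowKernel n _ _)

  rowKernel≤3^ : ∀ n x y → rowKernel n x y ≤ 3 ^ suc n
  rowKernel≤3^ zero    (l , _)     (l′ , _)       = t≤3 l l′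
  rowKernel≤3^ (suc n) (l , s ∷ x) (l′ , s′ ∷ x′) =
    *-mono-≤ (t≤3 (blocked l s) (blocked l′ s′)) (rowKernel≤3^ n _ _)

  module _ {A : Set} (K : Kernel A) where

    -- Gluing two nonempty paths inserts one factor of `K` at the joint, and this factor is at least
    -- 1.
    path-++-≥ : (∀ x y → 1 ≤ K x y) → ∀ {m n} (u : Vec A m) (v : Vec A n) →
                path K u * path K v ≤ path K (u Vec.++ v)
    path-++-≥ 1≤K []          v       = ≤-reflexive (+-identityʳ _)
    path-++-≥ 1≤K (x ∷ [])    []      = ≤-refl
    path-++-≥ 1≤K (x ∷ [])    (y ∷ v) = *-monoˡ-≤ (path K (y ∷ v)) (1≤K x y)
    path-++-≥ 1≤K (x ∷ y ∷ u) v       = ≤-trans (≤-reflexive (*-assoc (K x y) _ _))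
      (*-monoʳ-≤ (K x y) (path-++-≥ 1≤K (y ∷ u) v))

    -- The factor at the joint is at most `c`; `1 ≤ c` covers the cases in which there is no joint.
    path-++-≤ : ∀ {c} → 1 ≤ c → (∀ x y → K x y ≤ c) → ∀ {m n} (u : Vec A m) (v : Vec A n) →
                path K (u Vec.++ v) ≤ c * (path K u * path K v)
    path-++-≤ {c} 1≤c K≤c [] v =
      subst (_≤ c * (1 * path K v)) (trans (+-identityʳ _) (+-identityʳ _))
        (*-monoˡ-≤ (1 * path K v) 1≤c)
    path-++-≤ {c} 1≤c K≤c (x ∷ []) [] = subst (1 ≤_) (sym (*-identityʳ c)) 1≤c
    path-++-≤ {c} 1≤c K≤c (x ∷ []) (y ∷ v) =
      ≤-trans (*-monoˡ-≤ (path K (y ∷ v)) (K≤c x y))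
        (≤-reflexive (cong (c *_) (sym (*-identityˡ (path K (y ∷ v))))))
    path-++-≤ {c} 1≤c K≤c (x ∷ y ∷ u) v = ≤-trans (*-monoʳ-≤ (K x y) (path-++-≤ 1≤c K≤c (y ∷ u) v))
      (≤-reflexive (regroup (K x y) c (path K (y ∷ u)) (path K v)))
      where
      regroup : ∀ k c p q → k * (c * (p * q)) ≡ c * (k * p * q)
      regroup = solve-∀

  Z-+-≥ : ∀ m₁ m₂ n → Z m₁ n * Z m₂ n ≤ Z (m₁ + m₂) n
  Z-+-≥ m₁ m₂ n = begin
    Z m₁ n * Z m₂ n
      ≡⟨ ∑-product (vecs (rows n) m₁) (vecs (rows n) m₂) _ _ ⟨
    ∑ (vecs (rows n) m₁) (λ u →
      ∑ (vecs (rows n) m₂) (λ v → path (rowKernel₀ n) u * path (rowKernel₀ n) v))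
      ≤⟨ ∑-mono (vecs (rows n) m₁) (λ u →
        ∑-mono (vecs (rows n) m₂) (path-++-≥ _ (λ x y → 1≤rowKernel n _ _) u)) ⟩
    ∑ (vecs (rows n) m₁) (λ u → ∑ (vecs (rows n) m₂) (λ v → path (rowKernel₀ n) (u Vec.++ v)))
      ≡⟨ ∑-vecs-++ (rows n) m₁ _ ⟨
    Z (m₁ + m₂) n ∎
    where open ≤-Reasoning

  Z-+-≤ : ∀ m₁ m₂ n → Z (m₁ + m₂) n ≤ 3 ^ suc n * (Z m₁ n * Z m₂ n)
  Z-+-≤ m₁ m₂ n = begin
    Z (m₁ + m₂) n
      ≡⟨ ∑-vecs-++ (rows n) m₁ _ ⟩
    ∑ (vecs (rows n) m₁) (λ u → ∑ (vecs (rows n) m₂) (λ v → path (rowKernel₀ n) (u Vec.++ v)))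
      ≤⟨ ∑-mono (vecs (rows n) m₁) (λ u → ∑-mono (vecs (rows n) m₂)
           (path-++-≤ _ (m^n>0 3 (suc n)) (λ x y → rowKernel≤3^ n _ _) u)) ⟩
    ∑ (vecs (rows n) m₁) (λ u →
      ∑ (vecs (rows n) m₂) (λ v → 3 ^ suc n * (path (rowKernel₀ n) u * path (rowKernel₀ n) v)))
      ≡⟨ ∑-cong (vecs (rows n) m₁) (λ u → ∑-*ˡ (vecs (rows n) m₂) (3 ^ suc n) _) ⟩
    ∑ (vecs (rows n) m₁) (λ u →
      3 ^ suc n * ∑ (vecs (rows n) m₂) (λ v → path (rowKernel₀ n) u * path (rowKernel₀ n) v))
      ≡⟨ ∑-*ˡ (vecs (rows n) m₁) (3 ^ suc n) _ ⟩
    3 ^ suc n * ∑ (vecs (rows n) m₁) (λ u →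
      ∑ (vecs (rows n) m₂) (λ v → path (rowKernel₀ n) u * path (rowKernel₀ n) v))
      ≡⟨ cong (3 ^ suc n *_) (∑-product (vecs (rows n) m₁) (vecs (rows n) m₂) _ _) ⟩
    3 ^ suc n * (Z m₁ n * Z m₂ n) ∎
    where open ≤-Reasoning

  -- Expansion along columns

  -- The boundary condition in the direction in which rows are stacked: `free` for f(4,20),
  -- `periodic` for tr T^8.
  data Boundary : Set where
    free periodic : Boundary

  weight : Boundary → {A : Set} → Kernel A → ∀ {p} → Vec A p → ℕ
  weight free     = path
  weight periodic = cycle

  -- `rowKernel` is a product over squares, so a stack of rows factors into its first column and the
  -- rest. The end weight has to factor likewise, which holds both for the constant 1 and for the
  -- closing factor of a cycle.
  chain-column : ∀ {n} (c : Bool × Vec Link (suc n) → ℕ) (c₁ : Bool → ℕ)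
    (c₂ : Bool × Vec Link n → ℕ) →
    (∀ l s x → c (l , s ∷ x) ≡ c₁ (blocked l s) * c₂ (isFar s , x)) →
    ∀ {p} l s x (ls : Vec Bool p) (ss : Vec Link p) (xs : Vec (Vec Link n) p) →
    chain (rowKernel (suc n)) c (l , s ∷ x) (zip ls (zipWith _∷_ ss xs)) ≡
    chain t c₁ (blocked l s) (zipWith blocked ls ss) * chain (rowKernel n) c₂ (isFar s , x)
      (zip (Vec.map isFar ss) xs)
  chain-column c c₁ c₂ eq l s x []        []        []        = eq l s x
  chain-column c c₁ c₂ eq l s x (l′ ∷ ls) (s′ ∷ ss) (x′ ∷ xs) =
    trans (cong (rowKernel _ (l , s ∷ x) (l′ , s′ ∷ x′) *_)
      (chain-column c c₁ c₂ eq l′ s′ x′ ls ss xs))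
      (*-interchange (t (blocked l s) (blocked l′ s′)) _ _ _)

  weight-column : ∀ β {n p} (ls : Vec Bool p) (ss : Vec Link p) (xs : Vec (Vec Link n) p) →
    weight β (rowKernel (suc n)) (zip ls (zipWith _∷_ ss xs)) ≡
    weight β t (zipWith blocked ls ss) * weight β (rowKernel n) (zip (Vec.map isFar ss) xs)
  weight-column free     []       []       []       = refl
  weight-column free     (l ∷ ls) (s ∷ ss) (x ∷ xs) =
    chain-column _ _ _ (λ _ _ _ → refl) l s x ls ss xs
  weight-column periodic []       []       []       = refl
  weight-column periodic (l ∷ ls) (s ∷ ss) (x ∷ xs) =
    chain-column _ _ _ (λ _ _ _ → refl) l s x ls ss xs

  chain-lastColumn : ∀ (c : Bool × Vec Link 0 → ℕ) {p} l (ls : Vec Bool p)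
    (xs : Vec (Vec Link 0) p) →
    chain (rowKernel 0) c (l , []) (zip ls xs) ≡ chain t (λ l → c (l , [])) l ls
  chain-lastColumn c l []        []        = refl
  chain-lastColumn c l (l′ ∷ ls) ([] ∷ xs) = cong (t l l′ *_) (chain-lastColumn c l′ ls xs)

  weight-lastColumn : ∀ β {p} (ls : Vec Bool p) (xs : Vec (Vec Link 0) p) →
    weight β (rowKernel 0) (zip ls xs) ≡ weight β t ls
  weight-lastColumn free     []       []        = refl
  weight-lastColumn free     (l ∷ ls) ([] ∷ xs) = chain-lastColumn _ l ls xs
  weight-lastColumn periodic []       []        = refl
  weight-lastColumn periodic (l ∷ ls) ([] ∷ xs) = chain-lastColumn _ l ls xs

  -- The bits are those of the vertices L in the first column.
  blockSum : Boundary → ∀ n {p} → Vec Bool p → ℕ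
  blockSum β n {p} ls = ∑ (vecs (rows n) p) (λ xs → weight β (rowKernel n) (zip ls xs))

  blockSum-zero : ∀ β {p} (ls : Vec Bool p) → blockSum β 0 ls ≡ weight β t ls
  blockSum-zero β {p} ls = begin
    ∑ (vecs (rows 0) p) (λ xs → weight β (rowKernel 0) (zip ls xs))
      ≡⟨ ∑-cong (vecs (rows 0) p) (λ xs →
        trans (weight-lastColumn β ls xs) (sym (*-identityʳ (weight β t ls)))) ⟩
    ∑ (vecs (rows 0) p) (λ xs → weight β t ls * 1)
      ≡⟨ ∑-*ˡ (vecs (rows 0) p) (weight β t ls) (λ _ → 1) ⟩
    weight β t ls * ∑ (vecs (rows 0) p) (λ _ → 1)
      ≡⟨ cong (weight β t ls *_) (trans (∑-vecs-1 (rows 0) p) (^-zeroˡ p)) ⟩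
    weight β t ls * 1
      ≡⟨ *-identityʳ _ ⟩
    weight β t ls ∎
    where open ≡-Reasoning

  -- This is the transfer operator in the other direction. The first column contributes the weight
  -- of its vertical links, and only the bits `isFar` reach the next column, so the operator acts on
  -- functions of p bits whatever n is.
  blockSum-suc : ∀ β n {p} (ls : Vec Bool p) → blockSum β (suc n) ls ≡
    ∑ (vecs links p) (λ ss → weight β t (zipWith blocked ls ss) * blockSum β n (Vec.map isFar ss))
  blockSum-suc β n {p} ls = begin
    blockSum β (suc n) ls
      ≡⟨ ∑-columns links p _ ⟩
    ∑ (vecs links p) (λ ss →
      ∑ (vecs (rows n) p) (λ xs → weight β (rowKernel (suc n)) (zip ls (zipWith _∷_ ss xs))))
      ≡⟨ ∑-cong (vecs links p) (λ ss → ∑-cong (vecs (rows n) p) (weight-column β ls ss)) ⟩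
    ∑ (vecs links p) (λ ss → ∑ (vecs (rows n) p) (λ xs →
      weight β t (zipWith blocked ls ss) * weight β (rowKernel n) (zip (Vec.map isFar ss) xs)))
      ≡⟨ ∑-cong (vecs links p) (λ ss →
        ∑-*ˡ (vecs (rows n) p) (weight β t (zipWith blocked ls ss)) _) ⟩
    ∑ (vecs links p) (λ ss → weight β t (zipWith blocked ls ss) * blockSum β n (Vec.map isFar ss)) ∎
    where open ≡-Reasoning

  chain-false : ∀ n (c : Bool × Vec Link n → ℕ) {p} x (xs : Vec (Vec Link n) p) →
    chain (rowKernel₀ n) (λ y → c (false , y)) x xs ≡ chain (rowKernel n) c (false , x)
      (zip (replicate p false) xs)
  chain-false n c x []       = refl
  chain-false n c x (y ∷ xs) = cong (rowKernel₀ n x y *_) (chain-false n c y xs)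

  weight-false : ∀ β n {p} (xs : Vec (Vec Link n) p) →
    weight β (rowKernel₀ n) xs ≡ weight β (rowKernel n) (zip (replicate p false) xs)
  weight-false free     n []       = refl
  weight-false free     n (x ∷ xs) = chain-false n _ x xs
  weight-false periodic n []       = refl
  weight-false periodic n (x ∷ xs) = chain-false n _ x xs

  ∑-weight : ∀ β n p →
    ∑ (vecs (rows n) p) (weight β (rowKernel₀ n)) ≡ blockSum β n (replicate p false)
  ∑-weight β n p = ∑-cong (vecs (rows n) p) (weight-false β n)

  -- Tabulated functions of bit vectors, which the type checker can evaluate.
  data Tree : ℕ → Set where
    leaf : ℕ → Tree 0
    node : ∀ {p} → Tree p → Tree p → Tree (suc p)

  look : ∀ {p} → Tree p → Vec Bool p → ℕ
  look (leaf x)   []          = x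
  look (node u v) (false ∷ b) = look u b
  look (node u v) (true  ∷ b) = look v b

  tabulate : ∀ p → (Vec Bool p → ℕ) → Tree p
  tabulate zero    g = leaf (g [])
  tabulate (suc p) g = node (tabulate p (λ b → g (false ∷ b))) (tabulate p (λ b → g (true ∷ b)))

  look-tabulate : ∀ p g b → look (tabulate p g) b ≡ g b
  look-tabulate zero    g []          = refl
  look-tabulate (suc p) g (false ∷ b) = look-tabulate p _ b
  look-tabulate (suc p) g (true  ∷ b) = look-tabulate p _ b

  infixl 6 _⊕_
  infixl 7 _⊛_

  _⊕_ : ∀ {p} → Tree p → Tree p → Tree p
  leaf x   ⊕ leaf y     = leaf (x + y)
  node u v ⊕ node u′ v′ = node (u ⊕ u′) (v ⊕ v′)

  look-⊕ : ∀ {p} (u v : Tree p) b → look (u ⊕ v) b ≡ look u b + look v b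
  look-⊕ (leaf x)   (leaf y)     []          = refl
  look-⊕ (node u v) (node u′ v′) (false ∷ b) = look-⊕ u u′ b
  look-⊕ (node u v) (node u′ v′) (true  ∷ b) = look-⊕ v v′ b

  -- Passing the repeated subtrees as arguments makes evaluation share them.
  addToBoth : ∀ {p} → Tree p → Tree p → Tree p → Tree (suc p)
  addToBoth w u v = node (u ⊕ w) (v ⊕ w)

  -- The operator of `blockSum-suc`, split by the link of the first row. For the bit `false` the
  -- states none, near and far give W₀ ⊛ u, W₁ ⊛ u and W₀ ⊛ v; for `true` they give W₁ ⊛ u twice and
  -- W₁ ⊛ v. By linearity three recursive products replace these six.
  _⊛_ : ∀ {p} → Tree p → Tree p → Tree p
  ⊛-node : ∀ {p} → Tree p → Tree p → Tree p → Tree p → Tree (suc p)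

  leaf x     ⊛ leaf y   = leaf (x * y)
  node W₀ W₁ ⊛ node u v = ⊛-node W₀ W₁ u (u ⊕ v)

  ⊛-node W₀ W₁ u u+v = addToBoth (W₁ ⊛ u) (W₀ ⊛ u+v) (W₁ ⊛ u+v)

  look-⊛ : ∀ {p} (W w : Tree p) ls → look (W ⊛ w) ls ≡
           ∑ (vecs links p) (λ ss → look W (zipWith blocked ls ss) * look w (Vec.map isFar ss))
  look-⊛ (leaf x) (leaf y) [] = sym (+-identityʳ (x * y))
  look-⊛ {suc p} (node W₀ W₁) (node u v) (l ∷ ls) = trans (cases l) (sym (∑-vecs-suc links p _))
    where
    S : Tree p → Tree p → ℕ
    S W w = ∑ (vecs links p) (λ ss → look W (zipWith blocked ls ss) * look w (Vec.map isFar ss))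

    expand : ∀ W → look (W ⊛ (u ⊕ v) ⊕ W₁ ⊛ u) ls ≡ S W u + S W v + S W₁ u
    expand W = begin
      look (W ⊛ (u ⊕ v) ⊕ W₁ ⊛ u) ls              ≡⟨ look-⊕ (W ⊛ (u ⊕ v)) (W₁ ⊛ u) ls ⟩
      look (W ⊛ (u ⊕ v)) ls + look (W₁ ⊛ u) ls
        ≡⟨ cong₂ _+_ (look-⊛ W (u ⊕ v) ls) (look-⊛ W₁ u ls) ⟩
      S W (u ⊕ v) + S W₁ u
        ≡⟨ cong (_+ S W₁ u) (∑-cong (vecs links p) distrib) ⟩
      ∑ (vecs links p) _ + S W₁ u                 ≡⟨ cong (_+ S W₁ u) (∑-+ (vecs links p) _ _) ⟩
      S W u + S W v + S W₁ u                      ∎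
      where
      open ≡-Reasoning
      distrib : ∀ ss → look W (zipWith blocked ls ss) * look (u ⊕ v) (Vec.map isFar ss) ≡
        look W (zipWith blocked ls ss) * look u (Vec.map isFar ss) +
        look W (zipWith blocked ls ss) * look v (Vec.map isFar ss)
      distrib ss = trans (cong (look W (zipWith blocked ls ss) *_) (look-⊕ u v (Vec.map isFar ss)))
        (*-distribˡ-+ (look W (zipWith blocked ls ss)) _ _)

    reorder : ∀ a b c → a + b + c ≡ a + (c + (b + 0))
    reorder = solve-∀

    cases : ∀ l → look (node W₀ W₁ ⊛ node u v) (l ∷ ls) ≡
      ∑ links (λ s → ∑ (vecs links p) (λ ss →
        look (node W₀ W₁) (zipWith blocked (l ∷ ls) (s ∷ ss)) * look (node u v)
          (Vec.map isFar (s ∷ ss))))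
    cases false = trans (expand W₀) (reorder (S W₀ u) (S W₀ v) (S W₁ u))
    cases true  = trans (expand W₁) (reorder (S W₁ u) (S W₁ v) (S W₁ u))

  -- The index counts horizontal links: with none of them, `W` is already one column of squares.
  columns : ∀ {p} → Tree p → ℕ → Tree p
  columns W zero    = W
  columns W (suc n) = W ⊛ columns W n

  look-columns : ∀ β n {p} (ls : Vec Bool p) →
    look (columns (tabulate p (weight β t)) n) ls ≡ blockSum β n ls
  look-columns β zero    ls = trans (look-tabulate _ (weight β t) ls) (sym (blockSum-zero β ls))
  look-columns β (suc n) {p} ls = begin
    look (W ⊛ columns W n) ls
      ≡⟨ look-⊛ W (columns W n) ls ⟩
    ∑ (vecs links p) (λ ss → look W (zipWith blocked ls ss) * look (columns W n) (Vec.map isFar ss))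
      ≡⟨ ∑-cong (vecs links p) (λ ss →
        cong₂ _*_ (look-tabulate p (weight β t) (zipWith blocked ls ss))
          (look-columns β n (Vec.map isFar ss))) ⟩
    ∑ (vecs links p) (λ ss → weight β t (zipWith blocked ls ss) * blockSum β n (Vec.map isFar ss))
      ≡⟨ blockSum-suc β n ls ⟨
    blockSum β (suc n) ls ∎
    where
    open ≡-Reasoning
    W = tabulate p (weight β t)

  scaled≤ᵇ : ℕ → ℕ → ∀ {p} → Tree p → Tree p → Bool
  scaled≤ᵇ b a (leaf x)   (leaf y)     = b * x ≤ᵇ a * y
  scaled≤ᵇ b a (node u v) (node u′ v′) = scaled≤ᵇ b a u u′ ∧ scaled≤ᵇ b a v v′

  scaled≤ᵇ⇒≤ : ∀ b a {p} (u v : Tree p) → T (scaled≤ᵇ b a u v) → ∀ ls →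
    b * look u ls ≤ a * look v ls
  scaled≤ᵇ⇒≤ b a (leaf x)   (leaf y)     h []           = ≤ᵇ⇒≤ _ _ h
  scaled≤ᵇ⇒≤ b a (node u v) (node u′ v′) h (false ∷ ls) =
    scaled≤ᵇ⇒≤ b a u u′ (proj₁ (Equivalence.to T-∧ h)) ls
  scaled≤ᵇ⇒≤ b a (node u v) (node u′ v′) h (true ∷ ls)  =
    scaled≤ᵇ⇒≤ b a v v′ (proj₂ (Equivalence.to (T-∧ {scaled≤ᵇ b a u u′}) h)) ls

  -- Collatz–Wielandt for the positive operator of blockSum-suc
  blockSum-growth : ∀ β b a {p} n →
    (∀ (ls : Vec Bool p) → b * blockSum β (suc n) ls ≤ a * blockSum β n ls) →
    ∀ j (ls : Vec Bool p) → b ^ j * blockSum β (j + n) ls ≤ a ^ j * blockSum β n ls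
  blockSum-growth β b a {p} n le = pow
    where
    open ≤-Reasoning
    -- The coefficients of the operator are non-negative, so applying it preserves a pointwise
    -- inequality: the comparison at the one index n propagates to all later ones.
    step : ∀ j ls → b * blockSum β (suc (j + n)) ls ≤ a * blockSum β (j + n) ls
    step zero    ls = le ls
    step (suc j) ls = begin
      b * blockSum β (suc (suc (j + n))) ls
        ≡⟨ cong (b *_) (blockSum-suc β (suc (j + n)) ls) ⟩
      b * ∑ (vecs links p) (λ ss → w ss * blockSum β (suc (j + n)) (Vec.map isFar ss))
        ≡⟨ ∑-*ˡ (vecs links p) b _ ⟨
      ∑ (vecs links p) (λ ss → b * (w ss * blockSum β (suc (j + n)) (Vec.map isFar ss)))
        ≤⟨ ∑-mono (vecs links p) (λ ss → pointwise (w ss) (step j (Vec.map isFar ss))) ⟩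
      ∑ (vecs links p) (λ ss → a * (w ss * blockSum β (j + n) (Vec.map isFar ss)))
        ≡⟨ ∑-*ˡ (vecs links p) a _ ⟩
      a * ∑ (vecs links p) (λ ss → w ss * blockSum β (j + n) (Vec.map isFar ss))
        ≡⟨ cong (a *_) (blockSum-suc β (j + n) ls) ⟨
      a * blockSum β (suc (j + n)) ls ∎
      where
      w : Vec Link p → ℕ
      w ss = weight β t (zipWith blocked ls ss)
      exchange : ∀ b w x → w * (b * x) ≡ b * (w * x)
      exchange = solve-∀
      pointwise : ∀ w {x y} → b * x ≤ a * y → b * (w * x) ≤ a * (w * y)
      pointwise w {x} {y} bx≤ay = subst₂ _≤_ (exchange b w x) (exchange a w y) (*-monoʳ-≤ w bx≤ay)

    pow : ∀ j ls → b ^ j * blockSum β (j + n) ls ≤ a ^ j * blockSum β n ls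
    pow zero    ls = ≤-refl
    pow (suc j) ls = begin
      b ^ suc j * blockSum β (suc j + n) ls
        ≡⟨ cong (_* blockSum β (suc j + n) ls) (*-comm b (b ^ j)) ⟩
      b ^ j * b * blockSum β (suc j + n) ls   ≡⟨ *-assoc (b ^ j) b _ ⟩
      b ^ j * (b * blockSum β (suc j + n) ls) ≤⟨ *-monoʳ-≤ (b ^ j) (step j ls) ⟩
      b ^ j * (a * blockSum β (j + n) ls)     ≡⟨ swap (b ^ j) a _ ⟩
      a * (b ^ j * blockSum β (j + n) ls)     ≤⟨ *-monoʳ-≤ a (pow j ls) ⟩
      a * (a ^ j * blockSum β n ls)           ≡⟨ *-assoc a (a ^ j) _ ⟨
      a ^ suc j * blockSum β n ls             ∎
      where
      swap : ∀ x y z → x * (y * z) ≡ y * (x * z)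
      swap = solve-∀

  -- 8 = 2 · 4 is the length of the cycle in tr (T^4)².
  Z-sq : ∀ k n → Z (suc (k * 4)) n * Z (suc (k * 4)) n ≤
         3 ^ n * 3 ^ n * blockSum periodic n (replicate 8 false) ^ k
  Z-sq k n = subst₂ (λ N tr → Z (suc (k * 4)) n * Z (suc (k * 4)) n ≤ N * N * tr ^ k)
    (∑-vecs-1 links n) (∑-weight periodic n 8)
    (∑-path-sq (rows n) (rowKernel₀ n) (λ x y → rowKernel-sym n _ _) 3 k)

-- Computed certificates

module Certificates where

  open FiniteSums
  open TransferMatrix
  open import Data.Bool.Base using (Bool; false; T)
  open import Data.Nat.Base
  open import Data.Nat.Properties
  open import Data.Nat.Tactic.RingSolver using (solve-∀)
  open import Algebra.Properties.CommutativeSemigroup *-commutativeSemigroup using () renaming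
    (interchange to *-interchange)
  open import Data.Product using (∃; _,_)
  open import Data.Unit.Base using (tt)
  open import Data.Vec.Base using (Vec; replicate)
  open import Relation.Binary.PropositionalEquality

  weights : Boundary → ∀ p → Tree p
  weights β p = tabulate p (weight β t)

  -- The iterate `w` is an argument so that evaluation can share it between both sides of the
  -- comparison.
  growth≤ᵇ : ℕ → ℕ → ∀ {p} → Tree p → Tree p → Bool
  growth≤ᵇ b a W w = scaled≤ᵇ b a (W ⊛ w) w

  growth≤ᵇ⇒≤ : ∀ β b a p n → T (growth≤ᵇ b a (weights β p) (columns (weights β p) n)) →
    ∀ ls → b * blockSum β (suc n) ls ≤ a * blockSum β n ls
  growth≤ᵇ⇒≤ β b a p n h ls = subst₂ (λ x y → b * x ≤ a * y)
    (look-columns β (suc n) ls) (look-columns β n ls)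
    (scaled≤ᵇ⇒≤ b a (columns (weights β p) (suc n)) (columns (weights β p) n) h ls)

  ≤ᵇ-columns⇒≤Z : ∀ b a m n → T (a ≤ᵇ b * look (columns (weights free m) n) (replicate m false)) →
    a ≤ b * Z m n
  ≤ᵇ-columns⇒≤Z b a m n h = subst (λ z → a ≤ b * z)
    (trans (look-columns free n (replicate m false)) (sym (∑-weight free n m))) (≤ᵇ⇒≤ _ _ h)

  -- 320 = 4 · 4 · 20
  Z-4-19 : 1467007628 ^ 320 ≤ 1000000000 ^ 320 * Z (suc 3) 19
  Z-4-19 = ≤ᵇ-columns⇒≤Z (1000000000 ^ 320) (1467007628 ^ 320) (suc 3) 19 tt

  -- A column of 8 squares has 32 vertices; 7 is the first index with this bound.
  periodic-growth : ∀ (ls : Vec Bool 8) →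
    1000000000 ^ 32 * blockSum periodic 8 ls ≤ 1549560102 ^ 32 * blockSum periodic 7 ls
  periodic-growth = growth≤ᵇ⇒≤ periodic (1000000000 ^ 32) (1549560102 ^ 32) 8 7 tt

  ^-distribʳ-* : ∀ k a b → (a * b) ^ k ≡ a ^ k * b ^ k
  ^-distribʳ-* zero    a b = refl
  ^-distribʳ-* (suc k) a b = trans (cong (a * b *_) (^-distribʳ-* k a b))
    (*-interchange a b (a ^ k) (b ^ k))

  -- Joins the norm bound for k factors T^4 to the growth bound for j columns beyond n₀. `C` depends
  -- on neither j nor k, so it enters only as C^k, against main terms with exponent jk.
  Z-sq-growth : ∀ a b n₀ →
    (∀ (ls : Vec Bool 8) → b * blockSum periodic (suc n₀) ls ≤ a * blockSum periodic n₀ ls) →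
    ∃ λ C → ∀ j k → let n = j + n₀ ; S = Z (suc (k * 4)) n in
    S * S * (b ^ j) ^ k ≤ 3 ^ n * 3 ^ n * (a ^ j * C) ^ k
  Z-sq-growth a b n₀ growth = C , λ j k →
          let n = j + n₀ ; S = Z (suc (k * 4)) n ; G = blockSum periodic n 0s in begin
    S * S * (b ^ j) ^ k                     ≤⟨ *-monoˡ-≤ ((b ^ j) ^ k) (Z-sq k n) ⟩
    3 ^ n * 3 ^ n * G ^ k * (b ^ j) ^ k     ≡⟨ *-assoc (3 ^ n * 3 ^ n) _ _ ⟩
    3 ^ n * 3 ^ n * (G ^ k * (b ^ j) ^ k)   ≡⟨ cong (3 ^ n * 3 ^ n *_) (*-comm (G ^ k) _) ⟩
    3 ^ n * 3 ^ n * ((b ^ j) ^ k * G ^ k)   ≡⟨ cong (3 ^ n * 3 ^ n *_) (^-distribʳ-* k (b ^ j) G) ⟨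
    3 ^ n * 3 ^ n * (b ^ j * G) ^ k
      ≤⟨ *-monoʳ-≤ (3 ^ n * 3 ^ n) (^-monoˡ-≤ k (blockSum-growth periodic b a n₀ growth j 0s)) ⟩
    3 ^ n * 3 ^ n * (a ^ j * C) ^ k         ∎
    where
    open ≤-Reasoning
    0s = replicate 8 false
    C = blockSum periodic n₀ 0s

  Z-upper : ∃ λ C → ∀ j k → let n = j + 7 ; S = Z (suc (k * 4)) n in
    S * S * ((1000000000 ^ 32) ^ j) ^ k ≤ 3 ^ n * 3 ^ n * ((1549560102 ^ 32) ^ j * C) ^ k
  Z-upper = Z-sq-growth (1549560102 ^ 32) (1000000000 ^ 32) 7 periodic-growth

  -- Gathers the boundary factors into one K-th power. Here 729 = 3^6: four factors 3^K come from
  -- the square on the left, two from the bound 3^n ≤ 3^K.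
  square-bound : ∀ a d c x j k n K → n ≤ K → k ≤ K →
    x * x * ((d ^ 32) ^ j) ^ k ≤ 3 ^ n * 3 ^ n * ((a ^ 32) ^ j * c) ^ k →
    (3 ^ K * 3 ^ K * x) ^ 2 * d ^ (32 * j * k) ≤
      (729 * suc c) ^ K * a ^ (32 * j * k)
  square-bound a d c x j k n K n≤K k≤K le = begin
    (P * P * x) ^ 2 * d ^ (32 * j * k)              ≡⟨ regroup P x (d ^ (32 * j * k)) ⟩
    P * P * (P * P) * (x * x * d ^ (32 * j * k))
      ≡⟨ cong (λ y → P * P * (P * P) * (x * x * y)) (powers d) ⟨
    P * P * (P * P) * (x * x * ((d ^ 32) ^ j) ^ k)  ≤⟨ *-monoʳ-≤ (P * P * (P * P)) le ⟩
    P * P * (P * P) * (3 ^ n * 3 ^ n * ((a ^ 32) ^ j * c) ^ k)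
      ≡⟨ cong (λ y → P * P * (P * P) * (3 ^ n * 3 ^ n * y))
        (trans (^-distribʳ-* k ((a ^ 32) ^ j) c) (cong (_* c ^ k) (powers a))) ⟩
    P * P * (P * P) * (3 ^ n * 3 ^ n * (a ^ (32 * j * k) * c ^ k))
      ≤⟨ *-monoʳ-≤ (P * P * (P * P)) (*-mono-≤ (*-mono-≤ 3ⁿ≤P 3ⁿ≤P)
        (*-monoʳ-≤ (a ^ (32 * j * k)) cᵏ≤)) ⟩
    P * P * (P * P) * (P * P * (a ^ (32 * j * k) * suc c ^ K))
      ≡⟨ regroup′ P (a ^ (32 * j * k)) (suc c ^ K) ⟩
    P * P * P * P * P * P * suc c ^ K * a ^ (32 * j * k)
      ≡⟨ cong (_* a ^ (32 * j * k)) (trans (cong (_* suc c ^ K) (sixth 3))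
        (sym (^-distribʳ-* K 729 (suc c)))) ⟩
    (729 * suc c) ^ K * a ^ (32 * j * k)            ∎
    where
    open ≤-Reasoning
    P : ℕ
    P = 3 ^ K
    powers : ∀ y → ((y ^ 32) ^ j) ^ k ≡ y ^ (32 * j * k)
    powers y = trans (cong (_^ k) (^-*-assoc y 32 j)) (^-*-assoc y (32 * j) k)
    3ⁿ≤P : 3 ^ n ≤ P
    3ⁿ≤P = ^-monoʳ-≤ 3 n≤K
    -- `suc c` replaces `c` because raising the exponent from k to K needs a base of at least 1.
    cᵏ≤ : c ^ k ≤ suc c ^ K
    cᵏ≤ = ≤-trans (^-monoˡ-≤ k (n≤1+n c)) (^-monoʳ-≤ (suc c) k≤K)
    sixth : ∀ b → b ^ K * b ^ K * b ^ K * b ^ K * b ^ K * b ^ K ≡ (b * b * b * b * b * b) ^ K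
    sixth b = sym (trans (^-distribʳ-* K (b * b * b * b * b) b) (cong (_* b ^ K)
      (trans (^-distribʳ-* K (b * b * b * b) b) (cong (_* b ^ K)
      (trans (^-distribʳ-* K (b * b * b) b) (cong (_* b ^ K)
      (trans (^-distribʳ-* K (b * b) b) (cong (_* b ^ K) (^-distribʳ-* K b b)))))))))
    regroup : ∀ P x y → P * P * x * (P * P * x * 1) * y ≡ P * P * (P * P) * (x * x * y)
    regroup = solve-∀
    regroup′ : ∀ P x y → P * P * (P * P) * (P * P * (x * y)) ≡ P * P * P * P * P * P * y * x
    regroup′ = solve-∀

-- Counting independent sets vertex by vertex

module IndependentSets where

  open FiniteSums
  open import Defs using (sublists)
  open import Data.Bool.Base using (Bool; true; false; _∧_; not; if_then_else_)
  open import Data.Bool.Properties using (∧-assoc; ∧-comm)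
  open import Data.List.Base using (List; []; _∷_; _++_; map; filter; length)
  open import Data.List.Membership.Propositional using (_∈_)
  open import Data.List.Membership.Propositional.Properties using (∈-∃++)
  open import Data.List.Relation.Binary.Permutation.Propositional using (_↭_; prep; swap)
    renaming (refl to ↭-refl; trans to ↭-trans)
  open import Data.List.Relation.Binary.Permutation.Propositional.Properties using (shift; ∈-resp-↭)
  open import Data.List.Relation.Unary.All as All using (All; []; _∷_; all?)
  open import Data.List.Relation.Unary.AllPairs using (AllPairs; []; _∷_; allPairs?)
  open import Data.List.Relation.Unary.Any using (here; there)
  open import Data.List.Relation.Unary.Unique.Propositional using (Unique)
  open import Data.Nat.Base
  open import Data.Nat.Properties
  open import Data.Nat.Tactic.RingSolver using (solve-∀)
  open import Data.Product using (_,_)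
  open import Function.Bundles using (mk⇔)
  open import Level using (0ℓ)
  open import Relation.Binary.Core using (Rel)
  open import Relation.Binary.Definitions using (Decidable; Symmetric)
  open import Relation.Binary.PropositionalEquality
  open import Relation.Nullary using (does; ¬_; contradiction)
  open import Relation.Nullary.Decidable using (does-⇔; ¬?)
  import Relation.Unary as Unary

  𝟙 : Bool → ℕ
  𝟙 b = if b then 1 else 0

  length-filter-∑ : ∀ {A : Set} {P : A → Set} (P? : Unary.Decidable P) xs →
                    length (filter P? xs) ≡ ∑ xs (λ x → 𝟙 (does (P? x)))
  length-filter-∑ P? []       = refl
  length-filter-∑ P? (x ∷ xs) with does (P? x)
  ... | true  = cong suc (length-filter-∑ P? xs)
  ... | false = length-filter-∑ P? xs

  allᵇ : {A : Set} → (A → Bool) → List A → Bool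
  allᵇ p []       = true
  allᵇ p (x ∷ xs) = p x ∧ allᵇ p xs

  allᵇ-true : ∀ {A : Set} (xs : List A) → allᵇ (λ _ → true) xs ≡ true
  allᵇ-true []       = refl
  allᵇ-true (x ∷ xs) = allᵇ-true xs

  ∧-interchange : ∀ a b c d → (a ∧ b) ∧ (c ∧ d) ≡ (a ∧ c) ∧ (b ∧ d)
  ∧-interchange false b     c d = refl
  ∧-interchange true  true  c d = refl
  ∧-interchange true  false c d = sym (trans (∧-comm c false) refl)

  allᵇ-∧ : ∀ {A : Set} (p q : A → Bool) xs → allᵇ (λ x → p x ∧ q x) xs ≡ allᵇ p xs ∧ allᵇ q xs
  allᵇ-∧ p q []       = refl
  allᵇ-∧ p q (x ∷ xs) = trans (cong ((p x ∧ q x) ∧_) (allᵇ-∧ p q xs))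
    (∧-interchange (p x) (q x) (allᵇ p xs) (allᵇ q xs))

  does-all? : ∀ {A : Set} {P : A → Set} (P? : Unary.Decidable P) xs →
    does (all? P? xs) ≡ allᵇ (λ x → does (P? x)) xs
  does-all? P? []       = refl
  does-all? P? (x ∷ xs) = cong (does (P? x) ∧_) (does-all? P? xs)

  module Count {V : Set} {_∼_ : Rel V 0ℓ} (_∼?_ : Decidable _∼_) (∼-sym : Symmetric _∼_) where

    independent? : Unary.Decidable (AllPairs (λ u v → ¬ (u ∼ v)))
    independent? = allPairs? (λ u v → ¬? (u ∼? v))

    adjacent : V → V → Bool
    adjacent u v = does (u ∼? v)

    adjacent-sym : ∀ u v → adjacent u v ≡ adjacent v u
    adjacent-sym u v = does-⇔ (mk⇔ ∼-sym ∼-sym) (u ∼? v) (v ∼? u)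

    -- c ∖ x is the set of those vertices of c that may be chosen together with x.
    infixl 6 _∖_
    _∖_ : (V → Bool) → V → V → Bool
    (c ∖ x) y = c y ∧ not (adjacent x y)

    -- The number of independent subsets of xs that are contained in c.
    count : (V → Bool) → List V → ℕ
    count c []       = 1
    count c (x ∷ xs) = count c xs + (if c x then count (c ∖ x) xs else 0)

    -- Tests independence by shrinking the set of admissible vertices, which is the recursion that
    -- `count` follows.
    independentᵇ : (V → Bool) → List V → Bool
    independentᵇ c []       = true
    independentᵇ c (x ∷ xs) = c x ∧ independentᵇ (c ∖ x) xs

    independentᵇ-correct : ∀ c xs → independentᵇ c xs ≡ allᵇ c xs ∧ does (independent? xs)
    independentᵇ-correct c []       = refl
    independentᵇ-correct c (x ∷ xs) = begin
      c x ∧ independentᵇ (c ∖ x) xs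
        ≡⟨ cong (c x ∧_) (independentᵇ-correct (c ∖ x) xs) ⟩
      c x ∧ (allᵇ (c ∖ x) xs ∧ I)
        ≡⟨ cong (λ a → c x ∧ (a ∧ I)) (trans (allᵇ-∧ c (λ y → not (adjacent x y)) xs)
             (cong (allᵇ c xs ∧_) (sym (does-all? (λ y → ¬? (x ∼? y)) xs)))) ⟩
      c x ∧ ((allᵇ c xs ∧ N) ∧ I)
        ≡⟨ cong (c x ∧_) (∧-assoc (allᵇ c xs) N I) ⟩
      c x ∧ (allᵇ c xs ∧ (N ∧ I))
        ≡⟨ ∧-assoc (c x) (allᵇ c xs) (N ∧ I) ⟨
      (c x ∧ allᵇ c xs) ∧ (N ∧ I) ∎
      where
      open ≡-Reasoning
      I = does (independent? xs)
      N = does (all? (λ y → ¬? (x ∼? y)) xs)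

    ∑-independentᵇ : ∀ c xs → ∑ (sublists xs) (λ S → 𝟙 (independentᵇ c S)) ≡ count c xs
    ∑-independentᵇ c []       = refl
    ∑-independentᵇ c (x ∷ xs) = begin
      ∑ (sublists xs ++ map (x ∷_) (sublists xs)) (λ S → 𝟙 (independentᵇ c S))
        ≡⟨ ∑-++ (sublists xs) _ _ ⟩
      ∑ (sublists xs) (λ S → 𝟙 (independentᵇ c S)) + ∑ (map (x ∷_) (sublists xs))
        (λ S → 𝟙 (independentᵇ c S))
        ≡⟨ cong₂ _+_ (∑-independentᵇ c xs) (∑-map (x ∷_) (sublists xs) _) ⟩
      count c xs + ∑ (sublists xs) (λ S → 𝟙 (c x ∧ independentᵇ (c ∖ x) S))
        ≡⟨ cong (count c xs +_) chosen ⟩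
      count c (x ∷ xs) ∎
      where
      open ≡-Reasoning
      chosen : ∑ (sublists xs) (λ S → 𝟙 (c x ∧ independentᵇ (c ∖ x) S)) ≡
        (if c x then count (c ∖ x) xs else 0)
      chosen with c x
      ... | true  = ∑-independentᵇ (c ∖ x) xs
      ... | false = ∑-zero (sublists xs)

    length-filter-independent? : ∀ xs →
      length (filter independent? (sublists xs)) ≡ count (λ _ → true) xs
    length-filter-independent? xs = begin
      length (filter independent? (sublists xs))
        ≡⟨ length-filter-∑ independent? (sublists xs) ⟩
      ∑ (sublists xs) (λ S → 𝟙 (does (independent? S)))
        ≡⟨ ∑-cong (sublists xs) (λ S → cong 𝟙
             (trans (independentᵇ-correct (λ _ → true) S)
               (cong (_∧ does (independent? S)) (allᵇ-true S)))) ⟨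
      ∑ (sublists xs) (λ S → 𝟙 (independentᵇ (λ _ → true) S))
        ≡⟨ ∑-independentᵇ (λ _ → true) xs ⟩
      count (λ _ → true) xs ∎
      where open ≡-Reasoning

    count-cong : ∀ {c c′ xs} → All (λ x → c x ≡ c′ x) xs → count c xs ≡ count c′ xs
    count-cong []                         = refl
    count-cong {c} {c′} {x ∷ xs} (eq ∷ eqs) = cong₂ _+_ (count-cong eqs)
      (cong₂ (λ b k → if b then k else 0) eq (count-cong (All.map (cong (_∧ _)) eqs)))

    1≤count : ∀ c xs → 1 ≤ count c xs
    1≤count c []       = ≤-refl
    1≤count c (x ∷ xs) = ≤-trans (1≤count c xs) (m≤m+n _ _)

    -- If x and y are admissible and adjacent, both orders drop the joint choice, by symmetry of
    -- adjacency; if they are not adjacent, removing the neighbours of one commutes with removing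
    -- those of the other.
    count-swap : ∀ c x y xs → count c (x ∷ y ∷ xs) ≡ count c (y ∷ x ∷ xs)
    count-swap c x y xs
      rewrite adjacent-sym y x with c x | c y | adjacent x y
    ... | false | false | _     = refl
    ... | false | true  | _     = false-true (count c xs) (count (c ∖ y) xs)
      where
      false-true : ∀ a b → a + b + 0 ≡ a + 0 + (b + 0)
      false-true = solve-∀
    ... | true  | false | _     = true-false (count c xs) (count (c ∖ x) xs)
      where
      true-false : ∀ a b → a + 0 + (b + 0) ≡ a + b + 0
      true-false = solve-∀
    ... | true  | true  | true  = exclusive (count c xs) (count (c ∖ x) xs) (count (c ∖ y) xs)
      where
      exclusive : ∀ a b d → a + d + (b + 0) ≡ a + b + (d + 0)
      exclusive = solve-∀
    ... | true  | true  | false = trans (+-interchange (count c xs) _ _ _)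
      (cong (λ k → count c xs + count (c ∖ x) xs + (count (c ∖ y) xs + k))
        (count-cong (All.universal (λ z → ∖-comm (c z) (adjacent x z) (adjacent y z)) xs)))
      where
      ∖-comm : ∀ a b d → (a ∧ not b) ∧ not d ≡ (a ∧ not d) ∧ not b
      ∖-comm a b d = trans (∧-assoc a (not b) (not d))
        (trans (cong (a ∧_) (∧-comm (not b) (not d))) (sym (∧-assoc a (not d) (not b))))

    count-∷ : ∀ x xs ys → (∀ c → count c xs ≡ count c ys) → ∀ c →
      count c (x ∷ xs) ≡ count c (x ∷ ys)
    count-∷ x xs ys eq c = cong₂ (λ a b → a + (if c x then b else 0)) (eq c) (eq (c ∖ x))

    count-↭ : ∀ {xs ys} → xs ↭ ys → ∀ c → count c xs ≡ count c ys
    count-↭ ↭-refl        c = refl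
    count-↭ (prep {xs} {ys} x p)   c = count-∷ x xs ys (count-↭ p) c
    count-↭ (swap {xs} {ys} x y p) c = trans (count-swap c x y xs)
      (count-∷ y (x ∷ xs) (x ∷ ys) (count-∷ x xs ys (count-↭ p)) c)
    count-↭ (↭-trans p q) c = trans (count-↭ p c) (count-↭ q c)

    -- Applied in both directions, this exchanges duplicate-free lists with the same entries.
    -- Permutation invariance moves the head of `xs` to the front of `ys`, where the two recursions
    -- run in parallel.
    count-⊆ : ∀ c {xs ys} → Unique xs → (∀ {x} → x ∈ xs → x ∈ ys) → count c xs ≤ count c ys
    count-⊆ c {[]}     {ys} _        _     = 1≤count c ys
    count-⊆ c {x ∷ xs} {ys} (x≢ ∷ u) xs⊆ys with ∈-∃++ (xs⊆ys (here refl))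
    ... | as , bs , refl = ≤-trans
      (+-mono-≤ (count-⊆ c u xs⊆as++bs) (chosen (c x)))
      (≤-reflexive (sym (count-↭ (shift x as bs) c)))
      where
      xs⊆as++bs : ∀ {y} → y ∈ xs → y ∈ as ++ bs
      xs⊆as++bs y∈xs with ∈-resp-↭ (shift x as bs) (xs⊆ys (there y∈xs))
      ... | here y≡x = contradiction (sym y≡x) (All.lookup x≢ y∈xs)
      ... | there y∈ = y∈

      chosen : ∀ b →
        (if b then count (c ∖ x) xs else 0) ≤ (if b then count (c ∖ x) (as ++ bs) else 0)
      chosen true  = count-⊆ (c ∖ x) u xs⊆as++bs
      chosen false = z≤n

    count-map : (φ : V → V) → (∀ u v → adjacent (φ u) (φ v) ≡ adjacent u v) →
                ∀ c xs → count c (map φ xs) ≡ count (λ x → c (φ x)) xs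
    count-map φ hom c []       = refl
    count-map φ hom c (x ∷ xs) = cong₂ (λ a b → a + (if c (φ x) then b else 0))
      (count-map φ hom c xs)
      (trans (count-map φ hom (c ∖ φ x) xs)
        (count-cong (All.universal (λ y → cong (λ b → c (φ y) ∧ not b) (hom x y)) xs)))

-- From the lattice graph to the transfer matrix

module Links where

  open FiniteSums
  open TransferMatrix
  open IndependentSets
  open import Defs using (U; D; L; R; Vertex; HasCorner; hasCorner?; oneTo; corners; latticeVertices; unique-vertices; Edge; UL; UR; DL; DR; DU; RL; symClosure?; f)
  open import Data.Bool.Base using (Bool; true; false; _∧_; _∨_; not; if_then_else_)
  open import Data.Bool.Properties using (∨-identityʳ; ∨-zeroʳ; ∧-zeroʳ; ∧-identityʳ)
  open import Data.List.Base using (List; []; _∷_; _++_; map; cartesianProduct)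
  open import Data.List.Membership.Propositional using (_∈_)
  open import Data.List.Membership.Propositional.Properties
  open import Data.List.Relation.Unary.All as All using (All; []; _∷_)
  import Data.List.Relation.Unary.All.Properties as All
  open import Data.List.Relation.Unary.AllPairs using ([]; _∷_)
  open import Data.List.Relation.Unary.Any using (here; there)
  open import Data.List.Relation.Unary.Unique.Propositional using (Unique)
  open import Data.List.Relation.Unary.Unique.Propositional.Properties using (++⁺; map⁺)
  open import Data.Nat.Base
  open import Data.Nat.Properties
  open import Data.Nat.Tactic.RingSolver using (solve-∀)
  open import Data.Product using (_×_; _,_; proj₁; proj₂)
  open import Data.Sum.Base using (_⊎_; inj₁; inj₂)
  open import Data.Vec.Base using (Vec; []; _∷_)
  open import Function.Bundles using (mk⇔)
  open import Relation.Binary.Construct.Closure.Symmetric using (SymClosure; fwd; bwd; symmetric)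
  open import Relation.Binary.PropositionalEquality
  open import Relation.Nullary using (does; ¬_)
  open import Relation.Nullary.Decidable using (does-⇔; dec-true; dec-false; _×-dec_)

  open Count symClosure? (symmetric Edge)

  f-count : ∀ m n → f m n ≡ count (λ _ → true) (latticeVertices m n)
  f-count m n = length-filter-independent? (latticeVertices m n)

  1≤f : ∀ m n → 1 ≤ f m n
  1≤f m n = subst (1 ≤_) (sym (f-count m n)) (1≤count (λ _ → true) (latticeVertices m n))

  -- Symmetry under transposition

  transpose : Vertex → Vertex
  transpose (a , b , U) = b , a , L
  transpose (a , b , D) = b , a , R
  transpose (a , b , L) = b , a , U
  transpose (a , b , R) = b , a , D

  transpose-involutive : ∀ v → transpose (transpose v) ≡ v
  transpose-involutive (a , b , U) = refl
  transpose-involutive (a , b , D) = refl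
  transpose-involutive (a , b , L) = refl
  transpose-involutive (a , b , R) = refl

  transpose-edge : ∀ {u v} → Edge u v → SymClosure Edge (transpose u) (transpose v)
  transpose-edge UL = bwd UL
  transpose-edge UR = bwd DL
  transpose-edge DL = bwd UR
  transpose-edge DR = bwd DR
  transpose-edge DU = fwd RL
  transpose-edge RL = fwd DU

  transpose-∼ : ∀ {u v} → SymClosure Edge u v → SymClosure Edge (transpose u) (transpose v)
  transpose-∼ (fwd e) = transpose-edge e
  transpose-∼ (bwd e) with transpose-edge e
  ... | fwd e′ = bwd e′
  ... | bwd e′ = fwd e′

  adjacent-transpose : ∀ u v → adjacent (transpose u) (transpose v) ≡ adjacent u v
  adjacent-transpose u v = does-⇔ (mk⇔ back transpose-∼) (symClosure? (transpose u) (transpose v))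
    (symClosure? u v)
    where
    back : SymClosure Edge (transpose u) (transpose v) → SymClosure Edge u v
    back e = subst₂ (SymClosure Edge) (transpose-involutive u) (transpose-involutive v)
      (transpose-∼ e)

  record InLattice (m n : ℕ) (v : Vertex) : Set where
    constructor inLattice
    field
      1≤a    : 1 ≤ proj₁ v
      a≤m    : proj₁ v ≤ m
      1≤b    : 1 ≤ proj₁ (proj₂ v)
      b≤n    : proj₁ (proj₂ v) ≤ n
      corner : HasCorner m n v

  ∈-oneTo⁺ : ∀ {a m} → 1 ≤ a → a ≤ m → a ∈ oneTo m
  ∈-oneTo⁺ (s≤s z≤n) a≤m = ∈-applyUpTo⁺ suc a≤m

  ∈-oneTo⁻ : ∀ {a m} → a ∈ oneTo m → 1 ≤ a × a ≤ m
  ∈-oneTo⁻ a∈ with ∈-applyUpTo⁻ suc a∈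
  ... | _ , i<m , refl = s≤s z≤n , i<m

  ∈-corners : ∀ c → c ∈ corners
  ∈-corners U = here refl
  ∈-corners D = there (here refl)
  ∈-corners L = there (there (here refl))
  ∈-corners R = there (there (there (here refl)))

  ∈-lattice⁺ : ∀ m n {v} → InLattice m n v → v ∈ latticeVertices m n
  ∈-lattice⁺ m n {a , b , c} (inLattice 1≤a a≤m 1≤b b≤n h) = ∈-filter⁺ (hasCorner? m n)
    (∈-cartesianProduct⁺ (∈-oneTo⁺ 1≤a a≤m)
      (∈-cartesianProduct⁺ (∈-oneTo⁺ 1≤b b≤n) (∈-corners c))) h

  ∈-lattice⁻ : ∀ m n {v} → v ∈ latticeVertices m n → InLattice m n v
  ∈-lattice⁻ m n {v} v∈ =
    let v∈grid , h    = ∈-filter⁻ (hasCorner? m n) v∈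
        a∈ , bc∈      = ∈-cartesianProduct⁻ (oneTo m) (cartesianProduct (oneTo n) corners) v∈grid
        b∈ , c∈       = ∈-cartesianProduct⁻ (oneTo n) corners bc∈
        1≤a , a≤m     = ∈-oneTo⁻ a∈
        1≤b , b≤n     = ∈-oneTo⁻ b∈
    in inLattice 1≤a a≤m 1≤b b≤n h

  transpose-inLattice : ∀ {m n v} → InLattice m n v → InLattice n m (transpose v)
  transpose-inLattice {v = a , b , U} (inLattice 1≤a a≤m 1≤b b≤n h) = inLattice 1≤b b≤n 1≤a a≤m h
  transpose-inLattice {v = a , b , D} (inLattice 1≤a a≤m 1≤b b≤n h) = inLattice 1≤b b≤n 1≤a a≤m h
  transpose-inLattice {v = a , b , L} (inLattice 1≤a a≤m 1≤b b≤n h) = inLattice 1≤b b≤n 1≤a a≤m h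
  transpose-inLattice {v = a , b , R} (inLattice 1≤a a≤m 1≤b b≤n h) = inLattice 1≤b b≤n 1≤a a≤m h

  -- One inequality suffices since m and n are arbitrary. Transposing changes the order of the list
  -- of vertices, which `count-⊆` absorbs.
  f-transpose-≤ : ∀ m n → f m n ≤ f n m
  f-transpose-≤ m n = begin
    f m n
      ≡⟨ f-count m n ⟩
    count (λ _ → true) (latticeVertices m n)
      ≡⟨ count-map transpose adjacent-transpose (λ _ → true) (latticeVertices m n) ⟨
    count (λ _ → true) (map transpose (latticeVertices m n))
      ≤⟨ count-⊆ (λ _ → true) (map⁺ transpose-injective (unique-vertices m n)) ⊆ ⟩
    count (λ _ → true) (latticeVertices n m)
      ≡⟨ f-count n m ⟨
    f n m ∎
    where
    open ≤-Reasoning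
    transpose-injective : ∀ {u v} → transpose u ≡ transpose v → u ≡ v
    transpose-injective {u} {v} eq =
      trans (sym (transpose-involutive u)) (trans (cong transpose eq) (transpose-involutive v))

    ⊆ : ∀ {v} → v ∈ map transpose (latticeVertices m n) → v ∈ latticeVertices n m
    ⊆ v∈ with ∈-map⁻ transpose v∈
    ... | u , u∈ , refl = ∈-lattice⁺ n m (transpose-inLattice (∈-lattice⁻ m n u∈))

  f-transpose : ∀ m n → f m n ≡ f n m
  f-transpose m n = ≤-antisym (f-transpose-≤ m n) (f-transpose-≤ n m)

  -- Listing the vertices link by link

  Position : Set
  Position = ℕ × ℕ

  rowPositions : ℕ → ℕ → ℕ → List Position
  rowPositions a b zero    = []
  rowPositions a b (suc n) = (a , b) ∷ rowPositions a (suc b) n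

  -- m rows of length n, of which the first has index a
  grid : ℕ → ℕ → ℕ → List Position
  grid a zero    n = []
  grid a (suc m) n = rowPositions a 1 n ++ grid (suc a) m n

  ∈-rowPositions⁺ : ∀ {a b} k {n} → k < n → (a , k + b) ∈ rowPositions a b n
  ∈-rowPositions⁺         zero    (s≤s _)   = here refl
  ∈-rowPositions⁺ {a} {b} (suc k) {suc n} (s≤s k<n) =
    there (subst (λ c → (a , c) ∈ rowPositions a (suc b) n) (+-suc k b) (∈-rowPositions⁺ k k<n))

  ∈-rowPositions⁻ : ∀ {a b n p} → p ∈ rowPositions a b n →
    proj₁ p ≡ a × b ≤ proj₂ p × proj₂ p < b + n
  ∈-rowPositions⁻ {b = b} {suc n} (here refl) = refl , ≤-refl , m<m+n b (s≤s z≤n)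
  ∈-rowPositions⁻ {b = b} {suc n} {p} (there p∈) with ∈-rowPositions⁻ p∈
  ... | eq , b<c , c<b+n = eq , <⇒≤ b<c , subst (proj₂ p <_) (sym (+-suc b n)) c<b+n

  ∈-grid⁺ : ∀ {a} j {m n b} → j < m → 1 ≤ b → b ≤ n → (j + a , b) ∈ grid a m n
  ∈-grid⁺ {a} zero    {suc m} {n} {suc b} (s≤s _) _ b≤n =
    ∈-++⁺ˡ (subst (λ c → (a , c) ∈ rowPositions a 1 n) (+-comm b 1) (∈-rowPositions⁺ b b≤n))
  ∈-grid⁺ {a} (suc j) {suc m} {n} {b} (s≤s j<m) 1≤b b≤n =
    ∈-++⁺ʳ (rowPositions a 1 n) (subst (λ c → (c , b) ∈ grid (suc a) m n) (+-suc j a)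
      (∈-grid⁺ j j<m 1≤b b≤n))

  ∈-grid⁻ : ∀ {a} m {n p} → p ∈ grid a m n →
            (a ≤ proj₁ p × proj₁ p < a + m) × (1 ≤ proj₂ p × proj₂ p ≤ n)
  ∈-grid⁻ {a} (suc m) {n} {p} p∈ with ∈-++⁻ (rowPositions a 1 n) p∈
  ... | inj₁ p∈row = let eq , 1≤b , b≤n = ∈-rowPositions⁻ p∈row in
    (≤-reflexive (sym eq) , subst (_< a + suc m) (sym eq) (m<m+n a (s≤s z≤n))) , 1≤b , s≤s⁻¹ b≤n
  ... | inj₂ p∈rest = let (a<a′ , a′<a+m) , bounds = ∈-grid⁻ m p∈rest in
    (<⇒≤ a<a′ , subst (proj₁ p <_) (sym (+-suc a m)) a′<a+m) , bounds

  unique-rowPositions : ∀ a b n → Unique (rowPositions a b n)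
  unique-rowPositions a b zero    = []
  unique-rowPositions a b (suc n) =
    All.tabulate (λ p∈ eq → <⇒≢ (proj₁ (proj₂ (∈-rowPositions⁻ p∈))) (cong proj₂ eq)) ∷
    unique-rowPositions a (suc b) n

  unique-grid : ∀ a m n → Unique (grid a m n)
  unique-grid a zero    n = []
  unique-grid a (suc m) n = ++⁺ (unique-rowPositions a 1 n) (unique-grid (suc a) m n)
    (λ (p∈row , p∈rest) →
      <⇒≢ (proj₁ (proj₁ (∈-grid⁻ m p∈rest))) (sym (proj₁ (∈-rowPositions⁻ p∈row))))

  -- The two ends of a link are neighbours in the list, so that `count` meets them together and the
  -- link acts as one unit with three states.
  horizontal : List Position → List Vertex
  horizontal []             = []
  horizontal ((a , b) ∷ ps) = (a , b , R) ∷ (a , suc b , L) ∷ horizontal ps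

  vertical : List Position → List Vertex
  vertical []             = []
  vertical ((a , b) ∷ ps) = (a , b , D) ∷ (suc a , b , U) ∷ vertical ps

  -- Carries a property from positions to vertices while recording which end of its link a vertex
  -- is.
  data HorizontalOf (P : Position → Set) : Vertex → Set where
    right : ∀ {a b} → P (a , b) → HorizontalOf P (a , b , R)
    left  : ∀ {a b} → P (a , b) → HorizontalOf P (a , suc b , L)

  data VerticalOf (P : Position → Set) : Vertex → Set where
    down : ∀ {a b} → P (a , b) → VerticalOf P (a , b , D)
    up   : ∀ {a b} → P (a , b) → VerticalOf P (suc a , b , U)

  horizontal-all : ∀ {P ps} → All P ps → All (HorizontalOf P) (horizontal ps)
  horizontal-all []         = []
  horizontal-all (px ∷ pxs) = right px ∷ left px ∷ horizontal-all pxs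

  vertical-all : ∀ {P ps} → All P ps → All (VerticalOf P) (vertical ps)
  vertical-all []         = []
  vertical-all (px ∷ pxs) = down px ∷ up px ∷ vertical-all pxs

  all-∈ : ∀ {A : Set} (xs : List A) → All (_∈ xs) xs
  all-∈ xs = All.tabulate (λ x∈ → x∈)

  ∈-horizontal : ∀ {a b ps} → (a , b) ∈ ps →
    (a , b , R) ∈ horizontal ps × (a , suc b , L) ∈ horizontal ps
  ∈-horizontal (here refl) = here refl , there (here refl)
  ∈-horizontal (there p∈)  = let r , l = ∈-horizontal p∈ in there (there r) , there (there l)

  ∈-vertical : ∀ {a b ps} → (a , b) ∈ ps → (a , b , D) ∈ vertical ps × (suc a , b , U) ∈ vertical ps
  ∈-vertical (here refl) = here refl , there (here refl)
  ∈-vertical (there p∈)  = let d , u = ∈-vertical p∈ in there (there d) , there (there u)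

  unique-horizontal : ∀ {ps} → Unique ps → Unique (horizontal ps)
  unique-horizontal []       = []
  unique-horizontal (p≢ ∷ u) =
    ((λ ()) ∷ All.map (λ { (right p≢q) refl → p≢q refl ; (left _) () }) (horizontal-all p≢)) ∷
    All.map (λ { (left p≢q) refl → p≢q refl ; (right _) () }) (horizontal-all p≢) ∷
    unique-horizontal u

  unique-vertical : ∀ {ps} → Unique ps → Unique (vertical ps)
  unique-vertical []       = []
  unique-vertical (p≢ ∷ u) =
    ((λ ()) ∷ All.map (λ { (down p≢q) refl → p≢q refl ; (up _) () }) (vertical-all p≢)) ∷
    All.map (λ { (up p≢q) refl → p≢q refl ; (down _) () }) (vertical-all p≢) ∷
    unique-vertical u

  -- Horizontal links come first: when the vertical ones are counted, it is already settled which
  -- squares are blocked. There are m + 1 rows of n horizontal links, but m rows of n + 1 vertical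
  -- ones.
  linkVertices : ℕ → ℕ → List Vertex
  linkVertices m n = horizontal (grid 1 (suc m) n) ++ vertical (grid 1 m (suc n))

  unique-linkVertices : ∀ m n → Unique (linkVertices m n)
  unique-linkVertices m n = ++⁺ (unique-horizontal (unique-grid 1 (suc m) n))
    (unique-vertical (unique-grid 1 m (suc n)))
    (λ (v∈h , v∈v) → disjoint (All.lookup (horizontal-all (all-∈ (grid 1 (suc m) n))) v∈h)
                              (All.lookup (vertical-all (all-∈ (grid 1 m (suc n)))) v∈v))
    where
    disjoint : ∀ {P Q v} → HorizontalOf P v → ¬ VerticalOf Q v
    disjoint (right _) ()
    disjoint (left _)  ()

  linkVertices⊆lattice : ∀ m n {v} → v ∈ linkVertices m n → v ∈ latticeVertices (suc m) (suc n)
  linkVertices⊆lattice m n v∈ = ∈-lattice⁺ (suc m) (suc n)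
    (case (∈-++⁻ (horizontal (grid 1 (suc m) n)) v∈))
    where
    fromHorizontal : ∀ {v} → HorizontalOf (_∈ grid 1 (suc m) n) v → InLattice (suc m) (suc n) v
    fromHorizontal (right p∈) = let (1≤a , a≤m) , 1≤b , b≤n = ∈-grid⁻ (suc m) p∈ in
      inLattice 1≤a (s≤s⁻¹ a≤m) 1≤b (m≤n⇒m≤1+n b≤n) b≤n
    fromHorizontal (left p∈) = let (1≤a , a≤m) , 1≤b , b≤n = ∈-grid⁻ (suc m) p∈ in
      inLattice 1≤a (s≤s⁻¹ a≤m) (s≤s z≤n) (s≤s b≤n) (s≤s 1≤b)

    fromVertical : ∀ {v} → VerticalOf (_∈ grid 1 m (suc n)) v → InLattice (suc m) (suc n) v
    fromVertical (down p∈) = let (1≤a , a<1+m) , 1≤b , b≤n = ∈-grid⁻ m p∈ in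
      inLattice 1≤a (m≤n⇒m≤1+n (s≤s⁻¹ a<1+m)) 1≤b b≤n (s≤s⁻¹ a<1+m)
    fromVertical (up p∈) = let (1≤a , a<1+m) , 1≤b , b≤n = ∈-grid⁻ m p∈ in
      inLattice (s≤s z≤n) a<1+m 1≤b b≤n (s≤s 1≤a)

    case : ∀ {v} → v ∈ horizontal (grid 1 (suc m) n) ⊎ v ∈ vertical (grid 1 m (suc n)) →
      InLattice (suc m) (suc n) v
    case (inj₁ v∈h) = fromHorizontal (All.lookup (horizontal-all (all-∈ (grid 1 (suc m) n))) v∈h)
    case (inj₂ v∈v) = fromVertical (All.lookup (vertical-all (all-∈ (grid 1 m (suc n)))) v∈v)

  ∈-grid1⁺ : ∀ {a b m n} → 1 ≤ a → a ≤ m → 1 ≤ b → b ≤ n → (a , b) ∈ grid 1 m n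
  ∈-grid1⁺ {suc a} {b} {m} {n} _ a≤m 1≤b b≤n =
    subst (λ c → (c , b) ∈ grid 1 m n) (+-comm a 1) (∈-grid⁺ a a≤m 1≤b b≤n)

  lattice⊆linkVertices : ∀ m n {v} → v ∈ latticeVertices (suc m) (suc n) → v ∈ linkVertices m n
  lattice⊆linkVertices m n v∈ = toLink _ (∈-lattice⁻ (suc m) (suc n) v∈)
    where
    toLink : ∀ v → InLattice (suc m) (suc n) v → v ∈ linkVertices m n
    toLink (suc (suc a) , b , U) (inLattice 1≤a a≤m 1≤b b≤n h) =
      ∈-++⁺ʳ (horizontal (grid 1 (suc m) n))
        (proj₂ (∈-vertical (∈-grid1⁺ (s≤s z≤n) (s≤s⁻¹ a≤m) 1≤b b≤n)))
    toLink (suc zero , b , U) (inLattice _ _ _ _ (s≤s ()))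
    toLink (a , b , D) (inLattice 1≤a a≤m 1≤b b≤n h) =
      ∈-++⁺ʳ (horizontal (grid 1 (suc m) n)) (proj₁ (∈-vertical (∈-grid1⁺ 1≤a h 1≤b b≤n)))
    toLink (a , suc (suc b) , L) (inLattice 1≤a a≤m 1≤b b≤n h) =
      ∈-++⁺ˡ (proj₂ (∈-horizontal (∈-grid1⁺ 1≤a a≤m (s≤s z≤n) (s≤s⁻¹ b≤n))))
    toLink (a , suc zero , L) (inLattice _ _ _ _ (s≤s ()))
    toLink (a , b , R) (inLattice 1≤a a≤m 1≤b b≤n h) =
      ∈-++⁺ˡ (proj₁ (∈-horizontal (∈-grid1⁺ 1≤a a≤m 1≤b h)))

  f-links : ∀ m n → f (suc m) (suc n) ≡ count (λ _ → true) (linkVertices m n)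
  f-links m n = trans (f-count (suc m) (suc n)) (≤-antisym
    (count-⊆ _ (unique-vertices (suc m) (suc n)) (lattice⊆linkVertices m n))
    (count-⊆ _ (unique-linkVertices m n) (linkVertices⊆lattice m n)))

  -- Whether the square (a , b) is blocked
  Blocking : Set
  Blocking = ℕ → ℕ → Bool

  unblocked : Blocking
  unblocked a b = false

  block : ℕ → ℕ → Blocking → Blocking
  block a b g a′ b′ = g a′ b′ ∨ does ((a′ ≟ a) ×-dec (b′ ≟ b))

  -- Vertices `L` and `R` are always available: outside its own link such a vertex has only
  -- neighbours `U` and `D`, and these come later in the list.
  available : Blocking → Vertex → Bool
  available g (a , b , U) = not (g a b)
  available g (a , b , D) = not (g a b)
  available g (a , b , L) = true
  available g (a , b , R) = true

  ∏ : List Position → (Position → ℕ) → ℕ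
  ∏ []       w = 1
  ∏ (p ∷ ps) w = w p * ∏ ps w

  ∏-++ : ∀ ps qs w → ∏ (ps ++ qs) w ≡ ∏ ps w * ∏ qs w
  ∏-++ []       qs w = sym (+-identityʳ _)
  ∏-++ (p ∷ ps) qs w = trans (cong (w p *_) (∏-++ ps qs w)) (sym (*-assoc (w p) _ _))

  not-∨ : ∀ x y → not (x ∨ y) ≡ not x ∧ not y
  not-∨ true  y = refl
  not-∨ false y = refl

  tAt : Blocking → Position → ℕ
  tAt g (a , b) = t (g a b) (g (suc a) b)

  ≢⇒does-×≡false : ∀ {a b a′ b′} → ¬ ((a , b) ≡ (a′ , b′)) → does ((a ≟ a′) ×-dec (b ≟ b′)) ≡ false
  ≢⇒does-×≡false {a} {b} {a′} {b′} p≢q = dec-false ((a ≟ a′) ×-dec (b ≟ b′))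
    (λ { (refl , refl) → p≢q refl })

  -- No edge joins two different vertical links.
  count-∖-U : ∀ {a b} c {ps} → All (λ q → (a , b) ≢ q) ps →
              count (c ∖ (suc a , b , U)) (vertical ps) ≡ count c (vertical ps)
  count-∖-U {a} {b} c p≢ = count-cong (All.map unaffected (vertical-all p≢))
    where
    unaffected : ∀ {v} → VerticalOf (λ q → (a , b) ≢ q) v → (c ∖ (suc a , b , U)) v ≡ c v
    unaffected (down {a′} {b′} p≢q) = trans (cong (λ x → c (a′ , b′ , D) ∧ not x)
      (≢⇒does-×≡false {suc a′} {b′} {suc a} {b} (λ { refl → p≢q refl }))) (∧-identityʳ _)
    unaffected (up p≢q) = ∧-identityʳ _

  count-∖-D : ∀ {a b} c {ps} → All (λ q → (a , b) ≢ q) ps →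
              count (c ∖ (a , b , D)) (vertical ps) ≡ count c (vertical ps)
  count-∖-D {a} {b} c p≢ = count-cong (All.map unaffected (vertical-all p≢))
    where
    unaffected : ∀ {v} → VerticalOf (λ q → (a , b) ≢ q) v → (c ∖ (a , b , D)) v ≡ c v
    unaffected (up {a′} {b′} p≢q) = trans (cong (λ x → c (suc a′ , b′ , U) ∧ not x)
      (trans (∨-identityʳ _) (≢⇒does-×≡false {suc a} {b} {suc a′} {b′} (λ { refl → p≢q refl }))))
        (∧-identityʳ _)
    unaffected (down p≢q) = ∧-identityʳ _

  -- A link has the states none, D and U, less those excluded by a blocked square, and its state
  -- does not affect the other links; hence a product of values of `t`.
  count-vertical : ∀ g {ps} → Unique ps → count (available g) (vertical ps) ≡ ∏ ps (tAt g)
  count-vertical g {[]}             []       = refl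
  count-vertical g {(a , b) ∷ ps} (p≢ ∷ u) = trans
    (cong₂ (λ x y → N + (if not (g (suc a) b) then x else 0) + (if not (g a b) then N′ + y else 0))
      (count-∖-U (available g) p≢) excluded)
    (trans (cong (λ x →
      N + (if not (g (suc a) b) then N else 0) + (if not (g a b) then x + 0 else 0))
        (count-∖-D (available g) p≢))
    (trans (three (g a b) (g (suc a) b) N)
      (cong (t (g a b) (g (suc a) b) *_) (count-vertical g u))))
    where
    N = count (available g) (vertical ps)
    N′ = count (available g ∖ (a , b , D)) (vertical ps)

    excluded : (if (available g ∖ (a , b , D)) (suc a , b , U)
                then count (available g ∖ (a , b , D) ∖ (suc a , b , U)) (vertical ps) else 0) ≡ 0
    excluded = cong (λ x →
      if x then count (available g ∖ (a , b , D) ∖ (suc a , b , U)) (vertical ps) else 0)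
      (trans (cong (λ x → not (g (suc a) b) ∧ not x)
        (dec-true (symClosure? (a , b , D) (suc a , b , U)) (fwd DU)))
        (∧-zeroʳ _))

    three : ∀ x y N → N + (if not y then N else 0) + (if not x then N + 0 else 0) ≡ t x y * N
    three true  true  N = +-identityʳ (N + 0)
    three true  false N = two N
      where
      two : ∀ N → N + N + 0 ≡ 2 * N
      two = solve-∀
    three false true  N = two N
      where
      two : ∀ N → N + 0 + (N + 0) ≡ 2 * N
      two = solve-∀
    three false false N = all N
      where
      all : ∀ N → N + N + (N + 0) ≡ 3 * N
      all = solve-∀

  -- The summands none, far, near follow the order in which `count` branches at R(a,b) and then
  -- L(a,b + 1). The continuation `k` receives the blocking that all links together leave behind.
  linkSum : Blocking → List Position → (Blocking → ℕ) → ℕ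
  linkSum g []             k = k g
  linkSum g ((a , b) ∷ ps) k =
    linkSum g ps k + linkSum (block a (suc b) g) ps k + linkSum (block a b g) ps k

  module _ {a b : ℕ} (g : Blocking) {ps : List Position} (qs : List Position)
    (p≢ : All (λ q → (a , b) ≢ q) ps) where

    private
      vertices : List Vertex
      vertices = horizontal ps ++ vertical qs

      true≡ : ∀ {x} → x ≡ false → not x ≡ true
      true≡ refl = refl

    -- Forbidding the neighbours of R(a,b) amounts to blocking the square (a,b). The one neighbour
    -- outside that square, L(a,b + 1), belongs to the link at (a,b), which `p≢` keeps out of `ps`.
    count-∖-R : count (available g ∖ (a , b , R)) vertices ≡ count
      (available (block a b g)) vertices
    count-∖-R = count-cong (All.++⁺ (All.map onHorizontal (horizontal-all p≢))
      (All.map onVertical (vertical-all (all-∈ qs))))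
      where
      onHorizontal : ∀ {v} → HorizontalOf (λ q → (a , b) ≢ q) v →
        (available g ∖ (a , b , R)) v ≡ available (block a b g) v
      onHorizontal (right _) = refl
      onHorizontal (left {a′} {b′} p≢q) = true≡ (trans (∨-identityʳ _)
        (≢⇒does-×≡false {a} {suc b} {a′} {suc b′} (λ { refl → p≢q refl })))

      onVertical : ∀ {v} → VerticalOf (_∈ qs) v →
        (available g ∖ (a , b , R)) v ≡ available (block a b g) v
      onVertical (down {a′} {b′} _) = sym (not-∨ (g a′ b′) _)
      onVertical (up {a′} {b′} _)   = sym (not-∨ (g (suc a′) b′) _)

    count-∖-L : count (available g ∖ (a , suc b , L)) vertices ≡ count
      (available (block a (suc b) g)) vertices
    count-∖-L = count-cong (All.++⁺ (All.map onHorizontal (horizontal-all p≢))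
      (All.map onVertical (vertical-all (all-∈ qs))))
      where
      onHorizontal : ∀ {v} → HorizontalOf (λ q → (a , b) ≢ q) v →
        (available g ∖ (a , suc b , L)) v ≡ available (block a (suc b) g) v
      onHorizontal (left _) = refl
      onHorizontal (right {a′} {b′} p≢q) = true≡
        (≢⇒does-×≡false {a′} {suc b′} {a} {suc b} (λ { refl → p≢q refl }))

      onVertical : ∀ {v} → VerticalOf (_∈ qs) v →
        (available g ∖ (a , suc b , L)) v ≡ available (block a (suc b) g) v
      onVertical (down {a′} {b′} _) = sym (not-∨ (g a′ b′) _)
      onVertical (up {a′} {b′} _)   = sym (not-∨ (g (suc a′) b′) _)

  count-links : ∀ g {ps} qs → Unique ps →
    count (available g) (horizontal ps ++ vertical qs) ≡ linkSum g ps
      (λ g → count (available g) (vertical qs))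
  count-links g {[]}           qs []       = refl
  count-links g {(a , b) ∷ ps} qs (p≢ ∷ u) = cong₂ _+_
    (cong₂ _+_ (count-links g qs u) (trans (count-∖-L g qs p≢)
      (count-links (block a (suc b) g) qs u)))
    (trans (cong (λ x →
      count (available g ∖ (a , b , R)) (horizontal ps ++ vertical qs) + x) excluded)
      (trans (+-identityʳ _) (trans (count-∖-R g qs p≢) (count-links (block a b g) qs u))))
    where
    excluded : (if (available g ∖ (a , b , R)) (a , suc b , L)
                then count (available g ∖ (a , b , R) ∖ (a , suc b , L))
                  (horizontal ps ++ vertical qs) else 0) ≡ 0
    excluded = cong (λ x →
      if not x then count (available g ∖ (a , b , R) ∖ (a , suc b , L))
        (horizontal ps ++ vertical qs) else 0)
      (dec-true (symClosure? (a , b , R) (a , suc b , L)) (fwd RL))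

  -- Reading the blocked squares off the states of the links

  block-self : ∀ a b g → block a b g a b ≡ true
  block-self a b g = trans (cong (g a b ∨_) (dec-true ((a ≟ a) ×-dec (b ≟ b)) (refl , refl)))
    (∨-zeroʳ (g a b))

  block-other : ∀ {a b a′ b′} g → (a′ , b′) ≢ (a , b) → block a b g a′ b′ ≡ g a′ b′
  block-other {a} {b} {a′} {b′} g q≢p = trans (cong (g a′ b′ ∨_) (≢⇒does-×≡false q≢p))
    (∨-identityʳ (g a′ b′))

  blockLink : ℕ → ℕ → Link → Blocking → Blocking
  blockLink a b none g = g
  blockLink a b near g = block a b g
  blockLink a b far  g = block a (suc b) g

  blockRow : ∀ {n} → ℕ → ℕ → Vec Link n → Blocking → Blocking
  blockRow a b []      g = g
  blockRow a b (s ∷ x) g = blockRow a (suc b) x (blockLink a b s g)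

  blockRows : ∀ {m n} → ℕ → Vec (Vec Link n) m → Blocking → Blocking
  blockRows a []       g = g
  blockRows a (x ∷ xs) g = blockRows (suc a) xs (blockRow a 1 x g)

  linkSum-row : ∀ n a b g ps k →
    linkSum g (rowPositions a b n ++ ps) k ≡ ∑ (rows n) (λ x → linkSum (blockRow a b x g) ps k)
  linkSum-row zero    a b g ps k = sym (+-identityʳ _)
  linkSum-row (suc n) a b g ps k = begin
    linkSum g rest k + linkSum (block a (suc b) g) rest k + linkSum (block a b g) rest k
      ≡⟨ reorder (linkSum g rest k) (linkSum (block a (suc b) g) rest k)
        (linkSum (block a b g) rest k) ⟩
    ∑ links (λ s → linkSum (blockLink a b s g) rest k)
      ≡⟨ ∑-cong links (λ s → linkSum-row n a (suc b) (blockLink a b s g) ps k) ⟩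
    ∑ links (λ s → ∑ (rows n) (λ x → linkSum (blockRow a b (s ∷ x) g) ps k))
      ≡⟨ ∑-vecs-suc links n _ ⟨
    ∑ (rows (suc n)) (λ x → linkSum (blockRow a b x g) ps k) ∎
    where
    open ≡-Reasoning
    rest = rowPositions a (suc b) n ++ ps
    reorder : ∀ x y z → x + y + z ≡ x + (z + (y + 0))
    reorder = solve-∀

  linkSum-grid : ∀ a m n g k →
    linkSum g (grid a m n) k ≡ ∑ (vecs (rows n) m) (λ xs → k (blockRows a xs g))
  linkSum-grid a zero    n g k = sym (+-identityʳ _)
  linkSum-grid a (suc m) n g k = begin
    linkSum g (rowPositions a 1 n ++ grid (suc a) m n) k
      ≡⟨ linkSum-row n a 1 g (grid (suc a) m n) k ⟩
    ∑ (rows n) (λ x → linkSum (blockRow a 1 x g) (grid (suc a) m n) k)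
      ≡⟨ ∑-cong (rows n) (λ x → linkSum-grid (suc a) m n (blockRow a 1 x g) k) ⟩
    ∑ (rows n) (λ x → ∑ (vecs (rows n) m) (λ xs → k (blockRows a (x ∷ xs) g)))
      ≡⟨ ∑-vecs-suc (rows n) m _ ⟨
    ∑ (vecs (rows n) (suc m)) (λ xs → k (blockRows a xs g)) ∎
    where open ≡-Reasoning

  blockLink-other : ∀ {a b a′ b′} s g → (a′ , b′) ≢ (a , b) → (a′ , b′) ≢ (a , suc b) →
                    blockLink a b s g a′ b′ ≡ g a′ b′
  blockLink-other none g ≢₁ ≢₂ = refl
  blockLink-other near g ≢₁ ≢₂ = block-other g ≢₁
  blockLink-other far  g ≢₁ ≢₂ = block-other g ≢₂

  blockLink-here : ∀ a b s g → blockLink a b s g a b ≡ blocked (g a b) s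
  blockLink-here a b none g = refl
  blockLink-here a b near g = block-self a b g
  blockLink-here a b far  g = block-other g (λ eq → 1+n≢n (sym (cong proj₂ eq)))

  blockLink-next : ∀ a b s g → g a (suc b) ≡ false → blockLink a b s g a (suc b) ≡ isFar s
  blockLink-next a b none g eq = eq
  blockLink-next a b near g eq = trans (block-other g (λ eq → 1+n≢n (cong proj₂ eq))) eq
  blockLink-next a b far  g eq = block-self a (suc b) g

  blockRow-before : ∀ {n a b c} (x : Vec Link n) g → c < b → blockRow a b x g a c ≡ g a c
  blockRow-before []      g c<b = refl
  blockRow-before (s ∷ x) g c<b = trans (blockRow-before x _ (m<n⇒m<1+n c<b))
    (blockLink-other s g (λ eq → <⇒≢ c<b (cong proj₂ eq))
      (λ eq → <⇒≢ (m<n⇒m<1+n c<b) (cong proj₂ eq)))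

  blockRow-other : ∀ {n a b a′ c} (x : Vec Link n) g → a′ ≢ a → blockRow a b x g a′ c ≡ g a′ c
  blockRow-other []      g a′≢a = refl
  blockRow-other (s ∷ x) g a′≢a = trans (blockRow-other x _ a′≢a)
    (blockLink-other s g (λ eq → a′≢a (cong proj₁ eq)) (λ eq → a′≢a (cong proj₁ eq)))

  blockRows-before : ∀ {m n a a′ c} (xs : Vec (Vec Link n) m) g → a′ < a →
    blockRows a xs g a′ c ≡ g a′ c
  blockRows-before []       g a′<a = refl
  blockRows-before (x ∷ xs) g a′<a = trans (blockRows-before xs _ (m<n⇒m<1+n a′<a))
    (blockRow-other x g (<⇒≢ a′<a))

  -- h takes from index b on the values that the links x leave behind,
  -- when the last link before them blocks the first square iff l.
  Reads : ∀ {n} → (ℕ → Bool) → ℕ → Bool → Vec Link n → Set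
  Reads h b l []      = h b ≡ l
  Reads h b l (s ∷ x) = h b ≡ blocked l s × Reads h (suc b) (isFar s) x

  Reads-cong : ∀ {n h h′ b l} (x : Vec Link n) → (∀ c → h c ≡ h′ c) → Reads h b l x → Reads h′ b l x
  Reads-cong []      eq r       = trans (sym (eq _)) r
  Reads-cong (s ∷ x) eq (r , q) = trans (sym (eq _)) r , Reads-cong x eq q

  -- Links are applied from left to right. Square b is settled once the link at b has been applied,
  -- since later links only reach squares beyond b.
  blockRow-reads : ∀ {n a b l} (x : Vec Link n) g → g a b ≡ l → (∀ c → b < c → g a c ≡ false) →
                   Reads (blockRow a b x g a) b l x
  blockRow-reads []      g at-b after = at-b
  blockRow-reads {a = a} {b} {l} (s ∷ x) g at-b after =
    trans (blockRow-before x (blockLink a b s g) ≤-refl)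
      (trans (blockLink-here a b s g) (cong (λ l → blocked l s) at-b)) ,
    blockRow-reads x (blockLink a b s g) (blockLink-next a b s g (after (suc b) ≤-refl))
      (λ c 1+b<c →
        trans (blockLink-other s g (λ eq → <⇒≢ (<-trans (n<1+n b) 1+b<c) (sym (cong proj₂ eq)))
                            (λ eq → <⇒≢ 1+b<c (sym (cong proj₂ eq))))
                          (after c (<-trans (n<1+n b) 1+b<c)))

  ∏-row : ∀ {n} G a b l l′ (x y : Vec Link n) → Reads (G a) b l x → Reads (G (suc a)) b l′ y →
          ∏ (rowPositions a b (suc n)) (tAt G) ≡ rowKernel n (l , x) (l′ , y)
  ∏-row G a b l l′ []      []       r        r′         = trans (*-identityʳ _) (cong₂ t r r′)
  ∏-row G a b l l′ (s ∷ x) (s′ ∷ y) (r , q)  (r′ , q′)  =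
    cong₂ _*_ (cong₂ t r r′) (∏-row G a (suc b) (isFar s) (isFar s′) x y q q′)

  -- Links of later rows do not touch row a, so the final blocking of two consecutive rows is the
  -- one that their own links prescribe.
  ∏-grid : ∀ {m n} a (x : Vec Link n) (xs : Vec (Vec Link n) m) g →
    (∀ a′ c → a ≤ a′ → g a′ c ≡ false) →
           ∏ (grid a m (suc n)) (tAt (blockRows a (x ∷ xs) g)) ≡ path (rowKernel₀ n) (x ∷ xs)
  ∏-grid a x []       g after = refl
  ∏-grid {suc m} {n} a x (y ∷ ys) g after = begin
    ∏ (rowPositions a 1 (suc n) ++ grid (suc a) m (suc n)) (tAt G)
      ≡⟨ ∏-++ (rowPositions a 1 (suc n)) (grid (suc a) m (suc n)) (tAt G) ⟩
    ∏ (rowPositions a 1 (suc n)) (tAt G) * ∏ (grid (suc a) m (suc n)) (tAt G)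
      ≡⟨ cong₂ _*_ (∏-row G a 1 false false x y reads-x reads-y) (∏-grid (suc a) y ys g₁ after₁) ⟩
    rowKernel₀ n x y * path (rowKernel₀ n) (y ∷ ys) ∎
    where
    open ≡-Reasoning
    g₁ = blockRow a 1 x g
    g₂ = blockRow (suc a) 1 y g₁
    G  = blockRows a (x ∷ y ∷ ys) g

    after₁ : ∀ a′ c → suc a ≤ a′ → g₁ a′ c ≡ false
    after₁ a′ c a<a′ = trans (blockRow-other x g (λ eq → <⇒≢ a<a′ (sym eq))) (after a′ c (<⇒≤ a<a′))

    reads-x : Reads (G a) 1 false x
    reads-x = Reads-cong x (λ c → sym (blockRows-before (y ∷ ys) g₁ ≤-refl))
      (blockRow-reads x g (after a 1 ≤-refl) (λ c _ → after a c ≤-refl))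

    reads-y : Reads (G (suc a)) 1 false y
    reads-y = Reads-cong y (λ c → sym (blockRows-before ys g₂ ≤-refl))
      (blockRow-reads y g₁ (after₁ (suc a) 1 ≤-refl) (λ c _ → after₁ (suc a) c ≤-refl))

  f≡Z : ∀ m n → f (suc m) (suc n) ≡ Z (suc m) n
  f≡Z m n = begin
    f (suc m) (suc n)
      ≡⟨ f-links m n ⟩
    count (λ _ → true) (linkVertices m n)
      ≡⟨ count-cong (All.universal (λ { (a , b , U) → refl ; (a , b , D) → refl ; (a , b , L) →
        refl ; (a , b , R) → refl }) (linkVertices m n)) ⟩
    count (available unblocked) (linkVertices m n)
      ≡⟨ count-links unblocked (grid 1 m (suc n)) (unique-grid 1 (suc m) n) ⟩
    linkSum unblocked (grid 1 (suc m) n) (λ g → count (available g) (vertical (grid 1 m (suc n))))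
      ≡⟨ linkSum-grid 1 (suc m) n unblocked _ ⟩
    ∑ (vecs (rows n) (suc m)) (λ xs →
      count (available (blockRows 1 xs unblocked)) (vertical (grid 1 m (suc n))))
      ≡⟨ ∑-cong (vecs (rows n) (suc m)) (λ { (x ∷ xs) →
           trans (count-vertical _ (unique-grid 1 m (suc n)))
             (∏-grid 1 x xs unblocked (λ _ _ _ → refl)) }) ⟩
    Z (suc m) n ∎
    where open ≡-Reasoning

-- Comparing rectangles with square blocks

module SquareBlocks where

  open TransferMatrix using (Z-+-≥; Z-+-≤)
  open Links using (f≡Z; f-transpose; 1≤f)
  open Certificates using (^-distribʳ-*)
  open import Defs using (f; numVertices)
  open import Data.Nat.Base
  open import Data.Nat.DivMod
  open import Data.Nat.Properties
  open import Data.Nat.Tactic.RingSolver using (solve-∀)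
  open import Data.Product using (∃; _×_; _,_)
  open import Relation.Binary.PropositionalEquality
  open import Relation.Nullary using (contradiction)

  f-+-≥ : ∀ m₁ m₂ n → f (suc m₁) (suc n) * f (suc m₂) (suc n) ≤ f (suc m₁ + suc m₂) (suc n)
  f-+-≥ m₁ m₂ n = subst₂ _≤_ (sym (cong₂ _*_ (f≡Z m₁ n) (f≡Z m₂ n))) (sym (f≡Z (m₁ + suc m₂) n))
    (Z-+-≥ (suc m₁) (suc m₂) n)

  f-+-≤ : ∀ m₁ m₂ n →
    f (suc m₁ + suc m₂) (suc n) ≤ 3 ^ suc n * (f (suc m₁) (suc n) * f (suc m₂) (suc n))
  f-+-≤ m₁ m₂ n = subst₂ _≤_ (sym (f≡Z (m₁ + suc m₂) n))
    (cong (3 ^ suc n *_) (sym (cong₂ _*_ (f≡Z m₁ n) (f≡Z m₂ n)))) (Z-+-≤ (suc m₁) (suc m₂) n)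

  f-*-≥ : ∀ s m n → f (suc m) (suc n) ^ suc s ≤ f (suc s * suc m) (suc n)
  f-*-≥ zero    m n = ≤-reflexive (trans (*-identityʳ _)
    (cong (λ m → f m (suc n)) (sym (+-identityʳ (suc m)))))
  f-*-≥ (suc s) m n = ≤-trans (*-monoʳ-≤ (f (suc m) (suc n)) (f-*-≥ s m n))
    (f-+-≥ m (m + s * suc m) n)

  f-*-≤ : ∀ s m n → f (suc s * suc m) (suc n) ≤ (3 ^ suc n * f (suc m) (suc n)) ^ suc s
  f-*-≤ zero    m n = begin
    f (suc m + 0) (suc n)                     ≡⟨ cong (λ m → f m (suc n)) (+-identityʳ (suc m)) ⟩
    f (suc m) (suc n)                         ≤⟨ m≤n*m _ (3 ^ suc n) {{m^n≢0 3 (suc n)}} ⟩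
    3 ^ suc n * f (suc m) (suc n)             ≡⟨ *-identityʳ _ ⟨
    (3 ^ suc n * f (suc m) (suc n)) ^ 1       ∎
    where open ≤-Reasoning
  f-*-≤ (suc s) m n = begin
    f (suc (suc s) * suc m) (suc n)
      ≤⟨ f-+-≤ m (m + s * suc m) n ⟩
    3 ^ suc n * (f (suc m) (suc n) * f (suc s * suc m) (suc n))
      ≡⟨ *-assoc (3 ^ suc n) _ _ ⟨
    3 ^ suc n * f (suc m) (suc n) * f (suc s * suc m) (suc n)
      ≤⟨ *-monoʳ-≤ (3 ^ suc n * f (suc m) (suc n)) (f-*-≤ s m n) ⟩
    (3 ^ suc n * f (suc m) (suc n)) ^ suc (suc s) ∎
    where open ≤-Reasoning

  -- By supermultiplicativity an additional row contributes a factor of at least f(1, n + 1) ≥ 1.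
  f-monoˡ-≤ : ∀ {m m′} n → m ≤ m′ → f (suc m) (suc n) ≤ f (suc m′) (suc n)
  f-monoˡ-≤ {m} n m≤m′ with ≤⇒≤′ m≤m′
  ... | ≤′-refl = ≤-refl
  ... | ≤′-step {m″} p = ≤-trans (f-monoˡ-≤ n (≤′⇒≤ p)) (begin
    f (suc m″) (suc n)                  ≤⟨ m≤m*n _ _ {{>-nonZero (1≤f 1 (suc n))}} ⟩
    f (suc m″) (suc n) * f 1 (suc n)    ≤⟨ f-+-≥ m″ 0 n ⟩
    f (suc m″ + 1) (suc n)              ≡⟨ cong (λ m → f m (suc n)) (+-comm (suc m″) 1) ⟩
    f (suc (suc m″)) (suc n)            ∎)
    where open ≤-Reasoning

  f-mono-≤ : ∀ {m m′ n n′} → m ≤ m′ → n ≤ n′ → f (suc m) (suc n) ≤ f (suc m′) (suc n′)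
  f-mono-≤ {m} {m′} {n} {n′} m≤m′ n≤n′ = ≤-trans (f-monoˡ-≤ n m≤m′)
    (subst₂ _≤_ (f-transpose (suc n) (suc m′)) (f-transpose (suc n′) (suc m′)) (f-monoˡ-≤ m′ n≤n′))


  -- Blocks are stacked into a strip, the strip is transposed, and copies of it are stacked.
  f-blocks-≥ : ∀ k s t → f (suc k) (suc k) ^ (suc s * suc t) ≤ f (suc s * suc k) (suc t * suc k)
  f-blocks-≥ k s t = begin
    f (suc k) (suc k) ^ (suc s * suc t)
      ≡⟨ cong (f (suc k) (suc k) ^_) (*-comm (suc s) (suc t)) ⟩
    f (suc k) (suc k) ^ (suc t * suc s)
      ≡⟨ ^-*-assoc (f (suc k) (suc k)) (suc t) (suc s) ⟨
    (f (suc k) (suc k) ^ suc t) ^ suc s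
      ≤⟨ ^-monoˡ-≤ (suc s) (f-*-≥ t k k) ⟩
    f (suc t * suc k) (suc k) ^ suc s
      ≡⟨ cong (_^ suc s) (f-transpose (suc t * suc k) (suc k)) ⟩
    f (suc k) (suc t * suc k) ^ suc s                 ≤⟨ f-*-≥ s k (k + t * suc k) ⟩
    f (suc s * suc k) (suc t * suc k)                 ∎
    where open ≤-Reasoning

  -- With K = k + 1, a cut along a strip of blocks costs 3^K for each block in it; the two
  -- directions thus charge every block 3^K twice.
  f-blocks-≤ : ∀ k s t →
    f (suc s * suc k) (suc t * suc k) ≤ (3 ^ suc k * 3 ^ suc k * f (suc k) (suc k)) ^
      (suc s * suc t)
  f-blocks-≤ k s t = begin
    f (suc s * suc k) (suc t * suc k)
      ≤⟨ f-*-≤ s k (k + t * suc k) ⟩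
    (3 ^ (suc t * suc k) * f (suc k) (suc t * suc k)) ^ suc s
      ≤⟨ ^-monoˡ-≤ (suc s) (begin
        3 ^ (suc t * suc k) * f (suc k) (suc t * suc k)
          ≡⟨ cong₂ _*_ (trans (cong (3 ^_) (*-comm (suc t) (suc k)))
            (sym (^-*-assoc 3 (suc k) (suc t))))
               (f-transpose (suc k) (suc t * suc k)) ⟩
        (3 ^ suc k) ^ suc t * f (suc t * suc k) (suc k)
          ≤⟨ *-monoʳ-≤ ((3 ^ suc k) ^ suc t) (f-*-≤ t k k) ⟩
        (3 ^ suc k) ^ suc t * (3 ^ suc k * f (suc k) (suc k)) ^ suc t
          ≡⟨ ^-distribʳ-* (suc t) (3 ^ suc k) (3 ^ suc k * f (suc k) (suc k)) ⟨
        (3 ^ suc k * (3 ^ suc k * f (suc k) (suc k))) ^ suc t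
          ≡⟨ cong (_^ suc t) (sym (*-assoc (3 ^ suc k) (3 ^ suc k) (f (suc k) (suc k)))) ⟩
        (3 ^ suc k * 3 ^ suc k * f (suc k) (suc k)) ^ suc t ∎) ⟩
    ((3 ^ suc k * 3 ^ suc k * f (suc k) (suc k)) ^ suc t) ^ suc s
      ≡⟨ ^-*-assoc ((3 ^ suc k * 3 ^ suc k * f (suc k) (suc k))) (suc t) (suc s) ⟩
    (3 ^ suc k * 3 ^ suc k * f (suc k) (suc k)) ^ (suc t * suc s)
      ≡⟨ cong ((3 ^ suc k * 3 ^ suc k * f (suc k) (suc k)) ^_) (*-comm (suc t) (suc s)) ⟩
    (3 ^ suc k * 3 ^ suc k * f (suc k) (suc k)) ^ (suc s * suc t) ∎
    where open ≤-Reasoning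

  -- 4K² for K = k + 1: the number of vertices of a K × K block, up to its boundary
  abstract
    area : ℕ → ℕ
    area k = 4 * (suc k * suc k)

    area≡ : ∀ k → area k ≡ 4 * (suc k * suc k)
    area≡ k = refl

  instance
    area-nonZero : ∀ {k} → NonZero (area k)
    area-nonZero {k} = subst NonZero (sym (area≡ k)) _

  -- The quotient is s + 1, so s + 1 blocks fit into length m and s + 2 cover it.
  blocksOf : ∀ k M m → suc M * suc k ≤ m → ∃ λ s →
    M ≤ s × suc s * suc k ≤ m × m ≤ suc (suc s) * suc k
  blocksOf k M m le with m / suc k in eq
  ... | zero  = contradiction (≤-trans (s≤s z≤n) quotient≥) (<-irrefl (sym eq))
    where
    quotient≥ : suc M ≤ m / suc k
    quotient≥ = subst (_≤ m / suc k) (m*n/n≡m (suc M) (suc k)) (/-monoˡ-≤ (suc k) le)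
  ... | suc s = s , s≤s⁻¹ quotient≥ , subst (λ q → q * suc k ≤ m) eq (m/n*n≤m m (suc k)) , (begin
      m                                     ≡⟨ m≡m%n+[m/n]*n m (suc k) ⟩
      m % suc k + m / suc k * suc k
        ≤⟨ +-mono-≤ (<⇒≤ (m%n<n m (suc k))) (≤-reflexive (cong (_* suc k) eq)) ⟩
      suc k + suc s * suc k                 ∎)
    where
    open ≤-Reasoning
    quotient≥ : suc M ≤ suc s
    quotient≥ = subst (suc M ≤_) eq (subst (_≤ m / suc k) (m*n/n≡m (suc M) (suc k))
      (/-monoˡ-≤ (suc k) le))

  numVertices-≤ : ∀ k s t {m n} → m ≤ suc (suc s) * suc k → n ≤ suc (suc t) * suc k →
                  numVertices m n ≤ area k * (suc (suc s) * suc (suc t))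
  numVertices-≤ k s t {m} {n} m≤ n≤ = begin
    4 * m * n ∸ 2 * m ∸ 2 * n     ≤⟨ m∸n≤m (4 * m * n ∸ 2 * m) (2 * n) ⟩
    4 * m * n ∸ 2 * m             ≤⟨ m∸n≤m (4 * m * n) (2 * m) ⟩
    4 * m * n                     ≤⟨ *-mono-≤ (*-monoʳ-≤ 4 m≤) n≤ ⟩
    4 * (suc (suc s) * suc k) * (suc (suc t) * suc k)
      ≡⟨ regroup (suc (suc s)) (suc (suc t)) (suc k) ⟩
    4 * (suc k * suc k) * (suc (suc s) * suc (suc t))
      ≡⟨ cong (_* (suc (suc s) * suc (suc t))) (area≡ k) ⟨
    area k * (suc (suc s) * suc (suc t)) ∎
    where
    open ≤-Reasoning
    regroup : ∀ s t k → 4 * (s * k) * (t * k) ≡ 4 * (k * k) * (s * t)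
    regroup = solve-∀

  -- Since 4mn - 2m - 2n ≥ 4(m - 1)(n - 1), giving up one row and one column of blocks pays for the
  -- vertices missing at the boundary.
  numVertices-≥ : ∀ k s t {m n} → suc s * suc k ≤ m → suc t * suc k ≤ n →
    area k * (s * t) ≤ numVertices m n
  numVertices-≥ k s t {suc m} {suc n} (s≤s m≥) (s≤s n≥) = begin
    area k * (s * t)                                ≡⟨ cong (_* (s * t)) (area≡ k) ⟩
    4 * (suc k * suc k) * (s * t)                   ≡⟨ regroup s t (suc k) ⟨
    4 * (s * suc k) * (t * suc k)
      ≤⟨ *-mono-≤ (*-monoʳ-≤ 4 (m+n≤o⇒n≤o k m≥)) (m+n≤o⇒n≤o k n≥) ⟩
    4 * m * n                                       ≤⟨ m≤m+n (4 * m * n) (2 * m + 2 * n) ⟩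
    4 * m * n + (2 * m + 2 * n)                     ≡⟨ m+n∸m≡n (2 * suc n) _ ⟨
    2 * suc n + (4 * m * n + (2 * m + 2 * n)) ∸ 2 * suc n
      ≡⟨ cong (_∸ 2 * suc n) (m+n∸m≡n (2 * suc m) _) ⟨
    2 * suc m + (2 * suc n + (4 * m * n + (2 * m + 2 * n))) ∸ 2 * suc m ∸ 2 * suc n
      ≡⟨ cong (λ v → v ∸ 2 * suc m ∸ 2 * suc n) (expand m n) ⟨
    numVertices (suc m) (suc n) ∎
    where
    open ≤-Reasoning
    regroup : ∀ s t k → 4 * (s * k) * (t * k) ≡ 4 * (k * k) * (s * t)
    regroup = solve-∀
    expand : ∀ m n → 4 * suc m * suc n ≡ 2 * suc m + (2 * suc n + (4 * m * n + (2 * m + 2 * n)))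
    expand = solve-∀

-- Growth of powers of rationals

module RationalPowers where

  open import Defs using (_^_; pow-nonNeg; pow-pos; pow-mono-≤; pow-mono-<)
  import Algebra.Properties.Semiring.Exp as Exp
  import Algebra.Properties.CommutativeSemiring.Exp as CExp
  open import Algebra.Bundles using (CommutativeRing; CommutativeSemiring)
  open import Data.Integer.Base as ℤ using (+_; -[1+_]; +≤+)
  import Data.Integer.Properties as ℤ
  open import Data.Nat.Base as ℕ using (ℕ; zero; suc; NonZero)
  import Data.Nat.Properties as ℕ
  import Data.Nat.Tactic.RingSolver as ℕ
  open import Data.Product using (∃; _,_; proj₁; proj₂)
  open import Data.Rational.Base hiding (_⊔_; _⊓_; NonZero)
  open import Data.Rational.Properties
  import Data.Rational.Unnormalised.Base as ℚᵘ
  import Data.Rational.Unnormalised.Properties as ℚᵘ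
  open import Relation.Binary.PropositionalEquality
  open import Relation.Nullary using (¬_)

  private
    ℚ-commutativeSemiring : CommutativeSemiring _ _
    ℚ-commutativeSemiring = CommutativeRing.commutativeSemiring +-*-commutativeRing

  ^-+ : ∀ q m n → q ^ (m ℕ.+ n) ≡ q ^ m * q ^ n
  ^-+ = Exp.^-homo-* (CommutativeSemiring.semiring ℚ-commutativeSemiring)

  ^-* : ∀ q m n → (q ^ m) ^ n ≡ q ^ (m ℕ.* n)
  ^-* = Exp.^-assocʳ (CommutativeSemiring.semiring ℚ-commutativeSemiring)

  ^-distrib : ∀ p q n → (p * q) ^ n ≡ p ^ n * q ^ n
  ^-distrib = CExp.^-distrib-* ℚ-commutativeSemiring

  1^ : ∀ n → 1ℚ ^ n ≡ 1ℚ
  1^ zero    = refl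
  1^ (suc n) = trans (*-identityˡ _) (1^ n)

  -- Abstract, so that the type checker never normalises fractions.
  abstract
    ι : ℕ → ℚ
    ι n = + n / 1

    ι≡/1 : ∀ n → ι n ≡ + n / 1
    ι≡/1 n = refl

    ι-0 : ι 0 ≡ 0ℚ
    ι-0 = refl

    ι-1 : ι 1 ≡ 1ℚ
    ι-1 = refl

    toℚᵘ-ι : ∀ n → toℚᵘ (ι n) ℚᵘ.≃ ℚᵘ.mkℚᵘ (+ n) 0
    toℚᵘ-ι n = toℚᵘ-fromℚᵘ (ℚᵘ.mkℚᵘ (+ n) 0)

  ι-+ : ∀ m n → ι (m ℕ.+ n) ≡ ι m + ι n
  ι-+ m n = toℚᵘ-injective (begin
    toℚᵘ (ι (m ℕ.+ n))                               ≈⟨ toℚᵘ-ι (m ℕ.+ n) ⟩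
    ℚᵘ.mkℚᵘ (+ (m ℕ.+ n)) 0
      ≈⟨ ℚᵘ.*≡* (cong (ℤ._* + 1) (sym (cong₂ ℤ._+_ (ℤ.*-identityʳ (+ m)) (ℤ.*-identityʳ (+ n))))) ⟩
    ℚᵘ.mkℚᵘ (+ m) 0 ℚᵘ.+ ℚᵘ.mkℚᵘ (+ n) 0             ≈⟨ ℚᵘ.+-cong (toℚᵘ-ι m) (toℚᵘ-ι n) ⟨
    toℚᵘ (ι m) ℚᵘ.+ toℚᵘ (ι n)                       ≈⟨ toℚᵘ-homo-+ (ι m) (ι n) ⟨
    toℚᵘ (ι m + ι n)                                 ∎)
    where open ℚᵘ.≃-Reasoning

  ι-suc : ∀ n → ι (suc n) ≡ 1ℚ + ι n
  ι-suc n = trans (ι-+ 1 n) (cong (λ z → z + ι n) ι-1)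

  ι-* : ∀ m n → ι (m ℕ.* n) ≡ ι m * ι n
  ι-* m n = toℚᵘ-injective (begin
    toℚᵘ (ι (m ℕ.* n))                               ≈⟨ toℚᵘ-ι (m ℕ.* n) ⟩
    ℚᵘ.mkℚᵘ (+ (m ℕ.* n)) 0                          ≈⟨ ℚᵘ.*≡* (cong (ℤ._* + 1) (ℤ.pos-* m n)) ⟩
    ℚᵘ.mkℚᵘ (+ m) 0 ℚᵘ.* ℚᵘ.mkℚᵘ (+ n) 0             ≈⟨ ℚᵘ.*-cong (toℚᵘ-ι m) (toℚᵘ-ι n) ⟨
    toℚᵘ (ι m) ℚᵘ.* toℚᵘ (ι n)                       ≈⟨ toℚᵘ-homo-* (ι m) (ι n) ⟨
    toℚᵘ (ι m * ι n)                                 ∎)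
    where open ℚᵘ.≃-Reasoning

  ι-^ : ∀ m k → ι (m ℕ.^ k) ≡ ι m ^ k
  ι-^ m zero    = ι-1
  ι-^ m (suc k) = trans (ι-* m (m ℕ.^ k)) (cong (ι m *_) (ι-^ m k))

  ι-mono-≤ : ∀ {m n} → m ℕ.≤ n → ι m ≤ ι n
  ι-mono-≤ {m} {n} m≤n = toℚᵘ-cancel-≤ (begin
    toℚᵘ (ι m)       ≃⟨ toℚᵘ-ι m ⟩
    ℚᵘ.mkℚᵘ (+ m) 0  ≤⟨ ℚᵘ.*≤* (ℤ.*-monoʳ-≤-nonNeg (+ 1) (+≤+ m≤n)) ⟩
    ℚᵘ.mkℚᵘ (+ n) 0  ≃⟨ toℚᵘ-ι n ⟨
    toℚᵘ (ι n)       ∎)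
    where open ℚᵘ.≤-Reasoning

  0≤ι : ∀ n → 0ℚ ≤ ι n
  0≤ι n = subst (_≤ ι n) ι-0 (ι-mono-≤ {0} {n} ℕ.z≤n)

  1≤ι : ∀ {n} → 1 ℕ.≤ n → 1ℚ ≤ ι n
  1≤ι {n} 1≤n = subst (_≤ ι n) ι-1 (ι-mono-≤ 1≤n)

  0<1 : 0ℚ < 1ℚ
  0<1 = positive⁻¹ 1ℚ

  0<ι : ∀ {n} → 1 ℕ.≤ n → 0ℚ < ι n
  0<ι 1≤n = <-≤-trans 0<1 (1≤ι 1≤n)

  ι-archimedean : ∀ q → ∃ λ n → q ≤ ι n
  ι-archimedean q@(mkℚ (+ n) d _) = n , toℚᵘ-cancel-≤ (begin
    toℚᵘ q           ≤⟨ ℚᵘ.*≤* (ℤ.*-monoˡ-≤-nonNeg (+ n) (+≤+ (ℕ.s≤s ℕ.z≤n))) ⟩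
    ℚᵘ.mkℚᵘ (+ n) 0  ≃⟨ toℚᵘ-ι n ⟨
    toℚᵘ (ι n)       ∎)
    where open ℚᵘ.≤-Reasoning
  ι-archimedean q@(mkℚ -[1+ n ] d _) = 0 , subst (q ≤_) (sym ι-0) (<⇒≤ (negative⁻¹ q))

  *-monoˡ : ∀ {p q r} → 0ℚ ≤ r → p ≤ q → r * p ≤ r * q
  *-monoˡ {r = r} 0≤r = *-monoˡ-≤-nonNeg r {{nonNegative 0≤r}}

  *-monoʳ : ∀ {p q r} → 0ℚ ≤ r → p ≤ q → p * r ≤ q * r
  *-monoʳ {r = r} 0≤r = *-monoʳ-≤-nonNeg r {{nonNegative 0≤r}}

  *-mono-<ˡ : ∀ {p q r} → 0ℚ < r → p < q → r * p < r * q
  *-mono-<ˡ {r = r} 0<r = *-monoʳ-<-pos r {{positive 0<r}}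

  *-cancel-<ˡ : ∀ {p q} r → 0ℚ ≤ r → r * p < r * q → p < q
  *-cancel-<ˡ r 0≤r = *-cancelˡ-<-nonNeg r {{nonNegative 0≤r}}

  *-cancel-≤ˡ : ∀ {p q} r → 0ℚ < r → r * p ≤ r * q → p ≤ q
  *-cancel-≤ˡ r 0<r = *-cancelˡ-≤-pos r {{positive 0<r}}

  *-nonNeg : ∀ {p q} → 0ℚ ≤ p → 0ℚ ≤ q → 0ℚ ≤ p * q
  *-nonNeg {p} 0≤p 0≤q = subst (_≤ p * _) (*-zeroʳ p) (*-monoˡ 0≤p 0≤q)

  *-archimedean : ∀ q {d} → 0ℚ < d → ∃ λ n → q ≤ ι n * d
  *-archimedean q {d} 0<d =
    let m , q≤m = ι-archimedean q
        k , 1/d≤k = ι-archimedean (1/ d)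
        1≤kd : 1ℚ ≤ ι k * d
        1≤kd = subst (_≤ ι k * d) (*-inverseˡ d) (*-monoʳ (<⇒≤ 0<d) 1/d≤k)
    in m ℕ.* k , ≤-trans q≤m (subst₂ _≤_ (*-identityʳ (ι m))
            (trans (sym (*-assoc (ι m) (ι k) d)) (cong (_* d) (sym (ι-* m k))))
         (*-monoˡ (0≤ι m) 1≤kd))
    where instance _ = pos⇒nonZero d {{positive 0<d}}

  <⇒≱ : ∀ {p q} → p < q → ¬ (q ≤ p)
  <⇒≱ p<q q≤p = <-irrefl refl (<-≤-trans p<q q≤p)

  pow-cancel-≤ : ∀ k .{{_ : NonZero k}} {q r} → 0ℚ ≤ r → q ^ k ≤ r ^ k → q ≤ r
  pow-cancel-≤ k {q} {r} 0≤r le = ≮⇒≥ (λ r<q → <⇒≱ (pow-mono-< k 0≤r r<q) le)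

  pow-cancel-< : ∀ k {q r} → 0ℚ ≤ r → q ^ k < r ^ k → q < r
  pow-cancel-< k {q} {r} 0≤r lt = ≰⇒> (λ r≤q → <⇒≱ lt (pow-mono-≤ k 0≤r r≤q))

  1≤pow : ∀ k {q} → 1ℚ ≤ q → 1ℚ ≤ q ^ k
  1≤pow k {q} 1≤q = subst (_≤ q ^ k) (1^ k) (pow-mono-≤ k (<⇒≤ 0<1) 1≤q)

  pow-monoʳ-≤ : ∀ {q m n} → 1ℚ ≤ q → m ℕ.≤ n → q ^ m ≤ q ^ n
  pow-monoʳ-≤ {q} {m} {n} 1≤q m≤n = subst₂ _≤_ (*-identityʳ (q ^ m))
    (trans (sym (^-+ q m (n ℕ.∸ m))) (cong (q ^_) (ℕ.m+[n∸m]≡n m≤n)))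
    (*-monoˡ (pow-nonNeg m (≤-trans (<⇒≤ 0<1) 1≤q)) (1≤pow (n ℕ.∸ m) 1≤q))

  module _ {q r : ℚ} (0<q : 0ℚ < q) (q<r : q < r) where
    private
      d : ℚ
      d = r - q
      q+d≡r : q + d ≡ r
      q+d≡r = trans (+-comm q d) (trans (+-assoc r (- q) q)
        (trans (cong (λ z → r + z) (+-inverseˡ q)) (+-identityʳ r)))
      0<d : 0ℚ < d
      0<d = subst (_< d) (+-inverseʳ q) (+-monoˡ-< (- q) q<r)
      0≤q : 0ℚ ≤ q
      0≤q = <⇒≤ 0<q
      0<r : 0ℚ < r
      0<r = <-trans 0<q q<r

    -- Bernoulli's inequality 1 + nd/q ≤ (r/q)^n, multiplied by q^(n + 1) to avoid division.
    bernoulli : ∀ n → (q + ι n * d) * q ^ n ≤ q * r ^ n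
    bernoulli zero    = ≤-reflexive (cong (_* 1ℚ)
      (trans (cong (λ z → q + z) (trans (cong (_* d) ι-0) (*-zeroˡ d))) (+-identityʳ q)))
    bernoulli (suc n) = begin
      (q + ι (suc n) * d) * (q * q ^ n)       ≡⟨ *-assoc (q + ι (suc n) * d) q (q ^ n) ⟨
      (q + ι (suc n) * d) * q * q ^ n         ≤⟨ *-monoʳ (pow-nonNeg n 0≤q) coefficient ⟩
      r * (q + ι n * d) * q ^ n               ≡⟨ *-assoc r (q + ι n * d) (q ^ n) ⟩
      r * ((q + ι n * d) * q ^ n)             ≤⟨ *-monoˡ (<⇒≤ 0<r) (bernoulli n) ⟩
      r * (q * r ^ n)
        ≡⟨ trans (sym (*-assoc r q _)) (trans (cong (_* r ^ n) (*-comm r q)) (*-assoc q r _)) ⟩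
      q * (r * r ^ n)                         ∎
      where
      open ≤-Reasoning
      coefficient : (q + ι (suc n) * d) * q ≤ r * (q + ι n * d)
      coefficient = begin
        (q + ι (suc n) * d) * q                        ≡⟨ cong (λ x → (q + x * d) * q) (ι-suc n) ⟩
        (q + (1ℚ + ι n) * d) * q
          ≡⟨ cong (λ x →
            (q + x) * q) (trans (*-distribʳ-+ d 1ℚ (ι n))
              (cong (λ z → z + ι n * d) (*-identityˡ d))) ⟩
        (q + (d + ι n * d)) * q
          ≡⟨ cong (_* q) (trans (sym (+-assoc q d _)) (cong (λ z → z + ι n * d) q+d≡r)) ⟩
        (r + ι n * d) * q                              ≡⟨ *-distribʳ-+ q r (ι n * d) ⟩
        r * q + ι n * d * q
          ≤⟨ +-monoʳ-≤ (r * q) (*-monoˡ (*-nonNeg (0≤ι n) (<⇒≤ 0<d)) (<⇒≤ q<r)) ⟩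
        r * q + ι n * d * r
          ≡⟨ cong (λ x → r * q + x) (*-comm (ι n * d) r) ⟩
        r * q + r * (ι n * d)                          ≡⟨ *-distribˡ-+ r q (ι n * d) ⟨
        r * (q + ι n * d)                              ∎

    pow-dominates : ∀ c → ∃ λ N → ∀ n → N ℕ.≤ n → c * q ^ n < r ^ n
    pow-dominates c = let N , cq≤Nd = *-archimedean (c * q) 0<d in N , λ n N≤n →
      *-cancel-<ˡ q 0≤q (begin-strict
        q * (c * q ^ n)            ≡⟨ trans (sym (*-assoc q c _)) (cong (_* q ^ n) (*-comm q c)) ⟩
        c * q * q ^ n
          ≤⟨ *-monoʳ (pow-nonNeg n 0≤q) (≤-trans cq≤Nd (*-monoʳ (<⇒≤ 0<d) (ι-mono-≤ N≤n))) ⟩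
        ι n * d * q ^ n
          <⟨ *-monoˡ-<-pos (q ^ n) {{positive (pow-pos n 0<q)}}
            (subst (_< q + ι n * d) (+-identityˡ (ι n * d)) (+-monoˡ-< (ι n * d) 0<q)) ⟩
        (q + ι n * d) * q ^ n      ≤⟨ bernoulli n ⟩
        q * r ^ n                  ∎)
      where open ≤-Reasoning

  -- The ratio of (s + 2)(t + 2) to st tends to 1. With p such that x^(p + 1) < y^p, the condition
  -- s, t ≥ 8p gives (s + 2)(t + 2)p ≤ (p + 1)st, which proves the p-th power of the claim.
  pow-squeeze : ∀ {x y} → 1ℚ ≤ x → x < y →
    ∃ λ M → ∀ s t → M ℕ.≤ s → M ℕ.≤ t → x ^ ((2 ℕ.+ s) ℕ.* (2 ℕ.+ t)) ≤ y ^ (s ℕ.* t)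
  pow-squeeze {x} {y} 1≤x x<y = 8 ℕ.* p , bound
    where
    0<x : 0ℚ < x
    0<x = <-≤-trans 0<1 1≤x
    0≤y : 0ℚ ≤ y
    0≤y = <⇒≤ (<-trans 0<x x<y)
    dominates = pow-dominates 0<x x<y x
    p′ p : ℕ
    p′ = proj₁ dominates
    p  = suc p′

    exponents : ∀ s t → 8 ℕ.* p ℕ.≤ s → 8 ℕ.* p ℕ.≤ t →
      (2 ℕ.+ s) ℕ.* (2 ℕ.+ t) ℕ.* p ℕ.≤ suc p ℕ.* (s ℕ.* t)
    exponents s t p≤s p≤t = subst₂ (λ s t → (2 ℕ.+ s) ℕ.* (2 ℕ.+ t) ℕ.* p ℕ.≤ suc p ℕ.* (s ℕ.* t))
      (ℕ.m+[n∸m]≡n p≤s) (ℕ.m+[n∸m]≡n p≤t)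
      (subst ((2 ℕ.+ s₀) ℕ.* (2 ℕ.+ t₀) ℕ.* p ℕ.≤_) (identity p′ (s ℕ.∸ 8 ℕ.* p) (t ℕ.∸ 8 ℕ.* p))
        (ℕ.m≤m+n _ _))
      where
      s₀ = 8 ℕ.* p ℕ.+ (s ℕ.∸ 8 ℕ.* p)
      t₀ = 8 ℕ.* p ℕ.+ (t ℕ.∸ 8 ℕ.* p)
      -- The second summand on the left is the slack, expanded around s = t = 8(p + 1); all its
      -- coefficients are natural.
      identity : ∀ p a b →
        (2 ℕ.+ (8 ℕ.* suc p ℕ.+ a)) ℕ.* (2 ℕ.+ (8 ℕ.* suc p ℕ.+ b)) ℕ.* suc p ℕ.+
          (suc p ℕ.* (28 ℕ.+ 32 ℕ.* p) ℕ.+ 6 ℕ.* suc p ℕ.* a ℕ.+ 6 ℕ.* suc p ℕ.* b ℕ.+ a ℕ.* b) ≡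
        suc (suc p) ℕ.* ((8 ℕ.* suc p ℕ.+ a) ℕ.* (8 ℕ.* suc p ℕ.+ b))
      identity = ℕ.solve-∀

    bound : ∀ s t → 8 ℕ.* p ℕ.≤ s → 8 ℕ.* p ℕ.≤ t → x ^ ((2 ℕ.+ s) ℕ.* (2 ℕ.+ t)) ≤ y ^ (s ℕ.* t)
    bound s t p≤s p≤t = pow-cancel-≤ p (pow-nonNeg (s ℕ.* t) 0≤y) (begin
      (x ^ ((2 ℕ.+ s) ℕ.* (2 ℕ.+ t))) ^ p   ≡⟨ ^-* x ((2 ℕ.+ s) ℕ.* (2 ℕ.+ t)) p ⟩
      x ^ ((2 ℕ.+ s) ℕ.* (2 ℕ.+ t) ℕ.* p)   ≤⟨ pow-monoʳ-≤ 1≤x (exponents s t p≤s p≤t) ⟩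
      x ^ (suc p ℕ.* (s ℕ.* t))             ≡⟨ ^-* x (suc p) (s ℕ.* t) ⟨
      (x ^ suc p) ^ (s ℕ.* t)
        ≤⟨ pow-mono-≤ (s ℕ.* t) (pow-nonNeg (suc p) (<⇒≤ 0<x))
          (<⇒≤ (proj₂ dominates p (ℕ.n≤1+n p′))) ⟩
      (y ^ p) ^ (s ℕ.* t)
        ≡⟨ trans (^-* y p (s ℕ.* t)) (trans (cong (y ^_) (ℕ.*-comm p (s ℕ.* t)))
          (sym (^-* y (s ℕ.* t) p))) ⟩
      (y ^ (s ℕ.* t)) ^ p                   ∎)
      where open ≤-Reasoning

-- The limit along squares and the double limit

module SquareLimit where

  open import Defs hiding (*-mono-≤; f)
  open RationalPowers
  open SquareBlocks using (area; area≡; area-nonZero; blocksOf; numVertices-≤; numVertices-≥)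
  open import Data.Nat.Base as ℕ using (ℕ; zero; suc; NonZero)
  import Data.Nat.Properties as ℕ
  import Data.Nat.Tactic.RingSolver as ℕ
  open import Data.Product using (∃; _×_; _,_; proj₁; proj₂)
  open import Data.Rational.Base hiding (NonZero)
  open import Data.Rational.Properties
  open import Data.Sum.Base using (_⊎_; inj₁; inj₂)
  open import Relation.Binary.PropositionalEquality
  open import Relation.Nullary using (¬_; Dec; yes; no; contradiction)

  ι-<-cong-^ : ∀ {q m} k .{{_ : NonZero k}} → q < ι m → 0ℚ ≤ q → q ^ k < ι (m ℕ.^ k)
  ι-<-cong-^ {q} {m} k q<m 0≤q = subst (q ^ k <_) (sym (ι-^ m k)) (pow-mono-< k 0≤q q<m)

  ι-^-< : ∀ {q m} k .{{_ : NonZero k}} → ι m < q → ι (m ℕ.^ k) < q ^ k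
  ι-^-< {q} {m} k m<q = subst (_< q ^ k) (sym (ι-^ m k)) (pow-mono-< k (0≤ι m) m<q)

  module _ {k : ℕ} .{{_ : NonZero k}} {N : ℕ} {q : ℚ} where

    lower-root : q ^ k < ι N → Lower (root k N) q
    lower-root lt = inj₂ (subst (q ^ k <_) (ι≡/1 N) lt)

    lower-root⁻ : Lower (root k N) q → q < 0ℚ ⊎ q ^ k < ι N
    lower-root⁻ (inj₁ q<0) = inj₁ q<0
    lower-root⁻ (inj₂ lt)  = inj₂ (subst (q ^ k <_) (sym (ι≡/1 N)) lt)

    upper-root : 0ℚ < q → ι N < q ^ k → Upper (root k N) q
    upper-root 0<q lt = 0<q , subst (_< q ^ k) (ι≡/1 N) lt

    upper-root⁻ : Upper (root k N) q → ι N < q ^ k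
    upper-root⁻ (_ , lt) = subst (_< q ^ k) (sym (ι≡/1 N)) lt

  -- With K = k + 1 both sides are K-th powers, of c (p^4)^K and (r^4)^K. So only the constant c has
  -- to be beaten, and a boundary factor c^K is negligible.
  area-dominates : ∀ c {p r} → 0ℚ < p → p < r → ∃ λ k → ι (c ℕ.^ suc k) * p ^ area k < r ^ area k
  area-dominates c {p} {r} 0<p p<r =
    let k , dominates = pow-dominates (pow-pos 4 0<p) (pow-mono-< 4 (<⇒≤ 0<p) p<r) (ι c)
    in k , subst₂ _<_ (left k) (powers r k)
         (pow-mono-< (suc k) (*-nonNeg (0≤ι c) (pow-nonNeg (suc k) (pow-nonNeg 4 (<⇒≤ 0<p))))
           (dominates (suc k) (ℕ.n≤1+n k)))
    where
    powers : ∀ x k → ((x ^ 4) ^ suc k) ^ suc k ≡ x ^ area k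
    powers x k = trans (^-* (x ^ 4) (suc k) (suc k))
      (trans (^-* x 4 (suc k ℕ.* suc k)) (cong (x ^_) (sym (area≡ k))))
    left : ∀ k → (ι c * (p ^ 4) ^ suc k) ^ suc k ≡ ι (c ℕ.^ suc k) * p ^ area k
    left k = trans (^-distrib (ι c) ((p ^ 4) ^ suc k) (suc k))
      (cong₂ _*_ (sym (ι-^ c (suc k))) (powers p k))

  -- Walks up from a lower point in steps of δ until `located` answers with an upper point; an upper
  -- point b₀ fixed beforehand bounds the number of steps.
  approximate : ∀ (x : ℝ) {ε} → 0ℚ < ε → ∃ λ a → ∃ λ b → Lower x a × Upper x b × b < a + ε
  approximate x {ε} 0<ε = search (proj₁ steps) a₀ lower-a₀ (begin
      b₀                        ≡⟨ a+[b-a]≡b a₀ b₀ ⟨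
      a₀ + (b₀ - a₀)            ≤⟨ +-monoʳ-≤ a₀ (proj₂ steps) ⟩
      a₀ + ι (proj₁ steps) * δ  ∎)
    where
    open ≤-Reasoning
    a+[b-a]≡b : ∀ a b → a + (b - a) ≡ b
    a+[b-a]≡b a b = trans (+-comm a (b - a))
      (trans (+-assoc b (- a) a) (trans (cong (λ z → b + z) (+-inverseˡ a)) (+-identityʳ b)))

    a₀ = proj₁ (lower-inhabited x)
    lower-a₀ = proj₂ (lower-inhabited x)
    b₀ = proj₁ (upper-inhabited x)
    upper-b₀ = proj₂ (upper-inhabited x)

    -- The gap found is exactly 2δ = ε′, so ε′ < ε makes the estimate strict.
    ε′ = proj₁ (<-dense 0<ε)
    δ  = ½ * ε′
    0<δ : 0ℚ < δ
    0<δ = subst (_< δ) (*-zeroʳ ½) (*-mono-<ˡ (positive⁻¹ ½) (proj₁ (proj₂ (<-dense 0<ε))))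
    δ+δ≡ε′ : δ + δ ≡ ε′
    δ+δ≡ε′ = trans (sym (*-distribʳ-+ ε′ ½ ½)) (*-identityˡ ε′)

    steps = *-archimedean (b₀ - a₀) 0<δ

    search : ∀ n a → Lower x a → b₀ ≤ a + ι n * δ → ∃ λ a → ∃ λ b →
      Lower x a × Upper x b × b < a + ε
    search zero    a la b₀≤a = contradiction upper-b₀ (disjoint x (lower-closed′ b₀≤a′))
      where
      b₀≤a′ : b₀ ≤ a
      b₀≤a′ = subst (b₀ ≤_) (trans (cong (λ z → a + z) (trans (cong (_* δ) ι-0) (*-zeroˡ δ)))
        (+-identityʳ a)) b₀≤a
      lower-closed′ : b₀ ≤ a → Lower x b₀
      lower-closed′ b₀≤a = let r , a<r , lr = lower-open x la in
              lower-closed x (≤-<-trans b₀≤a a<r) lr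
    search (suc n) a la b₀≤ with located x {a + δ} {a + δ + δ}
      (subst (_< a + δ + δ) (+-identityʳ (a + δ)) (+-monoʳ-< (a + δ) 0<δ))
    ... | inj₁ la+δ = search n (a + δ) la+δ (subst (b₀ ≤_) regroup b₀≤)
      where
      regroup : a + ι (suc n) * δ ≡ a + δ + ι n * δ
      regroup = trans (cong (λ z → a + z)
        (trans (cong (_* δ) (ι-suc n)) (trans (*-distribʳ-+ δ 1ℚ (ι n))
          (cong (λ z → z + ι n * δ) (*-identityˡ δ)))))
        (sym (+-assoc a δ (ι n * δ)))
    ... | inj₂ u = a , a + δ + δ , la , u ,
        subst (_< a + ε) (trans (cong (λ z → a + z) (sym δ+δ≡ε′)) (sym (+-assoc a δ δ)))
      (+-monoʳ-< a (proj₂ (proj₂ (<-dense 0<ε))))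

  -- Being a parameter, `f` cannot unfold during the limit argument.
  module DoubleLimit
    (f : ℕ → ℕ → ℕ)
    (1≤f : ∀ m n → 1 ℕ.≤ f m n)
    (f-mono-≤ : ∀ {m m′ n n′} → m ℕ.≤ m′ → n ℕ.≤ n′ → f (suc m) (suc n) ℕ.≤ f (suc m′) (suc n′))
    (f-blocks-≥ : ∀ k s t →
      f (suc k) (suc k) ℕ.^ (suc s ℕ.* suc t) ℕ.≤ f (suc s ℕ.* suc k) (suc t ℕ.* suc k))
    (f-blocks-≤ : ∀ k s t → f (suc s ℕ.* suc k) (suc t ℕ.* suc k) ℕ.≤
      (3 ℕ.^ suc k ℕ.* 3 ℕ.^ suc k ℕ.* f (suc k) (suc k)) ℕ.^ (suc s ℕ.* suc t))
    where

    F : ℕ → ℕ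
    F k = f (suc k) (suc k)

    F⁺ : ℕ → ℕ
    F⁺ k = 3 ℕ.^ suc k ℕ.* 3 ℕ.^ suc k ℕ.* F k

    1≤F⁺ : ∀ k → 1 ℕ.≤ F⁺ k
    1≤F⁺ k = ℕ.*-mono-≤ (ℕ.*-mono-≤ (ℕ.m^n>0 3 (suc k)) (ℕ.m^n>0 3 (suc k))) (1≤f (suc k) (suc k))

    -- The square of side (j + 1)(k + 1) is tiled by blocks of either size.
    F≤F⁺ : ∀ j k → F j ℕ.^ (suc k ℕ.* suc k) ℕ.≤ F⁺ k ℕ.^ (suc j ℕ.* suc j)
    F≤F⁺ j k = begin
      F j ℕ.^ (suc k ℕ.* suc k)                   ≤⟨ f-blocks-≥ j k k ⟩
      f (suc k ℕ.* suc j) (suc k ℕ.* suc j)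
        ≡⟨ cong₂ f (ℕ.*-comm (suc k) (suc j)) (ℕ.*-comm (suc k) (suc j)) ⟩
      f (suc j ℕ.* suc k) (suc j ℕ.* suc k)       ≤⟨ f-blocks-≤ k j j ⟩
      F⁺ k ℕ.^ (suc j ℕ.* suc j)                  ∎
      where open ℕ.≤-Reasoning

    -- Both cuts are compared at the common exponent 4(j + 1)²(k + 1)².
    disjoint-roots : ∀ j k {q} → Lower (root (area j) (F j)) q → ¬ Upper (root (area k) (F⁺ k)) q
    disjoint-roots j k {q} l u@(0<q , _) =
      absurd (lower-root⁻ {area j} {F j} l) (upper-root⁻ {area k} {F⁺ k} u)
      where
      open ≤-Reasoning
      J² = suc j ℕ.* suc j
      K² = suc k ℕ.* suc k
      swap : ∀ a b → 4 ℕ.* a ℕ.* b ≡ 4 ℕ.* b ℕ.* a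
      swap = ℕ.solve-∀
      exponents : area k ℕ.* J² ≡ area j ℕ.* K²
      exponents = trans (cong (ℕ._* J²) (area≡ k))
        (trans (swap K² J²) (cong (ℕ._* K²) (sym (area≡ j))))

      absurd : q < 0ℚ ⊎ q ^ area j < ι (F j) → ¬ (ι (F⁺ k) < q ^ area k)
      absurd (inj₁ q<0)  _     = <-asym q<0 0<q
      absurd (inj₂ qʲ<F) F⁺<qᵏ = <-irrefl refl (begin-strict
        q ^ (area j ℕ.* K²)    ≡⟨ ^-* q (area j) K² ⟨
        (q ^ area j) ^ K²      <⟨ ι-<-cong-^ K² qʲ<F (pow-nonNeg (area j) (<⇒≤ 0<q)) ⟩
        ι (F j ℕ.^ K²)         ≤⟨ ι-mono-≤ (F≤F⁺ j k) ⟩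
        ι (F⁺ k ℕ.^ J²)        <⟨ ι-^-< J² F⁺<qᵏ ⟩
        (q ^ area k) ^ J²      ≡⟨ ^-* q (area k) J² ⟩
        q ^ (area k ℕ.* J²)    ≡⟨ cong (q ^_) exponents ⟩
        q ^ (area j ℕ.* K²)    ∎)

    ι-F⁺ : ∀ k → ι (F⁺ k) ≡ ι (9 ℕ.^ suc k) * ι (F k)
    ι-F⁺ k = trans (ι-* (3 ℕ.^ suc k ℕ.* 3 ℕ.^ suc k) (F k)) (cong (λ x → ι x * ι (F k)) 3ᵏ3ᵏ≡9ᵏ)
      where
      3ᵏ3ᵏ≡9ᵏ : 3 ℕ.^ suc k ℕ.* 3 ℕ.^ suc k ≡ 9 ℕ.^ suc k
      3ᵏ3ᵏ≡9ᵏ = trans (sym (ℕ.^-distribˡ-+-* 3 (suc k) (suc k)))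
        (trans (cong (3 ℕ.^_) (cong (suc k ℕ.+_) (sym (ℕ.+-identityʳ (suc k)))))
          (sym (ℕ.^-*-assoc 3 2 (suc k))))

    -- For a suitable K the factor 9^K between `F⁺` and `F` is smaller than the gap that r opens at
    -- exponent 4K²; comparing q with the root of `F` at this single K then decides.
    located-roots : ∀ {q r} → q < r →
      (∃ λ k → Lower (root (area k) (F k)) q) ⊎ (∃ λ k → Upper (root (area k) (F⁺ k)) r)
    located-roots {q} {r} q<r = decide (q <? 0ℚ)
      where
      open ≤-Reasoning
      compare : ∀ {p} k → 0ℚ ≤ q → q < p → 0ℚ < r → ι (9 ℕ.^ suc k) * p ^ area k < r ^ area k →
        Dec (q ^ area k < ι (F k)) →
        (∃ λ k → Lower (root (area k) (F k)) q) ⊎ (∃ λ k → Upper (root (area k) (F⁺ k)) r)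
      compare {p} k 0≤q q<p 0<r 9ᵏpᵏ<rᵏ (yes qᵏ<F) = inj₁ (k , lower-root {area k} {F k} qᵏ<F)
      compare {p} k 0≤q q<p 0<r 9ᵏpᵏ<rᵏ (no  qᵏ≮F) =
        inj₂ (k , upper-root {area k} {F⁺ k} 0<r (begin-strict
        ι (F⁺ k)                        ≡⟨ ι-F⁺ k ⟩
        ι (9 ℕ.^ suc k) * ι (F k)
          ≤⟨ *-monoˡ (0≤ι (9 ℕ.^ suc k)) (≤-trans (≮⇒≥ qᵏ≮F) (pow-mono-≤ (area k) 0≤q (<⇒≤ q<p))) ⟩
        ι (9 ℕ.^ suc k) * p ^ area k    <⟨ 9ᵏpᵏ<rᵏ ⟩
        r ^ area k                      ∎))

      decide : Dec (q < 0ℚ) →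
        (∃ λ k → Lower (root (area k) (F k)) q) ⊎ (∃ λ k → Upper (root (area k) (F⁺ k)) r)
      decide (yes q<0) = inj₁ (0 , inj₁ q<0)
      decide (no  q≮0) =
        -- q may be 0, while `area-dominates` needs a positive base.
        let p , q<p , p<r   = <-dense q<r
            0<p             = ≤-<-trans (≮⇒≥ q≮0) q<p
            k , 9ᵏpᵏ<rᵏ     = area-dominates 9 0<p p<r
        in compare k (≮⇒≥ q≮0) q<p (<-trans 0<p p<r) 9ᵏpᵏ<rᵏ (q ^ area k <? ι (F k))

    η : ℝ
    η = record
      { Lower           = λ q → ∃ λ k → Lower (root (area k) (F k)) q
      ; Upper           = λ q → ∃ λ k → Upper (root (area k) (F⁺ k)) q
      ; lower-inhabited = let q , l = lower-inhabited (root (area 0) (F 0)) in q , 0 , l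
      ; upper-inhabited = let q , u = upper-inhabited (root (area 0) (F⁺ 0)) in q , 0 , u
      ; lower-closed    = λ { q<r (k , l) → k , lower-closed (root (area k) (F k)) q<r l }
      ; upper-closed    = λ { q<r (k , u) → k , upper-closed (root (area k) (F⁺ k)) q<r u }
      ; lower-open      = λ { (k , l) →
              let r , q<r , l′ = lower-open (root (area k) (F k)) l in r , q<r , k , l′ }
      ; upper-open      = λ { (k , u) →
              let r , r<q , u′ = upper-open (root (area k) (F⁺ k)) u in r , r<q , k , u′ }
      ; disjoint        = λ { (j , l) (k , u) → disjoint-roots j k l u }
      ; located         = located-roots
      }

    count-≥ : ∀ k s t {m n} → suc s ℕ.* suc k ℕ.≤ m → suc t ℕ.* suc k ℕ.≤ n →
              F k ℕ.^ (suc s ℕ.* suc t) ℕ.≤ f m n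
    count-≥ k s t {suc m} {suc n} (ℕ.s≤s s≤m) (ℕ.s≤s t≤n) =
      ℕ.≤-trans (f-blocks-≥ k s t) (f-mono-≤ s≤m t≤n)

    count-≤ : ∀ k s t {m n} → 1 ℕ.≤ m → 1 ℕ.≤ n → m ℕ.≤ suc s ℕ.* suc k → n ℕ.≤ suc t ℕ.* suc k →
              f m n ℕ.≤ F⁺ k ℕ.^ (suc s ℕ.* suc t)
    count-≤ k s t {suc m} {suc n} _ _ (ℕ.s≤s m≤s) (ℕ.s≤s n≤t) =
      ℕ.≤-trans (f-mono-≤ m≤s n≤t) (f-blocks-≤ k s t)

    -- At least (s + 1)(t + 1) blocks fit, whereas the vertices are bounded by the area of (s + 2)(t
    -- + 2) blocks; the passage from q down to p absorbs the difference.
    eventually-lower : ∀ {p q} → p < q → Lower η q →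
      ∃ λ N → ∀ m n (2≤m : 2 ℕ.≤ m) (2≤n : 2 ℕ.≤ n) → N ℕ.≤ m → N ℕ.≤ n →
        Lower (root (numVertices m n) {{numVertices-nonZero 2≤m 2≤n}} (f m n)) p
    eventually-lower {p} {q} p<q (k , l) = decide (p <? 0ℚ) (p <? 1ℚ) (lower-root⁻ {area k} {F k} l)
      where
      open ≤-Reasoning

      below-1 : 0ℚ ≤ p → p < 1ℚ → ∀ e .{{_ : NonZero e}} N → 1 ℕ.≤ N → p ^ e < ι N
      below-1 0≤p p<1 e N 1≤N = begin-strict
        p ^ e     <⟨ pow-mono-< e 0≤p p<1 ⟩
        1ℚ ^ e    ≡⟨ 1^ e ⟩
        1ℚ        ≤⟨ 1≤ι 1≤N ⟩
        ι N       ∎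

      module _ (1≤p : 1ℚ ≤ p) (qᵏ<F : q ^ area k < ι (F k)) where
        0≤p : 0ℚ ≤ p
        0≤p = ≤-trans (<⇒≤ 0<1) 1≤p
        squeeze : ∃ λ M → ∀ s t → M ℕ.≤ s → M ℕ.≤ t →
          (p ^ area k) ^ ((2 ℕ.+ s) ℕ.* (2 ℕ.+ t)) ≤ (q ^ area k) ^ (s ℕ.* t)
        squeeze = pow-squeeze (1≤pow (area k) 1≤p) (pow-mono-< (area k) 0≤p p<q)

        large : ∀ m n → suc (proj₁ squeeze) ℕ.* suc k ℕ.≤ m → suc (proj₁ squeeze) ℕ.* suc k ℕ.≤ n →
                p ^ numVertices m n < ι (f m n)
        large m n N≤m N≤n =
          let s , M≤s , s≤m , m≤s = blocksOf k (proj₁ squeeze) m N≤m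
              t , M≤t , t≤n , n≤t = blocksOf k (proj₁ squeeze) n N≤n
          in begin-strict
          p ^ numVertices m n
            ≤⟨ pow-monoʳ-≤ 1≤p (numVertices-≤ k s t m≤s n≤t) ⟩
          p ^ (area k ℕ.* ((2 ℕ.+ s) ℕ.* (2 ℕ.+ t)))
            ≡⟨ ^-* p (area k) ((2 ℕ.+ s) ℕ.* (2 ℕ.+ t)) ⟨
          (p ^ area k) ^ ((2 ℕ.+ s) ℕ.* (2 ℕ.+ t))      ≤⟨ proj₂ squeeze s t M≤s M≤t ⟩
          (q ^ area k) ^ (s ℕ.* t)
            ≤⟨ pow-monoʳ-≤ (1≤pow (area k) (≤-trans 1≤p (<⇒≤ p<q)))
              (ℕ.*-mono-≤ (ℕ.n≤1+n s) (ℕ.n≤1+n t)) ⟩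
          (q ^ area k) ^ (suc s ℕ.* suc t)
            <⟨ ι-<-cong-^ (suc s ℕ.* suc t) qᵏ<F (pow-nonNeg (area k) (≤-trans 0≤p (<⇒≤ p<q))) ⟩
          ι (F k ℕ.^ (suc s ℕ.* suc t))                 ≤⟨ ι-mono-≤ (count-≥ k s t s≤m t≤n) ⟩
          ι (f m n)                                     ∎

      decide : Dec (p < 0ℚ) → Dec (p < 1ℚ) → q < 0ℚ ⊎ q ^ area k < ι (F k) →
        ∃ λ N → ∀ m n (2≤m : 2 ℕ.≤ m) (2≤n : 2 ℕ.≤ n) → N ℕ.≤ m → N ℕ.≤ n →
          Lower (root (numVertices m n) {{numVertices-nonZero 2≤m 2≤n}} (f m n)) p
      decide (yes p<0) _         _           = 0 , λ _ _ _ _ _ _ → inj₁ p<0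
      decide (no  p≮0) _         (inj₁ q<0)  = contradiction (<-trans p<q q<0) p≮0
      -- Below 1 powers decrease with the exponent and the block argument fails, but f ≥ 1 is
      -- enough.
      decide (no  p≮0) (yes p<1) (inj₂ _)    = 0 , λ m n 2≤m 2≤n _ _ →
        lower-root {numVertices m n} {{numVertices-nonZero 2≤m 2≤n}} {f m n}
          (below-1 (≮⇒≥ p≮0) p<1 (numVertices m n) {{numVertices-nonZero 2≤m 2≤n}} (f m n)
            (1≤f m n))
      decide (no  p≮0) (no  p≮1) (inj₂ qᵏ<F) =
        suc (proj₁ (squeeze (≮⇒≥ p≮1) qᵏ<F)) ℕ.* suc k , λ m n 2≤m 2≤n N≤m N≤n →
        lower-root {numVertices m n} {{numVertices-nonZero 2≤m 2≤n}} {f m n}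
          (large (≮⇒≥ p≮1) qᵏ<F m n N≤m N≤n)

    -- Since F⁺ ≥ 1, both p and q exceed 1 and no case distinction arises. Here (s + 2)(t + 2)
    -- blocks cover the rectangle, which has at least the area of st blocks as vertices.
    eventually-upper : ∀ {p q} → p < q → Upper η p →
      ∃ λ N → ∀ m n (2≤m : 2 ℕ.≤ m) (2≤n : 2 ℕ.≤ n) → N ℕ.≤ m → N ℕ.≤ n →
        Upper (root (numVertices m n) {{numVertices-nonZero 2≤m 2≤n}} (f m n)) q
    eventually-upper {p} {q} p<q (k , u@(0<p , _)) =
      suc M ℕ.* suc k , λ m n 2≤m 2≤n N≤m N≤n →
      upper-root {numVertices m n} {{numVertices-nonZero 2≤m 2≤n}} {f m n} (<-trans 0<p p<q)
        (large m n (ℕ.≤-trans (ℕ.s≤s ℕ.z≤n) 2≤m) (ℕ.≤-trans (ℕ.s≤s ℕ.z≤n) 2≤n) N≤m N≤n)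
      where
      open ≤-Reasoning
      F⁺<pᵏ : ι (F⁺ k) < p ^ area k
      F⁺<pᵏ = upper-root⁻ {area k} {F⁺ k} u
      1<pᵏ : 1ℚ < p ^ area k
      1<pᵏ = ≤-<-trans (1≤ι (1≤F⁺ k)) F⁺<pᵏ
      1≤q : 1ℚ ≤ q
      1≤q = <⇒≤ (<-trans (pow-cancel-< (area k) (<⇒≤ 0<p)
        (subst (_< p ^ area k) (sym (1^ (area k))) 1<pᵏ)) p<q)
      squeeze = pow-squeeze (<⇒≤ 1<pᵏ) (pow-mono-< (area k) (<⇒≤ 0<p) p<q)
      M = proj₁ squeeze

      large : ∀ m n → 1 ℕ.≤ m → 1 ℕ.≤ n → suc M ℕ.* suc k ℕ.≤ m → suc M ℕ.* suc k ℕ.≤ n →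
        ι (f m n) < q ^ numVertices m n
      large m n 1≤m 1≤n N≤m N≤n =
        let s , M≤s , s≤m , m≤s = blocksOf k M m N≤m
            t , M≤t , t≤n , n≤t = blocksOf k M n N≤n
        in begin-strict
        ι (f m n)
          ≤⟨ ι-mono-≤ (count-≤ k (suc s) (suc t) 1≤m 1≤n m≤s n≤t) ⟩
        ι (F⁺ k ℕ.^ ((2 ℕ.+ s) ℕ.* (2 ℕ.+ t)))        <⟨ ι-^-< ((2 ℕ.+ s) ℕ.* (2 ℕ.+ t)) F⁺<pᵏ ⟩
        (p ^ area k) ^ ((2 ℕ.+ s) ℕ.* (2 ℕ.+ t))      ≤⟨ proj₂ squeeze s t M≤s M≤t ⟩
        (q ^ area k) ^ (s ℕ.* t)                      ≡⟨ ^-* q (area k) (s ℕ.* t) ⟩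
        q ^ (area k ℕ.* (s ℕ.* t))
          ≤⟨ pow-monoʳ-≤ 1≤q (numVertices-≥ k s t s≤m t≤n) ⟩
        q ^ numVertices m n                           ∎

    η-limit : ∀ ε → 0ℚ < ε → ∃ λ N → ∀ m n (2≤m : 2 ℕ.≤ m) (2≤n : 2 ℕ.≤ n) → N ℕ.≤ m → N ℕ.≤ n →
      ∣ root (numVertices m n) {{numVertices-nonZero 2≤m 2≤n}} (f m n) - η ∣< ε
    η-limit ε 0<ε =
      let a , b , la , ub , b<a+ε = approximate η 0<ε
          a+ε-ε≡a = trans (+-assoc a ε (- ε))
            (trans (cong (λ z → a + z) (+-inverseʳ ε)) (+-identityʳ a))
          N  , upper = eventually-upper b<a+ε ub
          N′ , lower = eventually-lower (subst (b - ε <_) a+ε-ε≡a (+-monoˡ-< (- ε) b<a+ε)) la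
      -- First half: a + ε lies above the roots and a = (a + ε) - ε below η. Second half: b lies
      -- above η and b - ε < a below the roots.
      in N ℕ.⊔ N′ , λ m n 2≤m 2≤n N≤m N≤n →
        (a + ε , upper m n 2≤m 2≤n (ℕ.≤-trans (ℕ.m≤m⊔n N N′) N≤m) (ℕ.≤-trans (ℕ.m≤m⊔n N N′) N≤n) ,
          subst (Lower η) (sym a+ε-ε≡a) la) ,
        (b , ub , lower m n 2≤m 2≤n (ℕ.≤-trans (ℕ.m≤n⊔m N N′) N≤m) (ℕ.≤-trans (ℕ.m≤n⊔m N N′) N≤n))

    lower-bound : ∀ k {p} → p ^ area k ≤ ι (F k) → fromℚ p ≤ᴿ η
    lower-bound k {p} pᵏ≤F q q<p = k , decide (q <? 0ℚ)
      where
      decide : Dec (q < 0ℚ) → Lower (root (area k) (F k)) q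
      decide (yes q<0) = inj₁ q<0
      decide (no  q≮0) = lower-root {area k} {F k}
        (<-≤-trans (pow-mono-< (area k) (≮⇒≥ q≮0) q<p) pᵏ≤F)

    -- The lower cut is open, so points strictly above p suffice.
    upper-bound : ∀ {p} → (∀ {q} → p < q → Upper η q) → η ≤ᴿ fromℚ p
    upper-bound {p} upper q l = let r , q<r , l′ = lower-open η {q} l in
      <-≤-trans q<r (≮⇒≥ (λ p<r → disjoint η l′ (upper p<r)))

-- The numerical bounds

module Conclusion where

  open import Defs hiding (*-mono-≤)
  open RationalPowers
  open SquareBlocks
  open Certificates
  open Links using (1≤f; f≡Z)
  open TransferMatrix using (Z)
  open SquareLimit
  open import Data.Integer.Base as ℤ using (+_)
  import Data.Integer.Properties as ℤ
  open import Data.Nat.Base as ℕ using (ℕ; suc)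
  import Data.Nat.Properties as ℕ
  import Data.Nat.Tactic.RingSolver as ℕ
  open import Data.Product using (∃; _×_; _,_; proj₁; proj₂)
  open import Data.Rational.Base hiding (NonZero)
  open import Data.Rational.Properties
  import Data.Rational.Unnormalised.Base as ℚᵘ
  import Data.Rational.Unnormalised.Properties as ℚᵘ
  open import Relation.Binary.PropositionalEquality

  -- The decimal constants enter the estimates only through this relation between integers.
  /-*-ι : ∀ a d → (+ a / suc d) * ι (suc d) ≡ ι a
  /-*-ι a d = toℚᵘ-injective (begin
    toℚᵘ ((+ a / suc d) * ι (suc d))                   ≈⟨ toℚᵘ-homo-* (+ a / suc d) (ι (suc d)) ⟩
    toℚᵘ (+ a / suc d) ℚᵘ.* toℚᵘ (ι (suc d))
      ≈⟨ ℚᵘ.*-cong (toℚᵘ-fromℚᵘ (ℚᵘ.mkℚᵘ (+ a) d)) (toℚᵘ-ι (suc d)) ⟩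
    ℚᵘ.mkℚᵘ (+ a) d ℚᵘ.* ℚᵘ.mkℚᵘ (+ suc d) 0
      ≈⟨ ℚᵘ.*≡* (trans (ℤ.*-identityʳ _) (cong (λ n → + a ℤ.* + n) (sym (ℕ.*-identityʳ (suc d))))) ⟩
    ℚᵘ.mkℚᵘ (+ a) 0                                    ≈⟨ toℚᵘ-ι a ⟨
    toℚᵘ (ι a)                                         ∎)
    where open ℚᵘ.≃-Reasoning

  -- s + 1 strips of m + 1 rows stack to the square of side k + 1, and `e` is the share of its area
  -- that falls to one strip.
  power-lower : ∀ {p} a d e s m k → 1 ℕ.≤ d → p * ι d ≡ ι a → suc s ℕ.* suc m ≡ suc k →
    e ℕ.* suc s ≡ area k →
    a ℕ.^ e ℕ.≤ d ℕ.^ e ℕ.* f (suc m) (suc k) → p ^ area k ≤ ι (f (suc k) (suc k))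
  power-lower {p} a d e s m k 1≤d pd≡a sm≡k es≡area le =
    *-cancel-≤ˡ (ι d ^ area k) (pow-pos (area k) (0<ι 1≤d)) (begin
    ι d ^ area k * p ^ area k                          ≡⟨ ^-distrib (ι d) p (area k) ⟨
    (ι d * p) ^ area k
      ≡⟨ cong (_^ area k) (trans (*-comm (ι d) p) pd≡a) ⟩
    ι a ^ area k                                       ≡⟨ ι-^ a (area k) ⟨
    ι (a ℕ.^ area k)                                   ≤⟨ ι-mono-≤ bound ⟩
    ι (d ℕ.^ area k ℕ.* f (suc k) (suc k))             ≡⟨ ι-* (d ℕ.^ area k) (f (suc k) (suc k)) ⟩
    ι (d ℕ.^ area k) * ι (f (suc k) (suc k))
      ≡⟨ cong (_* ι (f (suc k) (suc k))) (ι-^ d (area k)) ⟩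
    ι d ^ area k * ι (f (suc k) (suc k))               ∎)
    where
    open ≤-Reasoning
    powers : ∀ x → (x ℕ.^ e) ℕ.^ suc s ≡ x ℕ.^ area k
    powers x = trans (ℕ.^-*-assoc x e (suc s)) (cong (x ℕ.^_) es≡area)
    bound : a ℕ.^ area k ℕ.≤ d ℕ.^ area k ℕ.* f (suc k) (suc k)
    bound = R.begin
      a ℕ.^ area k                                     R.≡⟨ powers a ⟨
      (a ℕ.^ e) ℕ.^ suc s                              R.≤⟨ ℕ.^-monoˡ-≤ (suc s) le ⟩
      (d ℕ.^ e ℕ.* f (suc m) (suc k)) ℕ.^ suc s
        R.≡⟨ ^-distribʳ-* (suc s) (d ℕ.^ e) (f (suc m) (suc k)) ⟩
      (d ℕ.^ e) ℕ.^ suc s ℕ.* f (suc m) (suc k) ℕ.^ suc s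
        R.≤⟨ ℕ.*-mono-≤ (ℕ.≤-reflexive (powers d)) (f-*-≥ s m k) ⟩
      d ℕ.^ area k ℕ.* f (suc s ℕ.* suc m) (suc k)
        R.≡⟨ cong (λ i → d ℕ.^ area k ℕ.* f i (suc k)) sm≡k ⟩
      d ℕ.^ area k ℕ.* f (suc k) (suc k)               R.∎
      where module R = ℕ.≤-Reasoning

  open DoubleLimit f 1≤f f-mono-≤ f-blocks-≥ f-blocks-≤ public using (η; η-limit)
  open DoubleLimit f 1≤f f-mono-≤ f-blocks-≥ f-blocks-≤ hiding (η; η-limit)

  -- The squared estimate has main term u^e with e ≤ 8K², twice the area, and boundary factor (729(c
  -- + 1))^K. For large K the gap between u^(8K²) and q^(8K²) absorbs the latter.
  power-upper : ∀ {u} a d → 1 ℕ.≤ d → 1ℚ ≤ u → u * ι d ≡ ι a →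
    (∃ λ c → ∀ j k → let n = j ℕ.+ 7 ; S = Z (suc (k ℕ.* 4)) n in
      S ℕ.* S ℕ.* ((d ℕ.^ 32) ℕ.^ j) ℕ.^ k ℕ.≤ 3 ℕ.^ n ℕ.* 3 ℕ.^ n ℕ.*
        ((a ℕ.^ 32) ℕ.^ j ℕ.* c) ℕ.^ k) →
    ∀ {q} → u < q → Upper η q
  power-upper {u} a d 1≤d 1≤u ud≡a (c , le) {q} u<q = κ ,
    upper-root {area κ} {F⁺ κ} (<-trans 0<u u<q)
      (pow-cancel-< 2 (pow-nonNeg (area κ) (<⇒≤ (<-trans 0<u u<q))) square<)
    where
    open ≤-Reasoning
    0<u : 0ℚ < u
    0<u = <-≤-trans 0<1 1≤u
    dominates = pow-dominates (pow-pos 8 0<u) (pow-mono-< 8 (<⇒≤ 0<u) u<q) (ι (729 ℕ.* suc c))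
    i = proj₁ dominates
    j k κ K e : ℕ
    -- The array has 4k + 1 rows and j + 8 columns; it is a square of side K for j = 4k - 7, which
    -- requires k ≥ 2.
    j = suc (i ℕ.* 4)
    k = 2 ℕ.+ i
    κ = k ℕ.* 4
    K = suc κ
    e = 32 ℕ.* j ℕ.* k

    i≤K : i ℕ.≤ K
    i≤K = ℕ.≤-trans (ℕ.m≤m*n i 4) (ℕ.m≤n+m (i ℕ.* 4) 9)
    j≤K : j ℕ.≤ K
    j≤K = ℕ.s≤s (ℕ.m≤n+m (i ℕ.* 4) 8)
    k≤K : k ℕ.≤ K
    k≤K = ℕ.≤-trans (ℕ.m≤m*n k 4) (ℕ.n≤1+n κ)

    j+7≡κ : j ℕ.+ 7 ≡ κ
    j+7≡κ = cong suc (ℕ.+-comm (i ℕ.* 4) 7)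

    nat-bound : F⁺ κ ℕ.^ 2 ℕ.* d ℕ.^ e ℕ.≤ (729 ℕ.* suc c) ℕ.^ K ℕ.* a ℕ.^ e
    nat-bound = square-bound a d c (F κ) j k κ K (ℕ.n≤1+n κ) k≤K
      (subst (λ S →
        S ℕ.* S ℕ.* ((d ℕ.^ 32) ℕ.^ j) ℕ.^ k ℕ.≤ 3 ℕ.^ κ ℕ.* 3 ℕ.^ κ ℕ.*
          ((a ℕ.^ 32) ℕ.^ j ℕ.* c) ℕ.^ k)
        (sym (f≡Z κ κ))
        (subst (λ n →
          Z K n ℕ.* Z K n ℕ.* ((d ℕ.^ 32) ℕ.^ j) ℕ.^ k ℕ.≤ 3 ℕ.^ n ℕ.* 3 ℕ.^ n ℕ.*
            ((a ℕ.^ 32) ℕ.^ j ℕ.* c) ℕ.^ k)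
          j+7≡κ (le j k)))

    square≤ : ι (F⁺ κ) ^ 2 ≤ ι (729 ℕ.* suc c) ^ K * u ^ e
    square≤ = *-cancel-≤ˡ (ι d ^ e) (pow-pos e (0<ι 1≤d)) (begin
      ι d ^ e * ι (F⁺ κ) ^ 2                      ≡⟨ *-comm (ι d ^ e) (ι (F⁺ κ) ^ 2) ⟩
      ι (F⁺ κ) ^ 2 * ι d ^ e                      ≡⟨ cong₂ _*_ (ι-^ (F⁺ κ) 2) (ι-^ d e) ⟨
      ι (F⁺ κ ℕ.^ 2) * ι (d ℕ.^ e)                ≡⟨ ι-* (F⁺ κ ℕ.^ 2) (d ℕ.^ e) ⟨
      ι (F⁺ κ ℕ.^ 2 ℕ.* d ℕ.^ e)                  ≤⟨ ι-mono-≤ nat-bound ⟩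
      ι ((729 ℕ.* suc c) ℕ.^ K ℕ.* a ℕ.^ e)       ≡⟨ ι-* ((729 ℕ.* suc c) ℕ.^ K) (a ℕ.^ e) ⟩
      ι ((729 ℕ.* suc c) ℕ.^ K) * ι (a ℕ.^ e)
        ≡⟨ cong₂ _*_ (ι-^ (729 ℕ.* suc c) K)
          (trans (ι-^ a e) (trans (cong (_^ e) (sym ud≡a)) (^-distrib u (ι d) e))) ⟩
      ι (729 ℕ.* suc c) ^ K * (u ^ e * ι d ^ e)
        ≡⟨ trans (sym (*-assoc (ι (729 ℕ.* suc c) ^ K) (u ^ e) (ι d ^ e)))
          (*-comm (ι (729 ℕ.* suc c) ^ K * u ^ e) (ι d ^ e)) ⟩
      ι d ^ e * (ι (729 ℕ.* suc c) ^ K * u ^ e)   ∎)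

    e≤8KK : e ℕ.≤ 8 ℕ.* (K ℕ.* K)
    e≤8KK = R.begin
      32 ℕ.* j ℕ.* k               R.≡⟨ regroup j k ⟩
      8 ℕ.* (j ℕ.* (k ℕ.* 4))      R.≤⟨ ℕ.*-monoʳ-≤ 8 (ℕ.*-mono-≤ j≤K (ℕ.n≤1+n κ)) ⟩
      8 ℕ.* (K ℕ.* K)              R.∎
      where
      module R = ℕ.≤-Reasoning
      regroup : ∀ j k → 32 ℕ.* j ℕ.* k ≡ 8 ℕ.* (j ℕ.* (k ℕ.* 4))
      regroup = ℕ.solve-∀

    eighth : ∀ x → ((x ^ 8) ^ K) ^ K ≡ x ^ (8 ℕ.* (K ℕ.* K))
    eighth x = trans (^-* (x ^ 8) K K) (^-* x 8 (K ℕ.* K))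

    square< : ι (F⁺ κ) ^ 2 < (q ^ area κ) ^ 2
    square< = begin-strict
      ι (F⁺ κ) ^ 2                                         ≤⟨ square≤ ⟩
      ι (729 ℕ.* suc c) ^ K * u ^ e
        ≤⟨ *-monoˡ (pow-nonNeg K (0≤ι (729 ℕ.* suc c))) (pow-monoʳ-≤ 1≤u e≤8KK) ⟩
      ι (729 ℕ.* suc c) ^ K * u ^ (8 ℕ.* (K ℕ.* K))
        ≡⟨ cong (ι (729 ℕ.* suc c) ^ K *_) (eighth u) ⟨
      ι (729 ℕ.* suc c) ^ K * ((u ^ 8) ^ K) ^ K
        ≡⟨ ^-distrib (ι (729 ℕ.* suc c)) ((u ^ 8) ^ K) K ⟨
      (ι (729 ℕ.* suc c) * (u ^ 8) ^ K) ^ K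
        <⟨ pow-mono-< K (*-nonNeg (0≤ι (729 ℕ.* suc c)) (pow-nonNeg K (pow-nonNeg 8 (<⇒≤ 0<u))))
          (proj₂ dominates K i≤K) ⟩
      ((q ^ 8) ^ K) ^ K                                    ≡⟨ eighth q ⟩
      q ^ (8 ℕ.* (K ℕ.* K))
        ≡⟨ cong (q ^_) (trans (double (K ℕ.* K)) (cong (ℕ._* 2) (sym (area≡ κ)))) ⟩
      q ^ (area κ ℕ.* 2)                                   ≡⟨ ^-* q (area κ) 2 ⟨
      (q ^ area κ) ^ 2                                     ∎
      where
      double : ∀ x → 8 ℕ.* x ≡ 4 ℕ.* x ℕ.* 2
      double = ℕ.solve-∀

  /-≥1 : ∀ a d → suc d ℕ.≤ a → 1ℚ ≤ + a / suc d
  /-≥1 a d d≤a = *-cancel-≤ˡ (ι (suc d)) (0<ι (ℕ.s≤s ℕ.z≤n))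
    (subst₂ _≤_ (sym (*-identityʳ (ι (suc d))))
      (trans (sym (/-*-ι a d)) (*-comm (+ a / suc d) (ι (suc d)))) (ι-mono-≤ d≤a))

  Z-lower : ∀ {p} a d e s m k → 1 ℕ.≤ d → p * ι d ≡ ι a → suc s ℕ.* suc m ≡ suc k →
    e ℕ.* suc s ≡ area k →
    a ℕ.^ e ℕ.≤ d ℕ.^ e ℕ.* Z (suc m) k → fromℚ p ≤ᴿ η
  Z-lower a d e s m k 1≤d pd≡a sm≡k es≡area le =
    lower-bound k (power-lower a d e s m k 1≤d pd≡a sm≡k es≡area
    (subst (λ z → a ℕ.^ e ℕ.≤ d ℕ.^ e ℕ.* z) (sym (f≡Z m k)) le))

  η-lower : fromℚ (+ 1467007628 / 1000000000) ≤ᴿ η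
  -- Five strips of 4 rows make 20 rows, and 5 · 320 = 4 · 20².
  η-lower = Z-lower 1467007628 1000000000 320 4 3 19 (ℕ.s≤s ℕ.z≤n) (/-*-ι 1467007628 999999999) refl
    (sym (area≡ 19)) Z-4-19

  η-upper : η ≤ᴿ fromℚ (+ 1549560102 / 1000000000)
  η-upper = upper-bound (power-upper 1549560102 1000000000 (ℕ.s≤s ℕ.z≤n)
      (/-≥1 1549560102 999999999 (ℕ.≤ᵇ⇒≤ 1000000000 1549560102 _))
        (/-*-ι 1549560102 999999999) Z-upper)

open Conclusion using (η; η-limit; η-lower; η-upper)
open import Defs
open import Data.Integer.Base using (+_)
open import Data.Product using (∃; _×_; _,_)
open import Data.Rational.Base using (_/_)

mainTheorem6 : ∃ λ (η : ℝ) → IsEntropyConstant η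
    × fromℚ (+ 1467007628 / 1000000000) ≤ᴿ η
    × η ≤ᴿ fromℚ (+ 1549560102 / 1000000000)
mainTheorem6 = η , η-limit , η-lower , η-upper
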